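{- The following problem is decidable. Input: an orbit-finite equivariant set $Q$ with the integer atoms, an equivariant subset $F\subseteq Q$, and semilinear but not necessarily equivariant functions $\delta_1,\ldots,\delta_n:Q\to Q$. Question: is there an equivalence relation $\equiv$ on $Q$ which (1) is nontrivial, i.e.\ identifies at least two different elements; (2) respects $F$, i.e.\ $p\equiv q$ implies ($p\in F \iff q\in F$); (3) is a congruence with respect to $\delta_1,\ldots,\delta_n$, i.e.\ $p\equiv q$ implies $\delta_i(p)\equiv\delta_i(q)$ for all $i$; and (4) is equivariant?
   Context: Integer atoms: the atoms are the integers $\mathbb{Z}$ with the successor function; the automorphisms are exactly the translations $x\mapsto x+z$, acting hereditarily on sets built from atoms (on pairs componentwise). A set or relation is equivariant if invariant under all translations; an equivariant set is orbit-finite if it is a finite union of orbits. For $k\ge1$, $\mathbb{Z}_k$ is the integers modulo $k$ with translations acting by addition, $\mathbb{Z}_0=\mathbb{Z}$; every equivariant single-orbit set is equivariantly isomorphic to some $\mathbb{Z}_k$. The input $Q$ is given by the list of characteristics $k$ of its orbits. A monomial set is a finite product of equivariant single-orbit sets, a polynomial set a finite disjoint union of monomials. A subset of $\mathbb{Z}^m$ is semilinear if Presburger-definable; every subset of $\mathbb{Z}_k$ ($k\ge1$) is semilinear; subsets of general monomials and polynomial sets are semilinear if semilinear after transport along equivariant isomorphisms to disjoint unions of monomials $\mathbb{Z}^m$, $\mathbb{Z}_k$ (via $\mathbb{Z}_k\times\mathbb{Z}\cong k$ copies of $\mathbb{Z}$, $\mathbb{Z}_k\times\mathbb{Z}_l\cong\mathbb{Z}_{\mathrm{lcm}(k,l)}$),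 componentwise. A function $Q\to Q$ is semilinear if its graph is a semilinear subset of $Q\times Q$; the functions are given by Presburger descriptions on each monomial. -}

module Defs where

open import Data.Nat as ℕ using (ℕ; zero; suc)
open import Data.Integer as ℤ using (ℤ; +_)
open import Data.Integer.DivMod using (_%ℕ_; n%ℕd<d)
open import Data.Fin as Fin using (Fin; fromℕ<; toℕ)
open import Data.List using (List; length; lookup)
open import Data.Product using (Σ; _×_; _,_; ∃)
open import Data.Sum using (_⊎_)
open import Data.Bool using (Bool; true)
open import Data.Empty using (⊥)
open import Relation.Nullary using (¬_)
open import Relation.Binary.PropositionalEquality using (_≡_)
open import Relation.Binary.Structures using (IsEquivalence)

-- Single-orbit equivariant sets ℤ_k  (ℤ_0 = ℤ, ℤ_k = integers mod k)

Zk : ℕ → Set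
Zk zero    = ℤ
Zk (suc k) = Fin (suc k)

proj : (k : ℕ) → ℤ → Zk k
proj zero    x = x
proj (suc k) x = fromℕ< (n%ℕd<d x (suc k))

rep : (k : ℕ) → Zk k → ℤ
rep zero    x = x
rep (suc k) x = + toℕ x

actZ : (k : ℕ) → ℤ → Zk k → Zk k
actZ k z a = proj k (z ℤ.+ rep k a)

-- Orbit-finite equivariant sets, given by the list of characteristics
-- of their orbits: Q ks = ℤ_{k₁} ⊔ … ⊔ ℤ_{kₘ}

Orb : List ℕ → Set
Orb ks = Fin (length ks)

Q : List ℕ → Set
Q ks = Σ (Orb ks) (λ i → Zk (lookup ks i))

act : (ks : List ℕ) → ℤ → Q ks → Q ks
act ks z (i , a) = i , actZ (lookup ks i) z a

elem : (ks : List ℕ) → Orb ks → ℤ → Q ks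
elem ks i x = i , proj (lookup ks i) x

data Term (n : ℕ) : Set where
  var  : Fin n → Term n
  lit  : ℤ → Term n
  _⊕_  : Term n → Term n → Term n
  ⊝_   : Term n → Term n

data Formula (n : ℕ) : Set where
  _≐_  : Term n → Term n → Formula n
  _≼_  : Term n → Term n → Formula n
  ¬′_  : Formula n → Formula n
  _∧′_ : Formula n → Formula n → Formula n
  _∨′_ : Formula n → Formula n → Formula n
  ∃′_  : Formula (suc n) → Formula n
  ∀′_  : Formula (suc n) → Formula n

Env : ℕ → Set
Env n = Fin n → ℤ

extend : ∀ {n} → ℤ → Env n → Env (suc n)
extend x ρ Fin.zero    = x
extend x ρ (Fin.suc i) = ρ i

⟦_⟧t : ∀ {n} → Term n → Env n → ℤ
⟦ var i ⟧t ρ = ρ i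
⟦ lit c ⟧t ρ = c
⟦ s ⊕ t ⟧t ρ = ⟦ s ⟧t ρ ℤ.+ ⟦ t ⟧t ρ
⟦ ⊝ t ⟧t ρ   = ℤ.- ⟦ t ⟧t ρ

⟦_⟧ : ∀ {n} → Formula n → Env n → Set
⟦ s ≐ t ⟧ ρ   = ⟦ s ⟧t ρ ≡ ⟦ t ⟧t ρ
⟦ s ≼ t ⟧ ρ   = ⟦ s ⟧t ρ ℤ.≤ ⟦ t ⟧t ρ
⟦ ¬′ φ ⟧ ρ    = ¬ ⟦ φ ⟧ ρ
⟦ φ ∧′ ψ ⟧ ρ  = ⟦ φ ⟧ ρ × ⟦ ψ ⟧ ρ
⟦ φ ∨′ ψ ⟧ ρ  = ⟦ φ ⟧ ρ ⊎ ⟦ ψ ⟧ ρ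
⟦ ∃′ φ ⟧ ρ    = Σ ℤ (λ x → ⟦ φ ⟧ (extend x ρ))
⟦ ∀′ φ ⟧ ρ    = (x : ℤ) → ⟦ φ ⟧ (extend x ρ)

env2 : ℤ → ℤ → Env 2
env2 x y Fin.zero    = x
env2 x y (Fin.suc _) = y

-- Semilinear functions Q → Q, given together with their Presburger
-- description: for each pair of orbits (i , j), a formula φ i j in two
-- free variables such that, for all integers x y,
--   δ (elem i x) ≡ elem j y  iff  φ i j (x , y).
-- (The graph restricted to ℤ_{kᵢ} × ℤ_{kⱼ}, pulled back along ℤ×ℤ → ℤ_{kᵢ}×ℤ_{kⱼ},
--  is Presburger definable.)

record SemilinearFun (ks : List ℕ) : Set where
  field
    fun   : Q ks → Q ks
    descr : Orb ks → Orb ks → Formula 2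
    defines : ∀ i j (x y : ℤ) →
      (fun (elem ks i x) ≡ elem ks j y → ⟦ descr i j ⟧ (env2 x y)) ×
      (⟦ descr i j ⟧ (env2 x y) → fun (elem ks i x) ≡ elem ks j y)

EquivariantSubset : (ks : List ℕ) → (Q ks → Bool) → Set
EquivariantSubset ks F = ∀ (z : ℤ) (p : Q ks) → F (act ks z p) ≡ F p

EquivariantRel : (ks : List ℕ) → (Q ks → Q ks → Set) → Set
EquivariantRel ks R = ∀ (z : ℤ) (p q : Q ks) →
  (R p q → R (act ks z p) (act ks z q)) × (R (act ks z p) (act ks z q) → R p q)

Nontrivial : (ks : List ℕ) → (Q ks → Q ks → Set) → Set
Nontrivial ks R = Σ (Q ks) (λ p → Σ (Q ks) (λ q → ¬ (p ≡ q) × R p q))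

RespectsF : (ks : List ℕ) → (Q ks → Bool) → (Q ks → Q ks → Set) → Set
RespectsF ks F R = ∀ p q → R p q → (F p ≡ true → F q ≡ true) × (F q ≡ true → F p ≡ true)

Congruence : (ks : List ℕ) (n : ℕ) → (Fin n → SemilinearFun ks) → (Q ks → Q ks → Set) → Set
Congruence ks n δ R = ∀ (i : Fin n) p q → R p q → R (SemilinearFun.fun (δ i) p) (SemilinearFun.fun (δ i) q)

GoodCongruenceExists : (ks : List ℕ) → (Q ks → Bool) → (n : ℕ) → (Fin n → SemilinearFun ks) → Set₁
GoodCongruenceExists ks F n δ =
  Σ (Q ks → Q ks → Set) (λ R →
    IsEquivalence R × Nontrivial ks R × RespectsF ks F R × Congruence ks n δ R × EquivariantRel ks R)

{-# OPTIONS --safe #-}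

-- An equivariant equivalence relation on a disjoint union of copies of ℤ/k is described by
-- a partition of the orbits, a period m i for every orbit, and offsets between the orbits of
-- a class.  For fixed periods, the existence of suitable offsets is a Presburger sentence, so it
-- suffices to bound the periods.  Given a solution R, choose a threshold b in a large gap of
-- the finitely many periods and offsets of R.  Identifying only the R-related points at distance
-- at most b (and their consequences) is again a solution, with periods at most b.  If it is
-- trivial, then on the orbits with a large period all maps have to be affine along residue classes
-- on the whole of ℤ, with rational slopes a / D.  Identifying x with x + w i on those orbits, and
-- nothing else, is then a solution as soon as D w j divides a w i for every edge i → j of slope a.
-- Such weights w exist because denominators cannot accumulate along a path: among the images of
-- K + 1 multiples of a period two lie in the same orbit, so that K! times the image of a period
-- is a period.  Finally, the weights reachable from a least one are bounded multiples of it.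
module Submission where

open import Defs
open import Data.Bool using (Bool; true; false; not; _∧_; _∨_)
open import Data.Bool.Properties using (∨-zeroʳ) renaming (_≟_ to _≟ᵇ_)
open import Data.Empty using (⊥; ⊥-elim)
open import Data.Fin using (Fin; zero; suc; toℕ; fromℕ<; combine; remQuot)
import Data.Fin.Properties as Fin
open import Data.Fin.Properties using (toℕ-fromℕ<; remQuot-combine; pigeonhole; toℕ≤pred[n]) renaming (_≟_ to _≟ᶠ_)
open import Data.Integer hiding (suc; _≟_; neg)
open import Data.Integer.Divisibility.Signed
open import Data.Integer.DivMod using (a≡a%ℕn+[a/ℕn]*n; n%ℕd<d; _%ℕ_; _/ℕ_)
open import Data.Integer.Properties renaming (_≟_ to _≟ᶻ_)
open import Data.Integer.Tactic.RingSolver using (solve-∀)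
open import Data.List using (List; []; _∷_; _++_; map; upTo; concatMap; allFin; length; lookup)
open import Data.List.Membership.Propositional using (_∈_)
open import Data.List.Membership.Propositional.Properties
  using (∈-++⁺ˡ; ∈-++⁺ʳ; ∈-map⁺; ∈-upTo⁺; ∈-concatMap⁺; ∈-++⁻; ∈-allFin; ∈-concat⁺′)
open import Data.List.Relation.Unary.Any using (Any; here; there)
open import Data.Nat as ℕ using (ℕ; zero; suc; z≤n; s≤s; _!)
import Data.Nat.DivMod as ℕ
import Data.Nat.Divisibility as ℕ
open import Data.Nat.Induction using (<-wellFounded)
open import Data.Nat.ListAction using (sum; product)
import Data.Nat.Properties as ℕ
import Data.Nat.Tactic.RingSolver as ℕ-Solver
open import Data.Product using (Σ; ∃; _×_; _,_; proj₁; proj₂; uncurry)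
open import Data.Sum using (_⊎_; inj₁; inj₂; map₂)
open import Data.Unit using (⊤; tt)
open import Data.Vec as Vec using (Vec; []; _∷_)
open import Data.Vec.Properties using (lookup∘tabulate)
open import Function using (_∘_; case_of_)
open import Induction.WellFounded using (Acc; acc)
open import Relation.Binary.PropositionalEquality
open import Relation.Binary.Structures using (IsEquivalence)
open import Relation.Nullary using (¬_; Dec; yes; no)
open import Relation.Nullary.Decidable using (⌊_⌋; map′; ¬?; _×-dec_; _⊎-dec_; _→-dec_)

-- Quantifier elimination for Presburger arithmetic

-- The periods are the obstacle: offsets can be quantified in a Presburger sentence, but
-- divisibility by an unknown period leaves Presburger arithmetic. So the periods must be bounded by
-- a number computed from the input alone.
--
-- Why a gap exists: "the period of i is positive and at most b" and "some offset from i to j has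
-- size at most b" are K (K + 1) conditions monotone in b. Along a fixed sequence of thresholds each
-- of them switches at most once, so some step of the sequence sees no switch.
--
-- What the gap buys: its width exceeds the constants of the maps that occur in the argument, so
-- bounded integers that agree modulo a period beyond the gap are equal. Congruences modulo unknown
-- periods thereby become equations between slopes and offsets.
--
-- The given relation is an arbitrary family of types, so its periods and classes cannot be
-- computed. Statements about it are proved under double negation. This suffices, because the search
-- over bounded periods is decidable and a failed search only has to be turned into a contradiction.

infixr 5 _∷ₗ_

data Lin : ℕ → Set where
  con  : ℤ → Lin 0
  _∷ₗ_ : ∀ {n} → ℤ → Lin n → Lin (suc n)

value : ∀ {n} → Lin n → Env n → ℤ
value (con c)  ρ = c
value (a ∷ₗ t) ρ = a * ρ zero + value t (ρ ∘ suc)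

infixl 6 _+ₗ_
infixl 7 _*ₗ_

_+ₗ_ : ∀ {n} → Lin n → Lin n → Lin n
con c    +ₗ con d    = con (c + d)
(a ∷ₗ s) +ₗ (b ∷ₗ t) = a + b ∷ₗ s +ₗ t

_*ₗ_ : ∀ {n} → ℤ → Lin n → Lin n
c *ₗ con d    = con (c * d)
c *ₗ (a ∷ₗ t) = c * a ∷ₗ c *ₗ t

litₗ : ∀ {n} → ℤ → Lin n
litₗ {zero}  c = con c
litₗ {suc n} c = + 0 ∷ₗ litₗ c

varₗ : ∀ {n} → Fin n → Lin n
varₗ zero    = + 1 ∷ₗ litₗ (+ 0)
varₗ (suc i) = + 0 ∷ₗ varₗ i

value-+ₗ : ∀ {n} (s t : Lin n) ρ → value (s +ₗ t) ρ ≡ value s ρ + value t ρ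
value-+ₗ (con c)  (con d)  ρ = refl
value-+ₗ (a ∷ₗ s) (b ∷ₗ t) ρ rewrite value-+ₗ s t (ρ ∘ suc) = shuffle a b (ρ zero) _ _
  where
  shuffle : ∀ a b x u v → (a + b) * x + (u + v) ≡ a * x + u + (b * x + v)
  shuffle = solve-∀

value-*ₗ : ∀ {n} c (t : Lin n) ρ → value (c *ₗ t) ρ ≡ c * value t ρ
value-*ₗ c (con d)  ρ = refl
value-*ₗ c (a ∷ₗ t) ρ rewrite value-*ₗ c t (ρ ∘ suc) = shuffle c a (ρ zero) _
  where
  shuffle : ∀ c a x v → c * a * x + c * v ≡ c * (a * x + v)
  shuffle = solve-∀

value-litₗ : ∀ {n} c (ρ : Env n) → value (litₗ {n} c) ρ ≡ c
value-litₗ {zero}  c ρ = refl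
value-litₗ {suc n} c ρ rewrite value-litₗ c (ρ ∘ suc) = +-identityˡ c

value-varₗ : ∀ {n} i (ρ : Env n) → value (varₗ i) ρ ≡ ρ i
value-varₗ zero    ρ rewrite value-litₗ (+ 0) (ρ ∘ suc) = trans (+-identityʳ _) (*-identityˡ _)
value-varₗ (suc i) ρ rewrite value-varₗ i (ρ ∘ suc) = +-identityˡ _

value-ext : ∀ {n} (t : Lin n) {ρ σ : Env n} → (∀ i → ρ i ≡ σ i) → value t ρ ≡ value t σ
value-ext (con c)  eq = refl
value-ext (a ∷ₗ t) eq = cong₂ (λ x v → a * x + v) (eq zero) (value-ext t (eq ∘ suc))

renameₗ : ∀ {n m} → (Fin n → Fin m) → Lin n → Lin m
renameₗ f (con c)  = litₗ c
renameₗ f (a ∷ₗ t) = a *ₗ varₗ (f zero) +ₗ renameₗ (f ∘ suc) t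

value-renameₗ : ∀ {n m} (f : Fin n → Fin m) t ρ → value (renameₗ f t) ρ ≡ value t (ρ ∘ f)
value-renameₗ f (con c)  ρ = value-litₗ c ρ
value-renameₗ f (a ∷ₗ t) ρ
  rewrite value-+ₗ (a *ₗ varₗ (f zero)) (renameₗ (f ∘ suc) t) ρ
        | value-*ₗ a (varₗ (f zero)) ρ
        | value-varₗ (f zero) ρ
        | value-renameₗ (f ∘ suc) t ρ = refl

-- In dv d t the modulus is suc d.
data Atom (n : ℕ) : Set where
  ge : Lin n → Atom n
  dv : ℕ → Lin n → Atom n

-- Negation stays a constructor: the elimination only asks where atoms change their truth value, so
-- no normal form is computed.
data QF (n : ℕ) : Set where
  at       : Atom n → QF n
  bool     : Bool → QF n
  neg      : QF n → QF n
  and or   : QF n → QF n → QF n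

evA : ∀ {n} → Atom n → Env n → Bool
evA (ge t)   ρ = ⌊ + 0 ≤? value t ρ ⌋
evA (dv d t) ρ = ⌊ + suc d ∣? value t ρ ⌋

ev : ∀ {n} → QF n → Env n → Bool
ev (at α)    ρ = evA α ρ
ev (bool b)  ρ = b
ev (neg φ)   ρ = not (ev φ ρ)
ev (and φ ψ) ρ = ev φ ρ ∧ ev ψ ρ
ev (or φ ψ)  ρ = ev φ ρ ∨ ev ψ ρ

atoms : ∀ {n} → QF n → List (Atom n)
atoms (at α)    = α ∷ []
atoms (bool b)  = []
atoms (neg φ)   = atoms φ
atoms (and φ ψ) = atoms φ ++ atoms ψ
atoms (or φ ψ)  = atoms φ ++ atoms ψ

⌊⌋-cong : ∀ {P R : Set} (p : Dec P) (r : Dec R) → (P → R) → (R → P) → ⌊ p ⌋ ≡ ⌊ r ⌋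
⌊⌋-cong (yes p) (yes r) f g = refl
⌊⌋-cong (yes p) (no ¬r) f g = ⊥-elim (¬r (f p))
⌊⌋-cong (no ¬p) (yes r) f g = ⊥-elim (¬p (g r))
⌊⌋-cong (no ¬p) (no ¬r) f g = refl

⌊⌋-true : ∀ {P : Set} (p : Dec P) → P → ⌊ p ⌋ ≡ true
⌊⌋-true (yes _) _ = refl
⌊⌋-true (no ¬p) p = ⊥-elim (¬p p)

true-⌊⌋ : ∀ {P : Set} (p : Dec P) → ⌊ p ⌋ ≡ true → P
true-⌊⌋ (yes p) _ = p

evA-ext : ∀ {n} (α : Atom n) {ρ σ : Env n} → (∀ i → ρ i ≡ σ i) → evA α ρ ≡ evA α σ
evA-ext (ge t)   eq = cong (λ v → ⌊ + 0 ≤? v ⌋) (value-ext t eq)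
evA-ext (dv d t) eq = cong (λ v → ⌊ + suc d ∣? v ⌋) (value-ext t eq)

ev-ext : ∀ {n} (φ : QF n) {ρ σ : Env n} → (∀ i → ρ i ≡ σ i) → ev φ ρ ≡ ev φ σ
ev-ext (at α)    eq = evA-ext α eq
ev-ext (bool b)  eq = refl
ev-ext (neg φ)   eq = cong not (ev-ext φ eq)
ev-ext (and φ ψ) eq = cong₂ _∧_ (ev-ext φ eq) (ev-ext ψ eq)
ev-ext (or φ ψ)  eq = cong₂ _∨_ (ev-ext φ eq) (ev-ext ψ eq)

bindₐ : ∀ {n m} → (Atom n → QF m) → QF n → QF m
bindₐ f (at α)    = f α
bindₐ f (bool b)  = bool b
bindₐ f (neg φ)   = neg (bindₐ f φ)
bindₐ f (and φ ψ) = and (bindₐ f φ) (bindₐ f ψ)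
bindₐ f (or φ ψ)  = or (bindₐ f φ) (bindₐ f ψ)

ev-bindₐ : ∀ {n m} (f : Atom n → QF m) φ {ρ σ} →
           (∀ α → α ∈ atoms φ → ev (f α) σ ≡ evA α ρ) → ev (bindₐ f φ) σ ≡ ev φ ρ
ev-bindₐ f (at α)    eq = eq α (here refl)
ev-bindₐ f (bool b)  eq = refl
ev-bindₐ f (neg φ)   eq = cong not (ev-bindₐ f φ eq)
ev-bindₐ f (and φ ψ) eq = cong₂ _∧_ (ev-bindₐ f φ λ α α∈ → eq α (∈-++⁺ˡ α∈))
                                    (ev-bindₐ f ψ λ α α∈ → eq α (∈-++⁺ʳ (atoms φ) α∈))
ev-bindₐ f (or φ ψ)  eq = cong₂ _∨_ (ev-bindₐ f φ λ α α∈ → eq α (∈-++⁺ˡ α∈))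
                                    (ev-bindₐ f ψ λ α α∈ → eq α (∈-++⁺ʳ (atoms φ) α∈))

-- The atom responsible for a change is returned, because it locates the boundary at which the
-- change happens.
ev-change : ∀ {n} (φ : QF n) (ρ σ : Env n) →
            ev φ ρ ≡ ev φ σ ⊎ ∃ λ α → α ∈ atoms φ × evA α ρ ≢ evA α σ
ev-change (at α) ρ σ with evA α ρ ≟ᵇ evA α σ
... | yes eq = inj₁ eq
... | no neq = inj₂ (α , here refl , neq)
ev-change (bool b) ρ σ = inj₁ refl
ev-change (neg φ) ρ σ with ev-change φ ρ σ
... | inj₁ eq = inj₁ (cong not eq)
... | inj₂ c  = inj₂ c
ev-change (and φ ψ) ρ σ with ev-change φ ρ σ | ev-change ψ ρ σ
... | inj₁ eq₁ | inj₁ eq₂ = inj₁ (cong₂ _∧_ eq₁ eq₂)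
... | inj₂ (α , α∈ , c) | _ = inj₂ (α , ∈-++⁺ˡ α∈ , c)
... | inj₁ _ | inj₂ (α , α∈ , c) = inj₂ (α , ∈-++⁺ʳ (atoms φ) α∈ , c)
ev-change (or φ ψ) ρ σ with ev-change φ ρ σ | ev-change ψ ρ σ
... | inj₁ eq₁ | inj₁ eq₂ = inj₁ (cong₂ _∨_ eq₁ eq₂)
... | inj₂ (α , α∈ , c) | _ = inj₂ (α , ∈-++⁺ˡ α∈ , c)
... | inj₁ _ | inj₂ (α , α∈ , c) = inj₂ (α , ∈-++⁺ʳ (atoms φ) α∈ , c)

period : ∀ {n} → QF n → ℕ
period (at (ge t))   = 1
period (at (dv d t)) = suc d
period (bool b)      = 1
period (neg φ)       = period φ
period (and φ ψ)     = period φ ℕ.* period ψ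
period (or φ ψ)      = period φ ℕ.* period ψ

period>0 : ∀ {n} (φ : QF n) → 0 ℕ.< period φ
period>0 (at (ge t))   = s≤s z≤n
period>0 (at (dv d t)) = s≤s z≤n
period>0 (bool b)      = s≤s z≤n
period>0 (neg φ)       = period>0 φ
period>0 (and φ ψ)     = ℕ.*-mono-≤ (period>0 φ) (period>0 ψ)
period>0 (or φ ψ)      = ℕ.*-mono-≤ (period>0 φ) (period>0 ψ)

∣-period : ∀ {n} (φ : QF n) {d t} → dv d t ∈ atoms φ → suc d ℕ.∣ period φ
∣-period (at (dv d t)) (here refl) = ℕ.∣-refl
∣-period (neg φ)       α∈ = ∣-period φ α∈
∣-period (and φ ψ)     α∈ with ∈-++⁻ (atoms φ) α∈
... | inj₁ p = ℕ.∣m⇒∣m*n (period ψ) (∣-period φ p)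
... | inj₂ p = ℕ.∣n⇒∣m*n (period φ) (∣-period ψ p)
∣-period (or φ ψ)      α∈ with ∈-++⁻ (atoms φ) α∈
... | inj₁ p = ℕ.∣m⇒∣m*n (period ψ) (∣-period φ p)
... | inj₂ p = ℕ.∣n⇒∣m*n (period φ) (∣-period ψ p)

dv-cong : ∀ {n} d (t : Lin n) {ρ σ} → + suc d ∣ value t ρ - value t σ → evA (dv d t) ρ ≡ evA (dv d t) σ
dv-cong d t {ρ} {σ} h = ⌊⌋-cong (_ ∣? _) (_ ∣? _)
  (λ p → subst (_ ∣_) (back (value t ρ) _) (∣m∣n⇒∣m-n p h))
  (λ p → subst (_ ∣_) (forth (value t ρ) _) (∣m∣n⇒∣m+n h p))
  where
  back : ∀ u v → u - (u - v) ≡ v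
  back = solve-∀
  forth : ∀ u v → (u - v) + v ≡ u
  forth = solve-∀

range : ℕ → List ℤ
range M = map +_ (upTo (suc M)) ++ map (λ n → - + n) (upTo (suc M))

∈-range : ∀ M e → ∣ e ∣ ℕ.≤ M → e ∈ range M
∈-range M (+ n)    p = ∈-++⁺ˡ (∈-map⁺ +_ (∈-upTo⁺ (s≤s p)))
∈-range M -[1+ n ] p = ∈-++⁺ʳ (map +_ (upTo (suc M))) (∈-map⁺ (λ n → - + n) (∈-upTo⁺ (s≤s p)))

-- (a , u) stands for the line (1 + a) x = u.
boundaryₐ : ∀ {n} → ℕ → Atom (suc n) → List (ℕ × Lin n)
boundaryₐ Δ (ge (+ 0 ∷ₗ t))      = []
boundaryₐ Δ (ge (+ suc a ∷ₗ t))  = map (λ e → a , litₗ e +ₗ - + 1 *ₗ t) (range (suc a ℕ.* Δ))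
boundaryₐ Δ (ge (-[1+ a ] ∷ₗ t)) = map (λ e → a , t +ₗ - + 1 *ₗ litₗ e) (range (suc a ℕ.* Δ))
boundaryₐ Δ (dv d t)             = []

boundary : ∀ {n} → QF (suc n) → List (ℕ × Lin n)
boundary φ = concatMap (boundaryₐ (period φ)) (atoms φ)

OnBoundary : ∀ {n} → QF (suc n) → Env n → ℤ → Set
OnBoundary φ ρ x = ∃ λ l → l ∈ boundary φ × + suc (proj₁ l) * x ≡ value (proj₂ l) ρ

between₁ : ∀ s c → + 0 ≤ s → ¬ + 0 ≤ s - c → ∣ s ∣ ℕ.≤ ∣ c ∣
between₁ s c p q = go s c p (<⇒≤ (≰⇒> (q ∘ i≤j⇒0≤j-i)))
  where
  go : ∀ s c → + 0 ≤ s → s ≤ c → ∣ s ∣ ℕ.≤ ∣ c ∣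
  go (+ n) (+ m) p (+≤+ q) = q

between₂ : ∀ s c → ¬ + 0 ≤ s → + 0 ≤ s - c → ∣ s ∣ ℕ.≤ ∣ c ∣
between₂ s c p q = go s c p (0≤i-j⇒j≤i q)
  where
  go : ∀ s c → ¬ + 0 ≤ s → c ≤ s → ∣ s ∣ ℕ.≤ ∣ c ∣
  go (+ n) c p q = ⊥-elim (p (+≤+ z≤n))
  go -[1+ n ] -[1+ m ] p (-≤- q) = s≤s q

ge-flip : ∀ s c → ⌊ + 0 ≤? s ⌋ ≢ ⌊ + 0 ≤? s - c ⌋ → ∣ s ∣ ℕ.≤ ∣ c ∣
ge-flip s c neq with + 0 ≤? s | + 0 ≤? s - c
... | yes p | no q = between₁ s c p q
... | no p | yes q = between₂ s c p q
... | yes p | yes q = ⊥-elim (neq refl)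
... | no p | no q = ⊥-elim (neq refl)

private
  shift-value : ∀ a x Δ t → a * (x - Δ) + t ≡ a * x + t - a * Δ
  shift-value = solve-∀

  shift-diff : ∀ a x Δ t → (a * x + t) - (a * (x - Δ) + t) ≡ a * Δ
  shift-diff = solve-∀

-- A step of length Δ changes a x + t by a Δ, so only values e of size at most |a Δ| can be followed
-- by a change of sign. Each of these finitely many e gives one line a x = e - t.
boundaryₐ-complete : ∀ {n} Δ (t : Lin n) a (ρ : Env n) x → a ≢ + 0 →
  ∣ a * x + value t ρ ∣ ℕ.≤ ∣ a * + Δ ∣ →
  ∃ λ l → l ∈ boundaryₐ Δ (ge (a ∷ₗ t)) × + suc (proj₁ l) * x ≡ value (proj₂ l) ρ
boundaryₐ-complete Δ t (+ 0)     ρ x a≢0 small = ⊥-elim (a≢0 refl)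
boundaryₐ-complete Δ t (+ suc a) ρ x a≢0 small =
  _ , ∈-map⁺ _ (∈-range _ e (subst (∣ e ∣ ℕ.≤_) (∣i*j∣≡∣i∣*∣j∣ (+ suc a) (+ Δ)) small)) , eq
  where
  e = + suc a * x + value t ρ
  shuffle : ∀ b v → b ≡ b + v + - + 1 * v
  shuffle = solve-∀
  eq : + suc a * x ≡ value (litₗ e +ₗ - + 1 *ₗ t) ρ
  eq rewrite value-+ₗ (litₗ e) (- + 1 *ₗ t) ρ | value-litₗ e ρ | value-*ₗ (- + 1) t ρ =
    shuffle (+ suc a * x) (value t ρ)
boundaryₐ-complete Δ t -[1+ a ]  ρ x a≢0 small =
  _ , ∈-map⁺ _ (∈-range _ e (subst (∣ e ∣ ℕ.≤_) (∣i*j∣≡∣i∣*∣j∣ -[1+ a ] (+ Δ)) small)) , eq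
  where
  e = -[1+ a ] * x + value t ρ
  shuffle : ∀ b x v → b * x ≡ v + - + 1 * ((- b) * x + v)
  shuffle = solve-∀
  eq : + suc a * x ≡ value (t +ₗ - + 1 *ₗ litₗ e) ρ
  eq rewrite value-+ₗ t (- + 1 *ₗ litₗ e) ρ | value-*ₗ (- + 1) (litₗ e) ρ | value-litₗ e ρ =
    shuffle (+ suc a) x (value t ρ)

-- Divisibility atoms do not notice a step of length `period φ`, so a change of truth value comes
-- from the sign of an inequality.
ev-step : ∀ {n} (φ : QF (suc n)) (ρ : Env n) x → OnBoundary φ ρ x ⊎
          ev φ (extend x ρ) ≡ ev φ (extend (x - + period φ) ρ)
ev-step φ ρ x with ev-change φ (extend x ρ) (extend (x - + period φ) ρ)
... | inj₁ eq = inj₂ eq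
... | inj₂ (dv d (a ∷ₗ t) , α∈ , neq) = ⊥-elim (neq (dv-cong d (a ∷ₗ t)
        {extend x ρ} {extend (x - + period φ) ρ}
          (subst (+ suc d ∣_) (sym (shift-diff a x (+ period φ) (value t ρ)))
          (∣n⇒∣m*n a (∣ᵤ⇒∣ (∣-period φ α∈))))))
... | inj₂ (ge (a ∷ₗ t) , α∈ , neq) = inj₁
  (widen (boundaryₐ-complete (period φ) t a ρ x a≢0 (ge-flip _ _ neq′)))
  where
  neq′ : ⌊ + 0 ≤? a * x + value t ρ ⌋ ≢ ⌊ + 0 ≤? a * x + value t ρ - a * + period φ ⌋
  neq′ eq = neq (trans eq (cong (λ v → ⌊ + 0 ≤? v ⌋) (sym (shift-value a x (+ period φ) (value t ρ)))))
  a≢0 : a ≢ + 0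
  a≢0 refl = neq refl
  widen : (∃ λ l → l ∈ boundaryₐ (period φ) (ge (a ∷ₗ t)) × + suc (proj₁ l) * x ≡ value (proj₂ l) ρ) →
          OnBoundary φ ρ x
  widen (l , l∈ , eq) = l , ∈-concatMap⁺ (boundaryₐ (period φ)) (lift α∈ l∈) , eq
    where
    lift : ∀ {α αs} → α ∈ αs → l ∈ boundaryₐ (period φ) α → Any (λ β → l ∈ boundaryₐ (period φ) β) αs
    lift (here refl) q = here q
    lift (there p)   q = there (lift p q)

-- Cooper's argument: a solution is pushed down by whole periods until it meets a boundary line or
-- has descended as far as desired.
descend : ∀ {n} (φ : QF (suc n)) (ρ : Env n) x → ev φ (extend x ρ) ≡ true → ∀ k →
          (∃ λ y → OnBoundary φ ρ y × ev φ (extend y ρ) ≡ true) ⊎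
          ev φ (extend (x - + k * + period φ) ρ) ≡ true
descend φ ρ x φx zero =
  inj₂ (subst (λ y → ev φ (extend y ρ) ≡ true) (sym (shuffle x)) φx)
  where
  shuffle : ∀ x → x - + 0 ≡ x
  shuffle = solve-∀
descend φ ρ x φx (suc k) with descend φ ρ x φx k
... | inj₁ b  = inj₁ b
... | inj₂ φy with ev-step φ ρ (x - + k * + period φ)
...   | inj₁ b  = inj₁ (_ , b , φy)
...   | inj₂ eq = inj₂ (subst (λ y → ev φ (extend y ρ) ≡ true) (shuffle x (+ k) (+ period φ))
  (trans (sym eq) φy))
  where
  shuffle : ∀ x k Δ → x - k * Δ - Δ ≡ x - (+ 1 + k) * Δ
  shuffle = solve-∀

-- Below the negative of this bound the term a x dominates the rest of an inequality with a nonzero,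
-- so the sign of a alone decides it.
threshold : ∀ {n} → QF (suc n) → Env n → ℕ
threshold (at (ge (a ∷ₗ t)))   ρ = suc ∣ value t ρ ∣
threshold (at (dv d t))        ρ = 0
threshold (bool b)             ρ = 0
threshold (neg φ)              ρ = threshold φ ρ
threshold (and φ ψ)            ρ = threshold φ ρ ℕ.+ threshold ψ ρ
threshold (or φ ψ)             ρ = threshold φ ρ ℕ.+ threshold ψ ρ

∣value∣<threshold : ∀ {n} (φ : QF (suc n)) ρ {a t} → ge (a ∷ₗ t) ∈ atoms φ → ∣ value t ρ ∣ ℕ.< threshold φ ρ
∣value∣<threshold (at (ge (a ∷ₗ t))) ρ (here refl) = ℕ.≤-refl
∣value∣<threshold (neg φ) ρ α∈ = ∣value∣<threshold φ ρ α∈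
∣value∣<threshold (and φ ψ) ρ α∈ with ∈-++⁻ (atoms φ) α∈
... | inj₁ p = ℕ.≤-trans (∣value∣<threshold φ ρ p) (ℕ.m≤m+n _ _)
... | inj₂ p = ℕ.≤-trans (∣value∣<threshold ψ ρ p) (ℕ.m≤n+m _ _)
∣value∣<threshold (or φ ψ) ρ α∈ with ∈-++⁻ (atoms φ) α∈
... | inj₁ p = ℕ.≤-trans (∣value∣<threshold φ ρ p) (ℕ.m≤m+n _ _)
... | inj₂ p = ℕ.≤-trans (∣value∣<threshold ψ ρ p) (ℕ.m≤n+m _ _)

i≤+∣i∣ : ∀ i → i ≤ + ∣ i ∣
i≤+∣i∣ (+ n)    = ≤-refl
i≤+∣i∣ -[1+ n ] = -≤+

-i≤+∣i∣ : ∀ i → - i ≤ + ∣ i ∣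
-i≤+∣i∣ i = ≤-trans (i≤+∣i∣ (- i)) (≤-reflexive (cong +_ (∣-i∣≡∣i∣ i)))

-- The truth values of the atoms as x → -∞ within the residue class of r.
limₐ : ∀ {n} → ℤ → Atom (suc n) → QF n
limₐ r (ge (+ 0 ∷ₗ t))      = at (ge t)
limₐ r (ge (+ suc a ∷ₗ t))  = bool false
limₐ r (ge (-[1+ a ] ∷ₗ t)) = bool true
limₐ r (dv d (a ∷ₗ t))      = at (dv d (litₗ (a * r) +ₗ t))

private
  *-≤-self : ∀ a {z} → z ≤ + 0 → + suc a * z ≤ z
  *-≤-self a {z} z≤0 = ≤-trans (≤-reflexive (expand (+ a) z))
    (≤-trans (+-monoʳ-≤ z (≤-trans (*-monoˡ-≤-nonNeg (+ a) z≤0) (≤-reflexive (*-zeroʳ (+ a)))))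
             (≤-reflexive (+-identityʳ z)))
    where
    expand : ∀ a z → (+ 1 + a) * z ≡ z + a * z
    expand = solve-∀

  -+≤0 : ∀ n → - + n ≤ + 0
  -+≤0 n = neg-≤-pos {n} {0}

lim-ge⁺ : ∀ a z v B → z ≤ - + B → ∣ v ∣ ℕ.< B → ¬ + 0 ≤ + suc a * z + v
lim-ge⁺ a z v B z≤-B v<B 0≤ = <⇒≱ (≤-<-trans le lt) 0≤
  where
  le : + suc a * z + v ≤ - + B + + ∣ v ∣
  le = +-mono-≤ (≤-trans (*-≤-self a (≤-trans z≤-B (-+≤0 B))) z≤-B) (i≤+∣i∣ v)
  lt : - + B + + ∣ v ∣ < + 0
  lt = <-≤-trans (+-monoʳ-< (- + B) (+<+ v<B)) (≤-reflexive (+-inverseˡ (+ B)))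

lim-ge⁻ : ∀ a z v B → z ≤ - + B → ∣ v ∣ ℕ.< B → + 0 ≤ -[1+ a ] * z + v
lim-ge⁻ a z v B z≤-B v<B = subst (+ 0 ≤_) (shuffle (+ suc a) z v) (i≤j⇒0≤j-i le)
  where
  shuffle : ∀ a z v → v - a * z ≡ (- a) * z + v
  shuffle = solve-∀
  le : + suc a * z ≤ v
  le = ≤-trans (*-≤-self a (≤-trans z≤-B (-+≤0 B))) (≤-trans z≤-B
         (≤-trans (neg-mono-≤ (+≤+ (ℕ.<⇒≤ v<B)))
           (≤-trans (neg-mono-≤ (-i≤+∣i∣ v)) (≤-reflexive (neg-involutive v)))))

lim-correct : ∀ {n} (φ : QF (suc n)) ρ r y → y ≤ - + threshold φ ρ → + period φ ∣ y - r →
              ev (bindₐ (limₐ r) φ) ρ ≡ ev φ (extend y ρ)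
lim-correct φ ρ r y y≤ per = ev-bindₐ (limₐ r) φ atom
  where
  shuffle : ∀ a r t → t ≡ + 0 * r + t
  shuffle = solve-∀
  shuffle′ : ∀ a r y t → (a * y + t) - (a * r + t) ≡ a * (y - r)
  shuffle′ = solve-∀
  atom : ∀ α → α ∈ atoms φ → ev (limₐ r α) ρ ≡ evA α (extend y ρ)
  atom (ge (+ 0 ∷ₗ t)) α∈ = cong (λ v → ⌊ + 0 ≤? v ⌋) (shuffle r y (value t ρ))
  atom (ge (+ suc a ∷ₗ t)) α∈ with + 0 ≤? + suc a * y + value t ρ
  ... | yes p = ⊥-elim (lim-ge⁺ a y (value t ρ) _ y≤ (∣value∣<threshold φ ρ α∈) p)
  ... | no _  = refl
  atom (ge (-[1+ a ] ∷ₗ t)) α∈ =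
    sym (⌊⌋-true (_ ≤? _) (lim-ge⁻ a y (value t ρ) _ y≤ (∣value∣<threshold φ ρ α∈)))
  atom (dv d (a ∷ₗ t)) α∈ = trans
    (cong (λ v → ⌊ + suc d ∣? v ⌋) (trans (value-+ₗ (litₗ (a * r)) t ρ)
      (cong (_+ value t ρ) (value-litₗ (a * r) ρ))))
    (sym (dv-cong d (a ∷ₗ t) {extend y ρ} {extend r ρ}
      (subst (+ suc d ∣_) (sym (shuffle′ a r y (value t ρ)))
        (∣n⇒∣m*n a (∣-trans (∣ᵤ⇒∣ (∣-period φ α∈)) per)))))

-- Substitutes x := u / (1 + a), clearing the denominator.
substₐ : ∀ {n} → ℕ → Lin n → Atom (suc n) → QF n
substₐ a u (ge (b ∷ₗ t))   = at (ge (b *ₗ u +ₗ + suc a *ₗ t))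
substₐ a u (dv d (b ∷ₗ t)) = at (dv (d ℕ.+ a ℕ.* suc d) (b *ₗ u +ₗ + suc a *ₗ t))

scale-ge : ∀ a v → ⌊ + 0 ≤? + suc a * v ⌋ ≡ ⌊ + 0 ≤? v ⌋
scale-ge a v = ⌊⌋-cong (_ ≤? _) (_ ≤? _)
  (λ p → *-cancelˡ-≤-pos (+ 0) v (+ suc a) (subst (_≤ + suc a * v) (sym (*-zeroʳ (+ suc a))) p))
  (λ p → subst (_≤ + suc a * v) (*-zeroʳ (+ suc a)) (*-monoˡ-≤-nonNeg (+ suc a) p))

scale-dv : ∀ a d v → ⌊ + (suc a ℕ.* suc d) ∣? + suc a * v ⌋ ≡ ⌊ + suc d ∣? v ⌋
scale-dv a d v = ⌊⌋-cong (_ ∣? _) (_ ∣? _)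
  (λ p → *-cancelˡ-∣ (+ suc a) (subst (_∣ + suc a * v) (pos-* (suc a) (suc d)) p))
  (λ p → subst (_∣ + suc a * v) (sym (pos-* (suc a) (suc d))) (*-monoʳ-∣ (+ suc a) p))

subst-correct : ∀ {n} (φ : QF (suc n)) a u ρ x → + suc a * x ≡ value u ρ →
                ev (bindₐ (substₐ a u) φ) ρ ≡ ev φ (extend x ρ)
subst-correct φ a u ρ x eq = ev-bindₐ (substₐ a u) φ (λ α _ → atom α)
  where
  shuffle : ∀ a b x t → b * (a * x) + a * t ≡ a * (b * x + t)
  shuffle = solve-∀
  scaled : ∀ b t → value (b *ₗ u +ₗ + suc a *ₗ t) ρ ≡ + suc a * (b * x + value t ρ)
  scaled b t rewrite value-+ₗ (b *ₗ u) (+ suc a *ₗ t) ρ | value-*ₗ b u ρ | value-*ₗ (+ suc a) t ρ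
                   | sym eq = shuffle (+ suc a) b x (value t ρ)
  atom : ∀ α → ev (substₐ a u α) ρ ≡ evA α (extend x ρ)
  atom (ge (b ∷ₗ t))   = trans (cong (λ v → ⌊ + 0 ≤? v ⌋) (scaled b t)) (scale-ge a (b * x + value t ρ))
  atom (dv d (b ∷ₗ t)) = trans (cong (λ v → ⌊ + (suc a ℕ.* suc d) ∣? v ⌋) (scaled b t))
    (scale-dv a d (b * x + value t ρ))

private
  ∨-true⁻ : ∀ {a b} → a ∨ b ≡ true → a ≡ true ⊎ b ≡ true
  ∨-true⁻ {true}  p = inj₁ refl
  ∨-true⁻ {false} p = inj₂ p

  ∧-true⁻ : ∀ {a b} → a ∧ b ≡ true → a ≡ true × b ≡ true
  ∧-true⁻ {true} {true} p = refl , refl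

⋁ : ∀ {A : Set} {n} → List A → (A → QF n) → QF n
⋁ []       f = bool false
⋁ (x ∷ xs) f = or (f x) (⋁ xs f)

⋁-true⁺ : ∀ {A : Set} {n} {xs} (f : A → QF n) {ρ x} → x ∈ xs → ev (f x) ρ ≡ true → ev (⋁ xs f) ρ ≡ true
⋁-true⁺ f (here refl) p rewrite p = refl
⋁-true⁺ f {ρ} (there {x} {xs} q) p = trans (cong (ev (f x) ρ ∨_) (⋁-true⁺ f q p)) (∨-zeroʳ _)

⋁-true⁻ : ∀ {A : Set} {n} xs (f : A → QF n) {ρ} → ev (⋁ xs f) ρ ≡ true → ∃ λ x → x ∈ xs × ev (f x) ρ ≡ true
⋁-true⁻ (x ∷ xs) f {ρ} p with ∨-true⁻ {ev (f x) ρ} p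
... | inj₁ q = x , here refl , q
... | inj₂ q with ⋁-true⁻ xs f q
...   | y , y∈ , r = y , there y∈ , r

-- A solution exists exactly if some residue class has solutions arbitrarily far down or a boundary
-- line carries one. The divisibility conjunct says that the line is met at an integer.
elim-lim elim-bd elim : ∀ {n} → QF (suc n) → QF n
elim-lim φ = ⋁ (upTo (period φ)) λ r → bindₐ (limₐ (+ r)) φ
elim-bd φ  = ⋁ (boundary φ) λ l → and (at (dv (proj₁ l) (proj₂ l))) (bindₐ (substₐ (proj₁ l) (proj₂ l)) φ)
elim φ     = or (elim-lim φ) (elim-bd φ)

elim-sound : ∀ {n} (φ : QF (suc n)) ρ → ev (elim φ) ρ ≡ true → ∃ λ x → ev φ (extend x ρ) ≡ true
elim-sound φ ρ p with ∨-true⁻ {ev (elim-lim φ) ρ} p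
... | inj₁ q with ⋁-true⁻ (upTo (period φ)) (λ r → bindₐ (limₐ (+ r)) φ) q
...   | r , _ , lim = y , trans (sym (lim-correct φ ρ (+ r) y y≤ (divides (- + k) (shuffle (+ r) (+ k) Δ)))) lim
  where
  -- A period is at least 1, so k periods below r lie under the threshold.
  k = r ℕ.+ threshold φ ρ
  Δ = + period φ
  y = + r - + k * Δ
  shuffle : ∀ r k Δ → (r - k * Δ) - r ≡ - k * Δ
  shuffle = solve-∀
  kΔ≥k : + k ≤ + k * Δ
  kΔ≥k = subst (+ k ≤_) (pos-* k (period φ))
           (+≤+ (ℕ.m≤m*n k (period φ) {{ℕ.>-nonZero (period>0 φ)}}))
  cancel : ∀ r b → r - (r + b) ≡ - b
  cancel = solve-∀
  y≤ : y ≤ - + threshold φ ρ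
  y≤ = ≤-trans (+-monoʳ-≤ (+ r) (neg-mono-≤ kΔ≥k))
               (≤-reflexive (trans (cong (λ w → + r - w) (pos-+ r (threshold φ ρ)))
                 (cancel (+ r) (+ threshold φ ρ))))
elim-sound φ ρ p | inj₂ q with ⋁-true⁻ (boundary φ) _ q
...   | (a , u) , _ , r with ∧-true⁻ {⌊ + suc a ∣? value u ρ ⌋} r
...     | d , s with true-⌊⌋ (+ suc a ∣? value u ρ) d
...       | divides x eq = x , trans (sym (subst-correct φ a u ρ x (trans (*-comm (+ suc a) x) (sym eq)))) s

elim-complete : ∀ {n} (φ : QF (suc n)) ρ x → ev φ (extend x ρ) ≡ true → ev (elim φ) ρ ≡ true
elim-complete φ ρ x φx with descend φ ρ x φx (∣ x ∣ ℕ.+ threshold φ ρ)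
... | inj₁ (y , ((a , u) , l∈ , eq) , φy) =
  trans (cong (ev (elim-lim φ) ρ ∨_) bd) (∨-zeroʳ _)
  where
  bd : ev (elim-bd φ) ρ ≡ true
  bd = ⋁-true⁺ _ l∈ (cong₂ _∧_
         (⌊⌋-true (+ suc a ∣? value u ρ) (divides y (trans (sym eq) (*-comm (+ suc a) y))))
         (trans (subst-correct φ a u ρ y eq) φy))
... | inj₂ φy = cong (_∨ ev (elim-bd φ) ρ) lim
  where
  k = ∣ x ∣ ℕ.+ threshold φ ρ
  Δ = period φ
  y = x - + k * + Δ
  instance _ = ℕ.>-nonZero (period>0 φ)
  r = y %ℕ Δ
  shuffle : ∀ r w → (r + w) - r ≡ w
  shuffle = solve-∀
  kΔ≥k : + k ≤ + k * + Δ
  kΔ≥k = subst (+ k ≤_) (pos-* k Δ) (+≤+ (ℕ.m≤m*n k Δ))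
  cancel : ∀ r b → r - (r + b) ≡ - b
  cancel = solve-∀
  y≤ : y ≤ - + threshold φ ρ
  y≤ = ≤-trans (+-mono-≤ (i≤+∣i∣ x) (neg-mono-≤ kΔ≥k))
               (≤-reflexive (trans (cong (λ w → + ∣ x ∣ - w) (pos-+ ∣ x ∣ (threshold φ ρ)))
                                   (cancel (+ ∣ x ∣) (+ threshold φ ρ))))
  lim : ev (elim-lim φ) ρ ≡ true
  lim = ⋁-true⁺ (λ r → bindₐ (limₐ (+ r)) φ) (∈-upTo⁺ (n%ℕd<d y Δ))
          (trans (lim-correct φ ρ (+ r) y y≤
            (divides (y /ℕ Δ) (trans (cong (_- + r) (a≡a%ℕn+[a/ℕn]*n y Δ)) (shuffle (+ r) _)))) φy)

-- Predicates definable in Presburger arithmetic.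

record Def {n} (P : Env n → Set) : Set where
  field
    qf       : QF n
    sound    : ∀ ρ → ev qf ρ ≡ true → P ρ
    complete : ∀ ρ → P ρ → ev qf ρ ≡ true

open Def

def-dec : ∀ {n} {P : Env n → Set} → Def P → ∀ ρ → Dec (P ρ)
def-dec d ρ with ev (qf d) ρ in eq
... | true  = yes (sound d ρ eq)
... | false = no λ p → case trans (sym eq) (complete d ρ p) of λ ()

def-⇔ : ∀ {n} {P R : Env n → Set} → (∀ ρ → P ρ → R ρ) → (∀ ρ → R ρ → P ρ) → Def P → Def R
def-⇔ f g d = record { qf = qf d ; sound = λ ρ p → f ρ (sound d ρ p) ; complete = λ ρ p → complete d ρ (g ρ p) }

def-const : ∀ {n} {P : Set} → Dec P → Def {n} (λ _ → P)
def-const p = record { qf = bool ⌊ p ⌋ ; sound = λ _ → true-⌊⌋ p ; complete = λ _ → ⌊⌋-true p }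

def-¬ : ∀ {n} {P : Env n → Set} → Def P → Def (λ ρ → ¬ P ρ)
def-¬ {P = P} d = record { qf = neg (qf d) ; sound = s ; complete = c }
  where
  s : ∀ ρ → not (ev (qf d) ρ) ≡ true → ¬ P ρ
  s ρ e p rewrite complete d ρ p = case e of λ ()
  c : ∀ ρ → ¬ P ρ → not (ev (qf d) ρ) ≡ true
  c ρ ¬p with ev (qf d) ρ in eq
  ... | true  = ⊥-elim (¬p (sound d ρ eq))
  ... | false = refl

def-× : ∀ {n} {P R : Env n → Set} → Def P → Def R → Def (λ ρ → P ρ × R ρ)
def-× d e = record
  { qf       = and (qf d) (qf e)
  ; sound    = λ ρ p → let (q , r) = ∧-true⁻ {ev (qf d) ρ} p in sound d ρ q , sound e ρ r
  ; complete = λ ρ (p , r) → cong₂ _∧_ (complete d ρ p) (complete e ρ r)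
  }

def-⊎ : ∀ {n} {P R : Env n → Set} → Def P → Def R → Def (λ ρ → P ρ ⊎ R ρ)
def-⊎ {P = P} {R} d e = record { qf = or (qf d) (qf e) ; sound = s ; complete = c }
  where
  s : ∀ ρ → ev (qf d) ρ ∨ ev (qf e) ρ ≡ true → P ρ ⊎ R ρ
  s ρ p with ∨-true⁻ {ev (qf d) ρ} p
  ... | inj₁ q = inj₁ (sound d ρ q)
  ... | inj₂ q = inj₂ (sound e ρ q)
  c : ∀ ρ → P ρ ⊎ R ρ → ev (qf d) ρ ∨ ev (qf e) ρ ≡ true
  c ρ (inj₁ p) rewrite complete d ρ p = refl
  c ρ (inj₂ r) rewrite complete e ρ r = ∨-zeroʳ _

def-→ : ∀ {n} {P R : Env n → Set} → Def P → Def R → Def (λ ρ → P ρ → R ρ)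
def-→ {P = P} {R} d e = def-⇔ to from (def-⊎ (def-¬ d) e)
  where
  to : ∀ ρ → ¬ P ρ ⊎ R ρ → P ρ → R ρ
  to ρ (inj₁ ¬p) p = ⊥-elim (¬p p)
  to ρ (inj₂ r)  p = r
  from : ∀ ρ → (P ρ → R ρ) → ¬ P ρ ⊎ R ρ
  from ρ f with def-dec d ρ
  ... | yes p = inj₂ (f p)
  ... | no ¬p = inj₁ ¬p

def-∃ : ∀ {n} {P : Env (suc n) → Set} → Def P → Def (λ ρ → Σ ℤ λ x → P (extend x ρ))
def-∃ d = record
  { qf       = elim (qf d)
  ; sound    = λ ρ p → let (x , q) = elim-sound (qf d) ρ p in x , sound d _ q
  ; complete = λ ρ (x , p) → elim-complete (qf d) ρ x (complete d _ p)
  }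

def-∀ : ∀ {n} {P : Env (suc n) → Set} → Def P → Def (λ ρ → ∀ x → P (extend x ρ))
def-∀ {P = P} d = def-⇔ to (λ ρ f (x , ¬p) → ¬p (f x)) (def-¬ (def-∃ (def-¬ d)))
  where
  to : ∀ ρ → ¬ (Σ ℤ λ x → ¬ P (extend x ρ)) → ∀ x → P (extend x ρ)
  to ρ h x with def-dec d (extend x ρ)
  ... | yes p = p
  ... | no ¬p = ⊥-elim (h (x , ¬p))

def-∀Fin : ∀ {n} m {P : Fin m → Env n → Set} → (∀ i → Def (P i)) → Def (λ ρ → ∀ i → P i ρ)
def-∀Fin zero    d = def-⇔ (λ _ _ ()) (λ _ _ → refl) (def-const {P = 0 ≡ 0} (yes refl))
def-∀Fin (suc m) {P} d = def-⇔ to (λ ρ f → f zero , f ∘ suc) (def-× (d zero) (def-∀Fin m (d ∘ suc)))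
  where
  to : ∀ ρ → P zero ρ × (∀ i → P (suc i) ρ) → ∀ i → P i ρ
  to ρ (p , f) zero    = p
  to ρ (p , f) (suc i) = f i

renameA : ∀ {n m} → (Fin n → Fin m) → Atom n → QF m
renameA f (ge t)   = at (ge (renameₗ f t))
renameA f (dv d t) = at (dv d (renameₗ f t))

ev-rename : ∀ {n m} (f : Fin n → Fin m) φ ρ → ev (bindₐ (renameA f) φ) ρ ≡ ev φ (ρ ∘ f)
ev-rename f φ ρ = ev-bindₐ (renameA f) φ (λ α _ → atom α)
  where
  atom : ∀ α → ev (renameA f α) ρ ≡ evA α (ρ ∘ f)
  atom (ge t)   = cong (λ v → ⌊ + 0 ≤? v ⌋) (value-renameₗ f t ρ)
  atom (dv d t) = cong (λ v → ⌊ + suc d ∣? v ⌋) (value-renameₗ f t ρ)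

def-rename : ∀ {n m} {P : Env n → Set} (f : Fin n → Fin m) → Def P → Def (λ ρ → P (ρ ∘ f))
def-rename f d = record
  { qf       = bindₐ (renameA f) (qf d)
  ; sound    = λ ρ p → sound d _ (trans (sym (ev-rename f (qf d) ρ)) p)
  ; complete = λ ρ p → trans (ev-rename f (qf d) ρ) (complete d _ p)
  }

-- Environments are functions, so pointwise equality cannot be substituted; the defining formula
-- transports it instead.
def-ext : ∀ {n} {P : Env n → Set} → Def P → ∀ {ρ σ} → (∀ i → ρ i ≡ σ i) → P ρ → P σ
def-ext d {ρ} {σ} eq p = sound d σ (trans (sym (ev-ext (qf d) eq)) (complete d ρ p))

def-≤ : ∀ {n} (t : Lin n) → Def (λ ρ → + 0 ≤ value t ρ)
def-≤ t = record
  { qf = at (ge t) ; sound = λ ρ → true-⌊⌋ (_ ≤? _) ; complete = λ ρ → ⌊⌋-true (_ ≤? _) }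

def-∣ : ∀ {n} m (t : Lin n) → Def (λ ρ → + m ∣ value t ρ)
def-∣ (suc m) t = record
  { qf = at (dv m t) ; sound = λ ρ → true-⌊⌋ (_ ∣? _) ; complete = λ ρ → ⌊⌋-true (_ ∣? _) }
-- Moduli of `dv` are positive, so divisibility by 0 is expressed as equality with 0 by two
-- inequalities.
def-∣ zero t = def-⇔ to from (def-× (def-≤ t) (def-≤ (- + 1 *ₗ t)))
  where
  neg-value : ∀ ρ → value (- + 1 *ₗ t) ρ ≡ - value t ρ
  neg-value ρ = trans (value-*ₗ (- + 1) t ρ) (-1*i≡-i (value t ρ))
  to : ∀ ρ → + 0 ≤ value t ρ × + 0 ≤ value (- + 1 *ₗ t) ρ → + 0 ∣ value t ρ
  to ρ (p , q) = ∣-reflexive (sym (≤-antisym (neg-cancel-≤ (subst (+ 0 ≤_) (neg-value ρ) q)) p))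
  from : ∀ ρ → + 0 ∣ value t ρ → + 0 ≤ value t ρ × + 0 ≤ value (- + 1 *ₗ t) ρ
  from ρ d = ≤-reflexive (sym eq) , ≤-reflexive (sym (trans (neg-value ρ) (cong -_ eq)))
    where eq = 0∣⇒≡0 d

linear : ∀ {n} → Term n → Lin n
linear (var i) = varₗ i
linear (lit c) = litₗ c
linear (s ⊕ t) = linear s +ₗ linear t
linear (⊝ t)   = - + 1 *ₗ linear t

value-linear : ∀ {n} (t : Term n) ρ → value (linear t) ρ ≡ ⟦ t ⟧t ρ
value-linear (var i) ρ = value-varₗ i ρ
value-linear (lit c) ρ = value-litₗ c ρ
value-linear (s ⊕ t) ρ = trans (value-+ₗ (linear s) (linear t) ρ)
  (cong₂ _+_ (value-linear s ρ) (value-linear t ρ))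
value-linear (⊝ t)   ρ = trans (value-*ₗ (- + 1) (linear t) ρ)
                           (trans (-1*i≡-i (value (linear t) ρ)) (cong -_ (value-linear t ρ)))

def-≤ₜ : ∀ {n} (s t : Term n) → Def (λ ρ → ⟦ s ⟧t ρ ≤ ⟦ t ⟧t ρ)
def-≤ₜ s t = def-⇔
  (λ ρ p → 0≤i-j⇒j≤i (subst (+ 0 ≤_) (value-linear (t ⊕ (⊝ s)) ρ) p))
  (λ ρ p → subst (+ 0 ≤_) (sym (value-linear (t ⊕ (⊝ s)) ρ)) (i≤j⇒0≤j-i p))
  (def-≤ (linear (t ⊕ (⊝ s))))

presburger : ∀ {n} (φ : Formula n) → Def ⟦ φ ⟧
presburger (s ≐ t)  = def-⇔ (λ ρ (p , q) → ≤-antisym p q) (λ ρ eq → ≤-reflexive eq , ≤-reflexive (sym eq))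
                        (def-× (def-≤ₜ s t) (def-≤ₜ t s))
presburger (s ≼ t)  = def-≤ₜ s t
presburger (¬′ φ)   = def-¬ (presburger φ)
presburger (φ ∧′ ψ) = def-× (presburger φ) (presburger ψ)
presburger (φ ∨′ ψ) = def-⊎ (presburger φ) (presburger ψ)
presburger (∃′ φ)   = def-∃ (presburger φ)
presburger (∀′ φ)   = def-∀ (presburger φ)

-- Semilinear maps are eventually affine along residue classes

∈-product : ∀ {A : Set} (h : A → ℕ) {x xs} → x ∈ xs → h x ℕ.∣ product (map h xs)
∈-product h (here refl)            = ℕ.m∣m*n _
∈-product h (there {x = y} p) = ℕ.∣n⇒∣m*n (h y) (∈-product h p)

∈-sum : ∀ {A : Set} (h : A → ℕ) {x xs} → x ∈ xs → h x ℕ.≤ sum (map h xs)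
∈-sum h (here refl)       = ℕ.m≤m+n _ _
∈-sum h (there {x = y} p) = ℕ.≤-trans (∈-sum h p) (ℕ.m≤n+m _ (h y))

product>0 : ∀ {A : Set} (h : A → ℕ) → (∀ x → 0 ℕ.< h x) → ∀ xs → 0 ℕ.< product (map h xs)
product>0 h pos []       = s≤s z≤n
product>0 h pos (x ∷ xs) = ℕ.*-mono-≤ (pos x) (product>0 h pos xs)

∈-concatMap′ : ∀ {A B : Set} (f : A → List B) {x xs y} → x ∈ xs → y ∈ f x → y ∈ concatMap f xs
∈-concatMap′ f x∈ y∈ = ∈-concat⁺′ y∈ (∈-map⁺ f x∈)

∣∧∣∣<⇒≡0 : ∀ {m z} → + m ∣ z → ∣ z ∣ ℕ.< m → z ≡ + 0
∣∧∣∣<⇒≡0 {m} {z} d lt with ∣ z ∣ in eq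
... | zero  = ∣i∣≡0⇒i≡0 eq
... | suc w = ⊥-elim (ℕ.<⇒≱ lt (ℕ.∣⇒≤ (subst (m ℕ.∣_) eq (∣⇒∣ᵤ d))))

residue-unique : ∀ {m c d} → c ℕ.< m → d ℕ.< m → + m ∣ + c - + d → c ≡ d
residue-unique {m} {c} {d} c<m d<m p = +-injective (i-j≡0⇒i≡j (+ c) (+ d) (∣∧∣∣<⇒≡0 p
  (ℕ.≤-<-trans (subst (ℕ._≤ c ℕ.⊔ d) (cong ∣_∣ (sym (m-n≡m⊖n c d))) (∣m⊝n∣≤m⊔n c d)) (ℕ.⊔-lub c<m d<m))))

-- The canonical representatives of integers modulo m. They let a graph known only modulo m
-- determine an integer.
Normal : ℕ → ℤ → Set
Normal m y = m ≡ 0 ⊎ ∃ λ c → c ℕ.< m × y ≡ + c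

normal-unique : ∀ {m y y′} → Normal m y → Normal m y′ → + m ∣ y - y′ → y ≡ y′
normal-unique {y = y} {y′} (inj₁ refl) _ d = i-j≡0⇒i≡j y y′ (0∣⇒≡0 d)
normal-unique {y = y} {y′} (inj₂ _) (inj₁ refl) d = i-j≡0⇒i≡j y y′ (0∣⇒≡0 d)
normal-unique (inj₂ (c , c< , refl)) (inj₂ (c′ , c′< , refl)) d = cong +_ (residue-unique c< c′< d)

-- (b , a , c) stands for the line (1 + b) y = a x + c.
Line : Set
Line = ℕ × ℤ × ℤ

-- On the line, 1 + b times the form β y + α x + γ becomes linear in x with this constant term (up
-- to sign).
offsetₐ : Line → Atom 2 → ℕ
offsetₐ (b , a , c) (ge (β ∷ₗ α ∷ₗ con γ)) = ∣ β * c + + suc b * γ ∣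
offsetₐ l           (dv d t)                = 0

sign-far : ∀ σ τ B z z′ → z ≤ - + B → z′ ≤ - + B → ∣ τ ∣ ℕ.< B →
           ⌊ + 0 ≤? σ * z + τ ⌋ ≡ ⌊ + 0 ≤? σ * z′ + τ ⌋
sign-far (+ 0)     τ B z z′ p q r = refl
sign-far (+ suc a) τ B z z′ p q r = ⌊⌋-cong (_ ≤? _) (_ ≤? _)
  (⊥-elim ∘ lim-ge⁺ a z τ B p r) (⊥-elim ∘ lim-ge⁺ a z′ τ B q r)
sign-far -[1+ a ]  τ B z z′ p q r = ⌊⌋-cong (_ ≤? _) (_ ≤? _)
  (λ _ → lim-ge⁻ a z′ τ B q r) (λ _ → lim-ge⁻ a z τ B p r)

sign-far⁺ : ∀ σ τ B z z′ → + B ≤ z → + B ≤ z′ → ∣ τ ∣ ℕ.< B →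
            ⌊ + 0 ≤? σ * z + τ ⌋ ≡ ⌊ + 0 ≤? σ * z′ + τ ⌋
sign-far⁺ σ τ B z z′ p q r =
  trans (cong (λ v → ⌊ + 0 ≤? v + τ ⌋) (negneg σ z))
    (trans (sign-far (- σ) τ B (- z) (- z′) (neg-mono-≤ p) (neg-mono-≤ q) r)
      (cong (λ v → ⌊ + 0 ≤? v + τ ⌋) (sym (negneg σ z′))))
  where
  negneg : ∀ σ z → σ * z ≡ - σ * - z
  negneg = solve-∀

-- E is a direction and x a starting point from which no line crosses a
-- boundary any more.
Outward : ℕ → ℤ → ℤ → Set
Outward N E x = (+ N ≤ x × + 0 ≤ E) ⊎ (x ≤ - + N × E ≤ + 0)

outward-step : ∀ {N E x} → Outward N E x → Outward N E (x + E)
outward-step {N} {E} {x} (inj₁ (p , q)) = inj₁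
  (≤-trans p (≤-trans (≤-reflexive (sym (+-identityʳ x))) (+-monoʳ-≤ x q)) , q)
outward-step {N} {E} {x} (inj₂ (p , q)) = inj₂
  (≤-trans (+-monoʳ-≤ x q) (≤-trans (≤-reflexive (+-identityʳ x)) p) , q)

sign-outward : ∀ σ τ N E x → Outward N E x → ∣ τ ∣ ℕ.< N →
               ⌊ + 0 ≤? σ * x + τ ⌋ ≡ ⌊ + 0 ≤? σ * (x + E) + τ ⌋
sign-outward σ τ N E x o@(inj₁ (p , q)) r with outward-step o
... | inj₁ (p′ , _) = sign-far⁺ σ τ N x (x + E) p p′ r
... | inj₂ (p′ , q′) = cong (λ e → ⌊ + 0 ≤? σ * e + τ ⌋)
        (trans (sym (+-identityʳ x)) (cong (λ w → x + w) (≤-antisym q q′)))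
sign-outward σ τ N E x o@(inj₂ (p , q)) r with outward-step o
... | inj₂ (p′ , _) = sign-far σ τ N x (x + E) p p′ r
... | inj₁ (p′ , q′) = cong (λ e → ⌊ + 0 ≤? σ * e + τ ⌋)
        (trans (sym (+-identityʳ x)) (cong (λ w → x + w) (≤-antisym q′ q)))

point : ℤ → ℤ → Env 2
point y x = extend y (extend x λ ())

-- Both coordinates move by multiples of the period, so divisibility atoms are unaffected. An
-- inequality restricted to the line is a form in x alone, whose sign is constant outward of its
-- constant term. The factor 1 + b in E keeps the shift of y integral.
line-step : ∀ (φ : QF 2) b a c q N x y →
  let E = q * (+ suc b * + period φ) in
  Outward N E x → (∀ α → α ∈ atoms φ → offsetₐ (b , a , c) α ℕ.< N) →
  + suc b * y ≡ a * x + c →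
  ev φ (point y x) ≡ ev φ (point (y + a * (q * + period φ)) (x + E))
line-step φ b a c q N x y o bound eq with ev-change φ (point y x)
  (point (y + a * (q * + period φ)) (x + q * (+ suc b * + period φ)))
... | inj₁ same = same
... | inj₂ (dv d (β ∷ₗ α ∷ₗ con γ) , α∈ , neq) = ⊥-elim (neq (sym (dv-cong d (β ∷ₗ α ∷ₗ con γ)
        {point (y + a * (q * Δ)) (x + q * (B * Δ))} {point y x}
        (subst (+ suc d ∣_) (sym (diff β α γ y x a q B Δ))
          (∣n⇒∣m*n (β * a * q + α * q * B) (∣ᵤ⇒∣ (∣-period φ α∈)))))))
  where
  Δ = + period φ
  B = + suc b
  diff : ∀ β α γ y x a q B Δ →
         (β * (y + a * (q * Δ)) + (α * (x + q * (B * Δ)) + γ)) - (β * y + (α * x + γ)) ≡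
           (β * a * q + α * q * B) * Δ
  diff = solve-∀
... | inj₂ (ge (β ∷ₗ α ∷ₗ con γ) , α∈ , neq) = ⊥-elim (neq
        (trans (along x y eq) (trans (sign-outward (α * B + β * a) (β * c + B * γ) N E x o (bound _ α∈))
          (sym (along (x + E) y′ eq′)))))
  where
  Δ = + period φ
  B = + suc b
  E = q * (B * Δ)
  y′ = y + a * (q * Δ)
  expand : ∀ B y a q Δ → B * (y + a * (q * Δ)) ≡ B * y + a * (q * (B * Δ))
  expand = solve-∀
  regroup : ∀ a x c E → a * x + c + a * E ≡ a * (x + E) + c
  regroup = solve-∀
  eq′ : B * y′ ≡ a * (x + E) + c
  eq′ = trans (expand B y a q Δ) (trans (cong (_+ a * E) eq) (regroup a x c E))
  scale : ∀ B β y α x γ → B * (β * y + (α * x + γ)) ≡ β * (B * y) + (α * B * x + B * γ)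
  scale = solve-∀
  collect : ∀ β a x c α B γ → β * (a * x + c) + (α * B * x + B * γ) ≡ (α * B + β * a) * x + (β * c + B * γ)
  collect = solve-∀
  along : ∀ x y → B * y ≡ a * x + c →
          ⌊ + 0 ≤? β * y + (α * x + γ) ⌋ ≡ ⌊ + 0 ≤? (α * B + β * a) * x + (β * c + B * γ) ⌋
  along x y eq = trans (sym (scale-ge b (β * y + (α * x + γ)))) (cong (λ v → ⌊ + 0 ≤? v ⌋)
    (trans (scale B β y α x γ) (trans (cong (λ v → β * v + (α * B * x + B * γ)) eq) (collect β a x c α B γ))))

Ray : ∀ {A : Set} → (ℤ → A × ℤ) → ℤ → ℤ → ℤ → Set
Ray h x E a = ∀ t → h (x + + t * E) ≡ (proj₁ (h x) , proj₂ (h x) + + t * a)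

-- Outside [-N, N] all maps are affine along the residue classes mod D.
module Rays {K n : ℕ} (k : Fin K → ℕ) (g : Fin n → Fin K × ℤ → Fin K × ℤ)
  (graph : ∀ f i j → Def {2} (λ ρ → proj₁ (g f (i , ρ (suc zero))) ≡ j ×
                                    + k j ∣ ρ zero - proj₂ (g f (i , ρ (suc zero)))))
  (normal : ∀ f i x → Normal (k (proj₁ (g f (i , x)))) (proj₂ (g f (i , x))))
  where

  asLine : ℕ × Lin 1 → Line
  asLine (b , a ∷ₗ con c) = b , a , c

  lines : Fin n → Fin K → Fin K → List Line
  lines f i j = map asLine (boundary (qf (graph f i j))) ++ map (λ c → 0 , + 0 , + c) (upTo (k j))

  entriesAt : Fin n → Fin K → Fin K → List (QF 2 × Line)
  entriesAt f i j = map (qf (graph f i j) ,_) (lines f i j)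

  entries : List (QF 2 × Line)
  entries = concatMap (λ f → concatMap (λ i → concatMap (entriesAt f i) (allFin K)) (allFin K)) (allFin n)

  ∈-entries : ∀ f i j {l} → l ∈ lines f i j → (qf (graph f i j) , l) ∈ entries
  ∈-entries f i j l∈ =
    ∈-concatMap′ (λ f → concatMap (λ i → concatMap (entriesAt f i) (allFin K)) (allFin K)) (∈-allFin f)
      (∈-concatMap′ (λ i → concatMap (entriesAt f i) (allFin K)) (∈-allFin i)
        (∈-concatMap′ (entriesAt f i) (∈-allFin j) (∈-map⁺ _ l∈)))

  step bnd : QF 2 × Line → ℕ
  step (φ , b , a , c) = suc b ℕ.* period φ
  bnd  (φ , l) = sum (map (offsetₐ l) (atoms φ))

  -- D is a common multiple of all (1 + b) times period, hence an admissible step along every line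
  -- at once; N exceeds every constant term.
  D N : ℕ
  D = product (map step entries)
  N = suc (sum (map bnd entries))

  D>0 : 0 ℕ.< D
  D>0 = product>0 step (λ (φ , b , a , c) → ℕ.*-mono-≤ {1} {suc b} (s≤s z≤n) (period>0 φ)) entries

  -- If the target orbit is ℤ, the graph formula holds at y and fails one period below, as values
  -- are unique; so y is a boundary point. If it is finite, y is one of its residues and a
  -- horizontal line serves.
  on-line : ∀ f i x → let (j , y) = g f (i , x) in
            ∃ λ l → l ∈ lines f i j × + suc (proj₁ l) * y ≡ proj₁ (proj₂ l) * x + proj₂ (proj₂ l) ×
                    (k j ≡ 0 ⊎ proj₁ (proj₂ l) ≡ + 0)
  on-line f i x with normal f i x
  ... | inj₂ (c , c<k , eq) = (0 , + 0 , + c) , ∈-++⁺ʳ (map asLine (boundary (qf (graph f i _))))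
    (∈-map⁺ _ (∈-upTo⁺ c<k)) ,
                              trans (*-identityˡ _) (trans eq (sym (+-identityˡ (+ c)))) , inj₂ refl
  ... | inj₁ k≡0 with ev-step (qf G) (extend x λ ()) y
    where
    j = proj₁ (g f (i , x))
    y = proj₂ (g f (i , x))
    G = graph f i j
  ...   | inj₁ (l@(b , a ∷ₗ con c) , l∈ , eq) = asLine l , ∈-++⁺ˡ (∈-map⁺ asLine l∈) , eq , inj₁ k≡0
  ...   | inj₂ same = ⊥-elim (ℕ.<⇒≢ (period>0 (qf G))
    (sym (+-injective (trans (sym (neg-involutive (+ Δ))) (cong -_ (0∣⇒≡0 zero∣))))))
    where
    j = proj₁ (g f (i , x))
    y = proj₂ (g f (i , x))
    G = graph f i j
    Δ = period (qf G)
    shuffle : ∀ y Δ → y - Δ - y ≡ - Δ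
    shuffle = solve-∀
    zero∣ : + 0 ∣ - + Δ
    zero∣ = subst₂ _∣_ (cong +_ k≡0) (shuffle y (+ Δ))
      (proj₂ (sound G (point (y - + Δ) x) (trans (sym same)
        (complete G (point y x) (refl , divides (+ 0) (+-inverseʳ y))))))

  -- The line through the starting point is followed step by step. `line-step` fixes each image
  -- modulo `k j`, and normality makes this an equality, since the shift w is 0 whenever the target
  -- is finite.
  ray-exists : ∀ f i x E → + D ∣ E → Outward N E x → ∃ (Ray (λ x → g f (i , x)) x E)
  ray-exists f i x E D∣E o with on-line f i x
  ... | (b , a , c) , l∈ , eq , flat = w , λ t → proj₁ (go t)
    where
    j = proj₁ (g f (i , x))
    G = graph f i j
    e∈ = ∈-entries f i j l∈
    Δ = + period (qf G)
    quot : + (suc b ℕ.* period (qf G)) ∣ E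
    quot = ∣-trans (∣ᵤ⇒∣ (∈-product step e∈)) D∣E
    q = quotient quot
    E≡ : E ≡ q * (+ suc b * Δ)
    E≡ = trans (_∣_.equality quot) (cong (q *_) (pos-* (suc b) (period (qf G))))
    w = a * (q * Δ)
    w-flat : k j ≡ 0 ⊎ w ≡ + 0
    w-flat = map₂ (λ a≡0 → cong (_* (q * Δ)) a≡0) flat
    offsets : ∀ α → α ∈ atoms (qf G) → offsetₐ (b , a , c) α ℕ.< N
    offsets α α∈ = s≤s (ℕ.≤-trans (∈-sum (offsetₐ (b , a , c)) α∈) (∈-sum bnd e∈))
    normal-at : ∀ {x y} → g f (i , x) ≡ (j , y) → Normal (k j) y
    normal-at {x} gx = subst (λ (j , y) → Normal (k j) y) gx (normal f i x)
    normal+w : ∀ {y} → Normal (k j) y → Normal (k j) (y + w)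
    normal+w {y} ny = go w-flat
      where
      go : k j ≡ 0 ⊎ w ≡ + 0 → Normal (k j) (y + w)
      go (inj₁ k≡0) = inj₁ k≡0
      go (inj₂ w≡0) = subst (Normal (k j)) (sym (trans (cong (λ w → y + w) w≡0) (+-identityʳ y))) ny
    match : ∀ x x′ y → g f (i , x) ≡ (j , y) → (p : proj₁ (g f (i , x′)) ≡ j) →
            + k j ∣ y + w - proj₂ (g f (i , x′)) → g f (i , x′) ≡ (j , y + w)
    match x x′ y gx p d = cong₂ _,_ p (sym
      (normal-unique (normal+w (normal-at gx)) (normal-at (cong (_, proj₂ (g f (i , x′))) p)) d))
    advance : ∀ x y → Outward N E x → g f (i , x) ≡ (j , y) → + suc b * y ≡ a * x + c →
              g f (i , x + E) ≡ (j , y + w) × + suc b * (y + w) ≡ a * (x + E) + c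
    advance x y o gx eq = match x (x + E) y gx (proj₁ there′) (proj₂ there′) , onl
      where
      here′ : ev (qf G) (point y x) ≡ true
      here′ = complete G (point y x) (cong proj₁ gx , divides (+ 0)
                (trans (cong (λ p → y - proj₂ p) gx) (+-inverseʳ y)))
      there′ : proj₁ (g f (i , x + E)) ≡ j × + k j ∣ y + w - proj₂ (g f (i , x + E))
      there′ = sound G (point (y + w) (x + E))
        (trans (sym (subst (λ F → ev (qf G) (point y x) ≡ ev (qf G) (point (y + w) (x + F)))
                 (sym E≡) (line-step (qf G) b a c q N x y (subst (λ F → Outward N F x) E≡ o) offsets eq)))
                   here′)
      expand : ∀ B y a q Δ → B * (y + a * (q * Δ)) ≡ B * y + a * (q * (B * Δ))
      expand = solve-∀
      regroup : ∀ a x c E → a * x + c + a * E ≡ a * (x + E) + c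
      regroup = solve-∀
      onl : + suc b * (y + w) ≡ a * (x + E) + c
      onl = trans (expand (+ suc b) y a q Δ) (trans (cong₂ (λ u v → u + a * v) eq (sym E≡)) (regroup a x c E))
    move : ∀ x t E → x + t * E + E ≡ x + (+ 1 + t) * E
    move = solve-∀
    On : ℤ → ℤ → Set
    On x y = g f (i , x) ≡ (j , y) × + suc b * y ≡ a * x + c × Outward N E x
    go : ∀ t → On (x + + t * E) (proj₂ (g f (i , x)) + + t * w)
    go zero = subst₂ On (sym (+-identityʳ x)) (sym (+-identityʳ (proj₂ (g f (i , x))))) (refl , eq , o)
    go (suc t) = let (gt , et , ot) = go t
                     (gs , es) = advance _ _ ot gt et
                 in subst₂ On (move x (+ t) E) (move (proj₂ (g f (i , x))) (+ t) w) (gs , es , outward-step ot)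

-- Classical reasoning about finitely many propositions, and stabilisation

excluded-middle : ∀ {P : Set} → ¬ ¬ Dec P
excluded-middle h = h (no λ p → h (yes p))

¬¬-Fin : ∀ n {P : Fin n → Set} → (∀ i → ¬ ¬ P i) → ¬ ¬ (∀ i → P i)
¬¬-Fin zero    h c = c λ ()
¬¬-Fin (suc n) h c = h zero λ p → ¬¬-Fin n (h ∘ suc) λ ps → c λ { zero → p ; (suc i) → ps i }

¬¬-least : ∀ {P : ℕ → Set} n → P n → ¬ ¬ (∃ λ u → u ℕ.≤ n × P u × ∀ v → v ℕ.< u → ¬ P v)
¬¬-least {P} n p = go n (<-wellFounded n) p
  where
  go : ∀ n → Acc ℕ._<_ n → P n → ¬ ¬ (∃ λ u → u ℕ.≤ n × P u × ∀ v → v ℕ.< u → ¬ P v)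
  go n (acc rs) p c = excluded-middle {∃ λ v → v ℕ.< n × P v} λ
    { (yes (v , v<n , q)) → go v (rs v<n) q λ (u , u≤v , r) → c (u , ℕ.≤-trans u≤v (ℕ.<⇒≤ v<n) , r)
    ; (no none) → c (n , ℕ.≤-refl , p , λ v v<n q → none (v , v<n , q))
    }

-- This is 2^p - 1: the induction runs the other processes once, and once more after the time at
-- which the first process is unstable.
stableTime : ℕ → ℕ
stableTime zero    = 0
stableTime (suc p) = stableTime p ℕ.+ suc (stableTime p)

-- If each of p processes is unstable at most once, they are all stable at some early time.
stabilise : ∀ p (Stable : ℕ → Fin p → Set) →
            (∀ i {s t} → s ℕ.< t → ¬ Stable s i → ¬ ¬ Stable t i) →
            ¬ ¬ (∃ λ t → t ℕ.≤ stableTime p × ∀ i → Stable t i)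
stabilise p Stable once c = from p Stable once 0 λ (t , _ , q) → c (t , q)
  where
  from : ∀ p (Stable : ℕ → Fin p → Set) →
         (∀ i {s t} → s ℕ.< t → ¬ Stable s i → ¬ ¬ Stable t i) →
         ∀ s → ¬ ¬ (∃ λ t → s ℕ.≤ t × t ℕ.≤ s ℕ.+ stableTime p × ∀ i → Stable t i)
  from zero    Stable once s c = c (s , ℕ.≤-refl , ℕ.m≤m+n s 0 , λ ())
  from (suc p) Stable once s c =
    from p (λ t → Stable t ∘ suc) (once ∘ suc) s λ (t , s≤t , t≤ , st) →
    excluded-middle λ
      { (yes q) → c (t , s≤t , ℕ.≤-trans t≤ (ℕ.+-monoʳ-≤ s (ℕ.m≤m+n _ _)) , λ { zero → q ; (suc i) → st i })
      ; (no ¬q) → from p (λ t → Stable t ∘ suc) (once ∘ suc) (suc t) λ (t′ , t<t′ , t′≤ , st′) →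
          once zero t<t′ ¬q λ q →
          c (t′ , ℕ.≤-trans s≤t (ℕ.<⇒≤ t<t′) , ℕ.≤-trans t′≤ (bound t t≤) , λ { zero → q ; (suc i) → st′ i })
      }
    where
    bound : ∀ t → t ℕ.≤ s ℕ.+ stableTime p → suc t ℕ.+ stableTime p ℕ.≤ s ℕ.+ stableTime (suc p)
    bound t t≤ = ℕ.≤-trans (ℕ.≤-reflexive (sym (ℕ.+-suc t (stableTime p))))
                  (ℕ.≤-trans (ℕ.+-monoˡ-≤ (suc (stableTime p)) t≤)
                    (ℕ.≤-reflexive (ℕ.+-assoc s (stableTime p) (suc (stableTime p)))))

maxOn : (ℤ → ℕ) → ℕ → ℕ
maxOn h M = sum (map h (range M))

≤-maxOn : ∀ h M x → ∣ x ∣ ℕ.≤ M → h x ℕ.≤ maxOn h M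
≤-maxOn h M x p = ∈-sum h (∈-range M x p)

sumFin : ∀ n → (Fin n → ℕ) → ℕ
sumFin n h = sum (map h (allFin n))

≤-sumFin : ∀ {n} (h : Fin n → ℕ) i → h i ℕ.≤ sumFin n h
≤-sumFin h i = ∈-sum h (∈-allFin i)

-i≤∣i∣′ : ∀ i → - + ∣ i ∣ ≤ i
-i≤∣i∣′ i = subst (- + ∣ i ∣ ≤_) (neg-involutive i) (neg-mono-≤ (-i≤+∣i∣ i))

-- Weights on a finite graph with rational edge factors

∣! : ∀ {m n} → 0 ℕ.< m → m ℕ.≤ n → m ℕ.∣ n !
∣! {suc m} _ m≤n = ℕ.∣-trans (ℕ.m∣m*n (m !)) (ℕ.m≤n⇒m!∣n! m≤n)

module Heights (K D A : ℕ) (D>0 : 0 ℕ.< D) (A>0 : 0 ℕ.< A) where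

  -- Bounds numerator and denominator of a weight relative to the least one after t edges. An edge
  -- multiplies the numerator by at most A and the denominator by D z, where z is at most A times
  -- the previous height.
  height : ℕ → ℕ
  height zero    = 1
  height (suc t) = D ℕ.* (A ℕ.* height t) ℕ.* height t

  height>0 : ∀ t → 0 ℕ.< height t
  height>0 zero    = s≤s z≤n
  height>0 (suc t) = ℕ.*-mono-≤ (ℕ.*-mono-≤ D>0 (ℕ.*-mono-≤ A>0 (height>0 t))) (height>0 t)

  A-height-≤ : ∀ t → A ℕ.* height t ℕ.≤ height (suc t)
  A-height-≤ t = ℕ.≤-trans (ℕ.m≤n*m (A ℕ.* height t) D {{ℕ.>-nonZero D>0}})
                           (ℕ.m≤m*n (D ℕ.* (A ℕ.* height t)) (height t) {{ℕ.>-nonZero (height>0 t)}})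

  height-≤ : ∀ t → height t ℕ.≤ height (suc t)
  height-≤ t = ℕ.≤-trans (ℕ.m≤n*m (height t) A {{ℕ.>-nonZero A>0}}) (A-height-≤ t)

  height-mono : ∀ {s t} → s ℕ.≤′ t → height s ℕ.≤ height t
  height-mono ℕ.≤′-refl     = ℕ.≤-refl
  height-mono (ℕ.≤′-step {n} p) = ℕ.≤-trans (height-mono p) (height-≤ n)

  -- With Y the largest height, giving the least weight the value Y! clears all denominators; a
  -- ratio a / b becomes Y! a / b, at most Y! Y.
  weightBound : ℕ
  weightBound = (height (stableTime K)) ! ℕ.* height (stableTime K)

module Weights {K : ℕ} (D A : ℕ) (D>0 : 0 ℕ.< D) (A>0 : 0 ℕ.< A)
  (Edge : Fin K → Fin K → ℤ → Set) (Edge-bound : ∀ {i j a} → Edge i j a → ∣ a ∣ ℕ.≤ A × a ≢ + 0)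
  (L : Fin K → Set) (L? : ∀ i → Dec (L i)) (m : Fin K → ℕ) (m>0 : ∀ {i} → L i → 0 ℕ.< m i)
  (L-closed : ∀ {i j a} → L i → Edge i j a → L j)
  where

  open Heights K D A D>0 A>0 public

  -- z m_i stays divisible by the periods along all paths of length at most k.
  Transported : ℕ → Fin K → ℤ → Set
  Transported zero    i z = ⊤
  Transported (suc k) i z = Transported k i z ×
    (∀ j a → Edge i j a → ∃ λ z′ → + D * z′ * + m j ≡ a * z * + m i × Transported k j z′)

  -- The transported numbers thus form a subgroup of ℤ, whose generator yields the weight.
  transported-lin : ∀ k {i z v} c → Transported k i z → Transported k i v → Transported k i (z + c * v)
  transported-lin zero    c p q = tt
  transported-lin (suc k) {i} {z} {v} c (p , f) (q , h) = transported-lin k c p q , λ j a e →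
    let (z′ , eq , r) = f j a e
        (v′ , eq′ , s) = h j a e
    in z′ + c * v′ , trans (left (+ D) z′ c v′ (+ m j))
      (trans (cong₂ (λ x y → x + c * y) eq eq′) (right a z c v (+ m i))) ,
       transported-lin k c r s
    where
    left : ∀ D z c v m → D * (z + c * v) * m ≡ D * z * m + c * (D * v * m)
    left = solve-∀
    right : ∀ a z c v m → a * z * m + c * (a * v * m) ≡ a * (z + c * v) * m
    right = solve-∀

  transported-≤ : ∀ {s t i z} → s ℕ.≤′ t → Transported t i z → Transported s i z
  transported-≤ ℕ.≤′-refl     p = p
  transported-≤ (ℕ.≤′-step q) p = transported-≤ q (proj₁ p)

  Weighting : (Fin K → Set) → (Fin K → ℕ) → Set
  Weighting L w = (∀ {i} → L i → 0 ℕ.< w i) × (∀ {i j a} → L i → Edge i j a → + D * + w j ∣ a * + w i)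

  -- The subgroups of transported numbers shrink with t but contain U, so it suffices to watch the
  -- numbers 1 to U until none is lost in a step. Then the generator u i is transported one edge
  -- further, to a member of the subgroup at j, that is, a multiple of u j. Hence the weight u i
  -- times m i.
  weights : ∀ U → (∀ {i} → L i → Transported (stableTime (K ℕ.* U)) i (+ U)) → 0 ℕ.< U →
            ¬ ¬ ∃ (Weighting L)
  weights U mem U>0 contra =
    stabilise (K ℕ.* U) Stable once λ (t , t≤ , stable) →
    ¬¬-Fin K (least t t≤) λ us →
    contra (weighting t stable us)
    where
    Stable′ : ℕ → Fin K × Fin U → Set
    Stable′ t (i , u) = Transported t i (+ suc (toℕ u)) → Transported (suc t) i (+ suc (toℕ u))
    Stable : ℕ → Fin (K ℕ.* U) → Set
    Stable t = Stable′ t ∘ remQuot U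
    once : ∀ p {s t} → s ℕ.< t → ¬ Stable s p → ¬ ¬ Stable t p
    once p s<t ¬st c = c λ x → ⊥-elim (¬st λ _ → transported-≤ (ℕ.≤⇒≤′ s<t) x)
    Least : ℕ → Fin K → ℕ → Set
    Least t i u = u ℕ.≤ U × (0 ℕ.< u × Transported t i (+ u)) × ∀ v → v ℕ.< u → ¬
      (0 ℕ.< v × Transported t i (+ v))
    least : ∀ t → t ℕ.≤ stableTime (K ℕ.* U) → ∀ i → ¬ ¬ (∃ λ u → L i → Least t i u)
    least t t≤ i c with L? i
    ... | no ¬l = c (0 , ⊥-elim ∘ ¬l)
    ... | yes l = ¬¬-least U (U>0 , transported-≤ (ℕ.≤⇒≤′ t≤) (mem l)) λ (u , q) → c (u , λ _ → q)
    weighting : ∀ t → (∀ p → Stable t p) → (∀ i → ∃ λ u → L i → Least t i u) → ∃ (Weighting L)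
    weighting t stable us = (λ i → u i ℕ.* m i) , (λ l → ℕ.*-mono-≤ (u>0 l) (m>0 l)) , divides-edge
      where
      u : Fin K → ℕ
      u i = proj₁ (us i)
      u>0 : ∀ {i} → L i → 0 ℕ.< u i
      u>0 {i} l = proj₁ (proj₁ (proj₂ (proj₂ (us i) l)))
      stable-u : ∀ {i} → L i → Transported (suc t) i (+ u i)
      stable-u {i} l with u i | proj₂ (us i) l
      ... | suc v | v<U , (_ , x) , _ = subst (λ n → Transported (suc t) i (+ suc n)) (toℕ-fromℕ< v<U)
        (subst (Stable′ t) (remQuot-combine i (fromℕ< v<U)) (stable (combine i (fromℕ< v<U)))
          (subst (λ n → Transported t i (+ suc n)) (sym (toℕ-fromℕ< v<U)) x))
      multiple : ∀ {j z} → L j → Transported t j z → + u j ∣ z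
      multiple {j} {z} l x with proj₂ (us j) l
      ... | _ , (u>0 , y) , minimal = divides q
        (trans z≡ (trans (cong (λ n → + n + q * + u j) r≡0) (+-identityˡ _)))
        where
        instance _ = ℕ.>-nonZero u>0
        r = z %ℕ u j
        q = z /ℕ u j
        z≡ : z ≡ + r + q * + u j
        z≡ = a≡a%ℕn+[a/ℕn]*n z (u j)
        isolate : ∀ r q u → r + q * u + - q * u ≡ r
        isolate = solve-∀
        xr : Transported t j (+ r)
        xr = subst (Transported t j) (trans (cong (_+ - q * + u j) z≡) (isolate (+ r) q (+ u j)))
          (transported-lin t (- q) x y)
        r≡0 : r ≡ 0
        r≡0 with r in eq
        ... | zero  = refl
        ... | suc s = ⊥-elim (minimal (suc s) (subst (ℕ._< u j) eq (n%ℕd<d z (u j)))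
                               (s≤s z≤n , subst (λ n → Transported t j (+ n)) eq xr))
      divides-edge : ∀ {i j a} → L i → Edge i j a → + D * + (u j ℕ.* m j) ∣ a * + (u i ℕ.* m i)
      divides-edge {i} {j} {a} l e with proj₂ (stable-u l) j a e
      ... | z , eq , x with multiple (L-closed l e) x
      ...   | divides q z≡ = divides q (trans (cong (a *_) (pos-* (u i) (m i)))
                (trans (sym (*-assoc a (+ u i) (+ m i)))
                (trans (sym eq) (trans (cong (λ y → + D * y * + m j) z≡)
                (trans (regroup (+ D) q (+ u j) (+ m j))
                  (cong (λ y → q * (+ D * y)) (sym (pos-* (u j) (m j)))))))))
        where
        regroup : ∀ D q u m → D * (q * u) * m ≡ q * (D * (u * m))
        regroup = solve-∀

  -- Weights are bounded only on a part L′ closed under edges. This is enough, because orbits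
  -- outside L′ can be left without any identification.
  record BoundedWeighting : Set₁ where
    field
      L′        : Fin K → Set
      L′?       : ∀ i → Dec (L′ i)
      L′⊆L      : ∀ {i} → L′ i → L i
      L′-closed : ∀ {i j a} → L′ i → Edge i j a → L′ j
      start     : ∃ L′
      w         : Fin K → ℕ
      weighting : Weighting L′ w
      w-bound   : ∀ {i} → L′ i → w i ℕ.≤ weightBound

  -- Starting from an orbit of least weight, edges only lead to orbits whose weight is a
  -- rational multiple of bounded height of that weight.
  bounded-weights : ∃ L → ∃ (Weighting L) → ¬ ¬ BoundedWeighting
  bounded-weights (i₁ , l₁) (w , w>0 , w-edge) contra =
    ¬¬-least {λ v → ∃ λ i → L i × w i ≡ v} (w i₁) (i₁ , l₁ , refl) λ (v , _ , (i₀ , l₀ , w≡v) , minimal) →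
    fromLeast i₀ l₀ λ {i} l → ℕ.≮⇒≥ λ lt → minimal (w i) (subst (w i ℕ.<_) w≡v lt) (i , l , refl)
    where
    fromLeast : ∀ i₀ → L i₀ → (∀ {i} → L i → w i₀ ℕ.≤ w i) → ⊥
    fromLeast i₀ l₀ least =
      -- When no orbit newly acquires a ratio of bounded height, the orbits that have one are closed
      -- under edges.
      stabilise K (λ t j → Ratio (suc t) j → Ratio t j)
        (λ j s<t ¬st c → ¬st λ r → ⊥-elim (c λ _ → ratio-≤ (ℕ.≤⇒≤′ s<t) r)) λ (t , t≤ , stable) →
      ¬¬-Fin K (λ j → excluded-middle {Ratio t j}) λ ratio? →
      contra (conclude t t≤ stable ratio?)
      where
      Ratio : ℕ → Fin K → Set
      Ratio t j = L j × ∃ λ a → ∃ λ b → (0 ℕ.< a × a ℕ.≤ height t) × (0 ℕ.< b × b ℕ.≤ height t) ×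
        b ℕ.* w j ≡ a ℕ.* w i₀
      ratio-≤ : ∀ {s t j} → s ℕ.≤′ t → Ratio s j → Ratio t j
      ratio-≤ p (l , a , b , (a> , a≤) , (b> , b≤) , eq) =
        l , a , b , (a> , ℕ.≤-trans a≤ (height-mono p)) , (b> , ℕ.≤-trans b≤ (height-mono p)) , eq
      w₀>0 = w>0 l₀
      ratio-step : ∀ {t j j′ a} → Ratio t j → Edge j j′ a → Ratio (suc t) j′
      ratio-step {t} {j} {j′} {a} (l , α , β , (α> , α≤) , (β> , β≤) , eq) e with w-edge l e
      ... | divides z az = L-closed l e , ∣ a ∣ ℕ.* α , D ℕ.* ∣ z ∣ ℕ.* β ,
              (ℕ.*-mono-≤ ∣a∣>0 α> , ℕ.≤-trans aα≤ (A-height-≤ t)) ,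
              (ℕ.*-mono-≤ (ℕ.*-mono-≤ D>0 ∣z∣>0) β> , ℕ.*-mono-≤ (ℕ.*-monoʳ-≤ D z≤) β≤) , eq′
        where
        az′ : ∣ a ∣ ℕ.* w j ≡ ∣ z ∣ ℕ.* (D ℕ.* w j′)
        az′ = trans (sym (∣i*j∣≡∣i∣*∣j∣ a (+ w j))) (trans (cong ∣_∣ az)
                (trans (∣i*j∣≡∣i∣*∣j∣ z _) (cong (∣ z ∣ ℕ.*_) (∣i*j∣≡∣i∣*∣j∣ (+ D) (+ w j′)))))
        ∣a∣>0 : 0 ℕ.< ∣ a ∣
        ∣a∣>0 = ℕ.n≢0⇒n>0 (proj₂ (Edge-bound e) ∘ ∣i∣≡0⇒i≡0)
        ∣z∣>0 : 0 ℕ.< ∣ z ∣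
        ∣z∣>0 = ℕ.n≢0⇒n>0 λ z≡0 → ℕ.<⇒≢ (ℕ.*-mono-≤ ∣a∣>0 (w>0 l))
                  (sym (trans az′ (cong (ℕ._* (D ℕ.* w j′)) z≡0)))
        aα≤ : ∣ a ∣ ℕ.* α ℕ.≤ A ℕ.* height t
        aα≤ = ℕ.*-mono-≤ (proj₁ (Edge-bound e)) α≤
        -- Leastness of `w i₀` enters here: a large multiplier z would make `w j′` smaller than
        -- `w i₀`.
        z≤ : ∣ z ∣ ℕ.≤ A ℕ.* height t
        z≤ = ℕ.≤-trans (ℕ.*-cancelʳ-≤ ∣ z ∣ (∣ a ∣ ℕ.* α) (w i₀) {{ℕ.>-nonZero w₀>0}} (begin
          ∣ z ∣ ℕ.* w i₀              ≤⟨ ℕ.*-monoʳ-≤ ∣ z ∣ (least (L-closed l e)) ⟩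
          ∣ z ∣ ℕ.* w j′              ≤⟨ ℕ.*-monoʳ-≤ ∣ z ∣ (ℕ.m≤n*m (w j′) D {{ℕ.>-nonZero D>0}}) ⟩
          ∣ z ∣ ℕ.* (D ℕ.* w j′)      ≡⟨ az′ ⟨
          ∣ a ∣ ℕ.* w j               ≤⟨ ℕ.*-monoʳ-≤ ∣ a ∣ (ℕ.m≤n*m (w j) β {{ℕ.>-nonZero β>}}) ⟩
          ∣ a ∣ ℕ.* (β ℕ.* w j)       ≡⟨ cong (∣ a ∣ ℕ.*_) eq ⟩
          ∣ a ∣ ℕ.* (α ℕ.* w i₀)      ≡⟨ ℕ.*-assoc ∣ a ∣ α (w i₀) ⟨
          ∣ a ∣ ℕ.* α ℕ.* w i₀        ∎)) aα≤
          where open ℕ.≤-Reasoning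
        eq′ : D ℕ.* ∣ z ∣ ℕ.* β ℕ.* w j′ ≡ ∣ a ∣ ℕ.* α ℕ.* w i₀
        eq′ = begin
          D ℕ.* ∣ z ∣ ℕ.* β ℕ.* w j′    ≡⟨ regroup D ∣ z ∣ β (w j′) ⟩
          β ℕ.* (∣ z ∣ ℕ.* (D ℕ.* w j′)) ≡⟨ cong (β ℕ.*_) az′ ⟨
          β ℕ.* (∣ a ∣ ℕ.* w j)          ≡⟨ swap β ∣ a ∣ (w j) ⟩
          ∣ a ∣ ℕ.* (β ℕ.* w j)          ≡⟨ cong (∣ a ∣ ℕ.*_) eq ⟩
          ∣ a ∣ ℕ.* (α ℕ.* w i₀)         ≡⟨ ℕ.*-assoc ∣ a ∣ α (w i₀) ⟨
          ∣ a ∣ ℕ.* α ℕ.* w i₀           ∎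
          where
          open ≡-Reasoning
          regroup : ∀ D z β w → D ℕ.* z ℕ.* β ℕ.* w ≡ β ℕ.* (z ℕ.* (D ℕ.* w))
          regroup = ℕ-Solver.solve-∀
          swap : ∀ β a w → β ℕ.* (a ℕ.* w) ≡ a ℕ.* (β ℕ.* w)
          swap = ℕ-Solver.solve-∀
      conclude : ∀ t → t ℕ.≤ stableTime K → (∀ j → Ratio (suc t) j → Ratio t j) → (∀ j → Dec (Ratio t j)) →
        BoundedWeighting
      conclude t t≤ stable ratio? = record
        { L′ = Ratio t ; L′? = ratio? ; L′⊆L = proj₁
        ; L′-closed = λ r e → stable _ (ratio-step {t} r e)
        ; start = i₀ , ratio-≤ {0} {t} (ℕ.≤⇒≤′ z≤n)
          (l₀ , 1 , 1 , (s≤s z≤n , ℕ.≤-refl) , (s≤s z≤n , ℕ.≤-refl) , refl)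
        ; w = w′
        ; weighting = (λ {j} r → proj₁ (proj₂ (witness j) r)) , λ {i} {j} {a} r e → edge {i} {j} {a} r
          (stable _ (ratio-step {t} r e)) (w-edge (proj₁ r) e)
        ; w-bound = λ {j} r → proj₁ (proj₂ (proj₂ (witness j) r))
        }
        where
        Y = height (stableTime K)
        witness : ∀ j → ∃ λ v → Ratio t j → 0 ℕ.< v × v ℕ.≤ weightBound × v ℕ.* w i₀ ≡ Y ! ℕ.* w j
        witness j with ratio? j
        ... | no ¬r = 0 , ⊥-elim ∘ ¬r
        ... | yes (l , a , b , (a> , a≤) , (b> , b≤) , eq) with ∣! b> (ℕ.≤-trans b≤ (height-mono (ℕ.≤⇒≤′ t≤)))
        ...   | ℕ.divides q Y!≡ = q ℕ.* a , λ _ → ℕ.*-mono-≤ q>0 a> , ℕ.*-mono-≤ q≤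
          (ℕ.≤-trans a≤ (height-mono (ℕ.≤⇒≤′ t≤))) , scaled
          where
          q>0 : 0 ℕ.< q
          q>0 = ℕ.n≢0⇒n>0 λ { refl → ℕ.<⇒≢ (ℕ.1≤n! Y) (sym Y!≡) }
          q≤ : q ℕ.≤ Y !
          q≤ = ℕ.≤-trans (ℕ.m≤m*n q b {{ℕ.>-nonZero b>}}) (ℕ.≤-reflexive (sym Y!≡))
          scaled : q ℕ.* a ℕ.* w i₀ ≡ Y ! ℕ.* w j
          scaled = trans (ℕ.*-assoc q a (w i₀)) (trans (cong (q ℕ.*_) (sym eq))
                     (trans (sym (ℕ.*-assoc q b (w j))) (cong (ℕ._* w j) (sym Y!≡))))
        w′ : Fin K → ℕ
        w′ = proj₁ ∘ witness
        edge : ∀ {i j a} → Ratio t i → Ratio t j → + D * + w j ∣ a * + w i → + D * + w′ j ∣ a * + w′ i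
        edge {i} {j} {a} r r′ (divides q eq) = *-cancelʳ-∣ (+ w i₀) {{ℕ.>-nonZero w₀>0}}
          (divides q (begin
            a * + w′ i * + w i₀       ≡⟨ *-assoc a (+ w′ i) (+ w i₀) ⟩
            a * (+ w′ i * + w i₀)     ≡⟨ cong (a *_) (scaled i r) ⟩
            a * (+ (Y !) * + w i)     ≡⟨ swap a (+ (Y !)) (+ w i) ⟩
            + (Y !) * (a * + w i)     ≡⟨ cong (+ (Y !) *_) eq ⟩
            + (Y !) * (q * (+ D * + w j)) ≡⟨ regroup (+ (Y !)) q (+ D) (+ w j) ⟩
            q * (+ D * (+ (Y !) * + w j)) ≡⟨ cong (λ v → q * (+ D * v)) (scaled j r′) ⟨
            q * (+ D * (+ w′ j * + w i₀)) ≡⟨ cong (q *_) (*-assoc (+ D) (+ w′ j) (+ w i₀)) ⟨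
            q * (+ D * + w′ j * + w i₀) ∎))
          where
          open ≡-Reasoning
          scaled : ∀ i → Ratio t i → + w′ i * + w i₀ ≡ + (Y !) * + w i
          scaled i r = trans (sym (pos-* (w′ i) (w i₀)))
            (trans (cong +_ (proj₂ (proj₂ (proj₂ (witness i) r)))) (pos-* (Y !) (w i)))
          swap : ∀ a y v → a * (y * v) ≡ y * (a * v)
          swap = solve-∀
          regroup : ∀ y q d v → y * (q * (d * v)) ≡ q * (d * (y * v))
          regroup = solve-∀

-- Equivariant congruences on Fin K × ℤ

abs-+ : ∀ {m n} x y → ∣ x ∣ ℕ.≤ m → ∣ y ∣ ℕ.≤ n → ∣ x + y ∣ ℕ.≤ m ℕ.+ n
abs-+ x y p q = ℕ.≤-trans (∣i+j∣≤∣i∣+∣j∣ x y) (ℕ.+-mono-≤ p q)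

abs-- : ∀ {m n} x y → ∣ x ∣ ℕ.≤ m → ∣ y ∣ ℕ.≤ n → ∣ x - y ∣ ℕ.≤ m ℕ.+ n
abs-- x y p q = ℕ.≤-trans (∣i-j∣≤∣i∣+∣j∣ x y) (ℕ.+-mono-≤ p q)

∣-respʳ : ∀ {m x y} → x ≡ y → m ∣ x → m ∣ y
∣-respʳ {m} eq = subst (m ∣_) eq

module Dynamics {K n : ℕ} (k : Fin K → ℕ) (g : Fin n → Fin K × ℤ → Fin K × ℤ) (F : Fin K → Bool) where

  Pt : Set
  Pt = Fin K × ℤ

  -- Equality of the given set, pulled back along the covering of every orbit by ℤ.
  Ker : Pt → Pt → Set
  Ker (i , x) (j , y) = i ≡ j × + k i ∣ y - x

  Ker? : ∀ p q → Dec (Ker p q)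
  Ker? (i , x) (j , y) = (i ≟ᶠ j) ×-dec (+ k i ∣? y - x)

  record Sol (R : Pt → Pt → Set) : Set where
    field
      rel-refl  : ∀ {p} → R p p
      rel-sym   : ∀ {p q} → R p q → R q p
      rel-trans : ∀ {p q s} → R p q → R q s → R p s
      shift     : ∀ {i x j y} z → R (i , x) (j , y) → R (i , x + z) (j , y + z)
      kern      : ∀ {i x y} → + k i ∣ y - x → R (i , x) (i , y)
      congr     : ∀ f {p q} → R p q → R (g f p) (g f q)
      respF     : ∀ {p q} → R p q → F (proj₁ p) ≡ F (proj₁ q)

  Proper : (Pt → Pt → Set) → Set
  Proper R = ∃ λ p → ∃ λ q → R p q × ¬ Ker p q

  Period : (Pt → Pt → Set) → Fin K → ℕ → Set
  Period R i m = ∀ {x y} → (R (i , x) (i , y) → + m ∣ y - x) × (+ m ∣ y - x → R (i , x) (i , y))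

  BoundedBy : ℕ → (Pt → Pt → Set) → Set
  BoundedBy B R = ∀ i → ∃ λ m → m ℕ.≤ B × Period R i m

  module Relation {R : Pt → Pt → Set} (sol : Sol R) where
    open Sol sol public

    -- By equivariance only the difference of the integer coordinates matters.
    move : ∀ {i x j y} x′ y′ → y′ - x′ ≡ y - x → R (i , x) (j , y) → R (i , x′) (j , y′)
    move {i} {x} {j} {y} x′ y′ eq r =
      subst₂ (λ u v → R (i , u) (j , v)) (left x x′)
        (trans (right x y x′) (trans (cong (_+ x′) (sym eq)) (back y′ x′))) (shift (x′ - x) r)
      where
      left : ∀ x x′ → x + (x′ - x) ≡ x′
      left = solve-∀
      right : ∀ x y x′ → y + (x′ - x) ≡ (y - x) + x′
      right = solve-∀
      back : ∀ y x → (y - x) + x ≡ y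
      back = solve-∀

    multiple⁺ : ∀ {i x d} → R (i , x) (i , x + d) → ∀ t → R (i , x) (i , x + + t * d)
    multiple⁺ {i} {x} {d} r zero    = subst (λ v → R (i , x) (i , v)) (sym (+-identityʳ x)) rel-refl
    multiple⁺ {i} {x} {d} r (suc t) = rel-trans (multiple⁺ r t)
      (move (x + + t * d) (x + + suc t * d) (diff x (+ t) d) r)
      where
      diff : ∀ x t d → (x + (+ 1 + t) * d) - (x + t * d) ≡ (x + d) - x
      diff = solve-∀

    multiple : ∀ {i x d} → R (i , x) (i , x + d) → ∀ t → R (i , x) (i , x + t * d)
    multiple r (+ t) = multiple⁺ r t
    multiple {i} {x} {d} r -[1+ t ] = rel-sym
      (move (x + -[1+ t ] * d) x (diff x (+ suc t) d) (multiple⁺ r (suc t)))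
      where
      diff : ∀ x t d → x - (x + (- t) * d) ≡ (x + t * d) - x
      diff = solve-∀

    private
      sub0 : ∀ e → e - + 0 ≡ e
      sub0 = solve-∀
      diff₁ : ∀ x y → (y - x) - + 0 ≡ y - x
      diff₁ = solve-∀

    -- Differences of related points of one orbit form a subgroup of ℤ, generated by its least
    -- positive element, or by 0 if there is none.
    period-exists : ∀ i → ¬ ¬ (∃ λ m → Period R i m)
    period-exists i c = excluded-middle {∃ λ e → 0 ℕ.< e × R (i , + 0) (i , + e)} λ
      { (no none) → c (0 , λ {x} {y} → zero-to none , λ d → kern
        (subst (+ k i ∣_) (sym (0∣⇒≡0 d)) (divides (+ 0) refl)))
      ; (yes (e , e>0 , r)) → ¬¬-least {λ e → 0 ℕ.< e × R (i , + 0) (i , + e)} e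
        (e>0 , r) λ (m , _ , (m>0 , rm) , least) →
          c (m , λ {x} {y} → to m m>0 rm least , from m rm)
      }
      where
      posi : ∀ z → R (i , + 0) (i , z) → R (i , + 0) (i , + ∣ z ∣)
      posi (+ n)    r = r
      posi -[1+ n ] r = rel-sym (move (+ suc n) (+ 0) (+-identityˡ -[1+ n ]) r)
      zero-to : ¬ (∃ λ e → 0 ℕ.< e × R (i , + 0) (i , + e)) → ∀ {x y} → R (i , x) (i , y) → + 0 ∣ y - x
      zero-to none {x} {y} r with ∣ y - x ∣ in eq | posi (y - x) (move (+ 0) (y - x) (diff₁ x y) r)
      ... | zero  | _ = ∣-reflexive (sym (∣i∣≡0⇒i≡0 eq))
      ... | suc e | r′ = ⊥-elim (none (suc e , s≤s z≤n , r′))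
      from : ∀ m → R (i , + 0) (i , + m) → ∀ {x y} → + m ∣ y - x → R (i , x) (i , y)
      from m rm {x} {y} (divides q eq) = move x y (trans eq (sym (trans (sub0 _) (+-identityˡ _))))
        (multiple rm q)
      to : ∀ m → 0 ℕ.< m → R (i , + 0) (i , + m) → (∀ v → v ℕ.< m → ¬ (0 ℕ.< v × R (i , + 0) (i , + v))) →
           ∀ {x y} → R (i , x) (i , y) → + m ∣ y - x
      to m m>0 rm least {x} {y} r = divides (z /ℕ m)
        (trans z≡ (trans (cong (λ v → + v + z /ℕ m * + m) r≡0) (+-identityˡ _)))
        where
        instance _ = ℕ.>-nonZero m>0
        z = y - x
        z≡ : z ≡ + (z %ℕ m) + (z /ℕ m) * + m
        z≡ = a≡a%ℕn+[a/ℕn]*n z m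
        isolate : ∀ r w → (r + w) - (+ 0 + w) ≡ r - + 0
        isolate = solve-∀
        rem : R (i , + 0) (i , + (z %ℕ m))
        rem = move (+ 0) (+ (z %ℕ m)) (trans (sym (isolate (+ (z %ℕ m)) (z /ℕ m * + m)))
                                        (cong (λ v → v - (+ 0 + z /ℕ m * + m)) (sym z≡)))
                (rel-trans (rel-sym (multiple rm (z /ℕ m))) (move (+ 0) z (diff₁ x y) r))
        r≡0 : z %ℕ m ≡ 0
        r≡0 with z %ℕ m in eq | rem
        ... | zero  | _ = refl
        ... | suc v | s = ⊥-elim (least (suc v) (subst (ℕ._< m) eq (n%ℕd<d z m)) (s≤s z≤n , s))

  module Periodic {R : Pt → Pt → Set} (sol : Sol R) (m : Fin K → ℕ) (per : ∀ i → Period R i (m i)) where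
    open Relation sol public

    -- Shifting by `m j` keeps y in its class, hence also x, so `m i` divides `m j`; symmetry gives
    -- the converse.
    m≡ : ∀ {i x j y} → R (i , x) (j , y) → m i ≡ m j
    m≡ {i} {x} {j} {y} r = ℕ.∣-antisym (∣⇒∣ᵤ (half r)) (∣⇒∣ᵤ (half (rel-sym r)))
      where
      cancel : ∀ y m → (y + m) - y ≡ m
      cancel = solve-∀
      half : ∀ {i x j y} → R (i , x) (j , y) → + m i ∣ + m j
      half {i} {x} {j} {y} r = ∣-respʳ (cancel x (+ m j)) (proj₁ (per i)
        (rel-trans r (rel-trans (proj₂ (per j)
          (divides (+ 1) (trans (cancel y (+ m j)) (sym (*-identityˡ (+ m j)))))) (rel-sym (shift (+ m j) r)))))

    m∣k : ∀ i → + m i ∣ + k i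
    m∣k i = ∣-respʳ (+-identityʳ (+ k i))
      (proj₁ (per i {+ 0} {+ k i}) (kern (divides (+ 1)
        (trans (+-identityʳ (+ k i)) (sym (*-identityˡ (+ k i)))))))

    R⇒∣ : ∀ {i x y} → R (i , x) (i , y) → + m i ∣ y - x
    R⇒∣ {i} = proj₁ (per i)

    ∣⇒R : ∀ {i x y} → + m i ∣ y - x → R (i , x) (i , y)
    ∣⇒R {i} = proj₂ (per i)

lower : ∀ {N b x d} → + (N ℕ.+ b) ≤ x → ∣ d ∣ ℕ.≤ b → + N ≤ x + d
lower {N} {b} {x} {d} p q = ≤-trans (≤-reflexive (split (+ N) (+ b)))
  (+-mono-≤ (≤-trans (≤-reflexive (sym (pos-+ N b))) p) (≤-trans (neg-mono-≤ (+≤+ q)) (-i≤∣i∣′ d)))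
  where
  split : ∀ N b → N ≡ (N + b) + - b
  split = solve-∀

upper : ∀ {N b x d} → x ≤ - + (N ℕ.+ b) → ∣ d ∣ ℕ.≤ b → x + d ≤ - + N
upper {N} {b} {x} {d} p q = ≤-trans (+-mono-≤ p (≤-trans (i≤+∣i∣ d) (+≤+ q)))
  (≤-reflexive (trans (cong (λ v → - v + + b) (pos-+ N b)) (split (+ N) (+ b))))
  where
  split : ∀ N b → - (N + b) + b ≡ - N
  split = solve-∀

-- Beyond M every integer lies on one of finitely many rays of step D or -D, so bounds at their
-- starting points control all of ℤ.
position : ∀ M D .{{_ : ℕ.NonZero D}} x → ∣ x ∣ ℕ.≤ M ⊎
  (∃ λ r → ∃ λ q → r ℕ.< D × x ≡ + (M ℕ.+ r) + + q * + D) ⊎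
  (∃ λ r → ∃ λ q → r ℕ.< D × x ≡ - + (M ℕ.+ r) + + q * - + D)
position M D x with ∣ x ∣ ℕ.≤? M
... | yes p = inj₁ p
... | no ¬p = inj₂ (signed x refl)
  where
  e = ∣ x ∣ ℕ.∸ M
  decompose : ∣ x ∣ ≡ (M ℕ.+ e ℕ.% D) ℕ.+ e ℕ./ D ℕ.* D
  decompose = trans (sym (ℕ.m+[n∸m]≡n (ℕ.<⇒≤ (ℕ.≰⇒> ¬p)))) (trans (cong (M ℕ.+_) (ℕ.m≡m%n+[m/n]*n e D))
                (sym (ℕ.+-assoc M (e ℕ.% D) (e ℕ./ D ℕ.* D))))
  decompose′ : + ∣ x ∣ ≡ + (M ℕ.+ e ℕ.% D) + + (e ℕ./ D) * + D
  decompose′ = trans (cong +_ decompose) (trans (pos-+ (M ℕ.+ e ℕ.% D) (e ℕ./ D ℕ.* D))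
                 (cong (λ v → + (M ℕ.+ e ℕ.% D) + v) (pos-* (e ℕ./ D) D)))
  negate : ∀ a q d → - (a + q * d) ≡ - a + q * - d
  negate = solve-∀
  signed : ∀ y → x ≡ y → (∃ λ r → ∃ λ q → r ℕ.< D × x ≡ + (M ℕ.+ r) + + q * + D) ⊎
                         (∃ λ r → ∃ λ q → r ℕ.< D × x ≡ - + (M ℕ.+ r) + + q * - + D)
  signed (+ y)    eq = inj₁ (e ℕ.% D , e ℕ./ D , ℕ.m%n<n e D , trans
    (trans eq (cong (+_ ∘ ∣_∣) (sym eq))) decompose′)
  signed -[1+ y ] eq = inj₂ (e ℕ.% D , e ℕ./ D , ℕ.m%n<n e D , trans (trans eq (cong (-_ ∘ +_ ∘ ∣_∣) (sym eq)))
                         (trans (cong -_ decompose′) (negate (+ (M ℕ.+ e ℕ.% D)) (+ (e ℕ./ D)) (+ D))))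

-- A common multiple of the finite characteristics; infinite orbits contribute the factor 1.
periodScale : ∀ {K} → (Fin K → ℕ) → ℕ
periodScale {K} k = product (map (λ i → 1 ℕ.⊔ k i) (allFin K))

periodScale>0 : ∀ {K} (k : Fin K → ℕ) → 0 ℕ.< periodScale k
periodScale>0 {K} k = product>0 (λ i → 1 ℕ.⊔ k i) (λ i → ℕ.m≤m⊔n 1 (k i)) (allFin K)

∣-periodScale : ∀ {K} (k : Fin K → ℕ) i → k i ≢ 0 → k i ℕ.∣ periodScale k
∣-periodScale k i k≢0 = subst (ℕ._∣ periodScale k) (ℕ.m≤n⇒m⊔n≡n (ℕ.n≢0⇒n>0 k≢0))
  (∈-product (λ i → 1 ℕ.⊔ k i) (∈-allFin i))

-- Constants that determine the width of the gap.

module Bounds {K n : ℕ} (g : Fin n → Fin K × ℤ → Fin K × ℤ) (N D : ℕ) (D>0 : 0 ℕ.< D)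
  (ray : ∀ f i x E → + D ∣ E → Outward N E x → ∃ (Ray (λ x → g f (i , x)) x E)) where

  size : Fin n → Fin K → ℤ → ℕ
  size f i x = ∣ proj₂ (g f (i , x)) ∣

  maxSize : ℕ → ℕ
  maxSize M = sumFin n λ f → sumFin K λ i → maxOn (size f i) M

  size≤ : ∀ {M} f i x → ∣ x ∣ ℕ.≤ M → size f i x ℕ.≤ maxSize M
  size≤ {M} f i x p = ℕ.≤-trans (≤-maxOn (size f i) M x p)
    (ℕ.≤-trans (≤-sumFin (λ i → maxOn (size f i) M) i) (≤-sumFin (λ f → sumFin K λ i → maxOn (size f i) M) f))

  rise : Fin n → Fin K → ℤ → ℤ → ℤ
  rise f i x E = proj₂ (g f (i , x + E)) - proj₂ (g f (i , x))

  rise≤ : ∀ {M} f i x E → ∣ x ∣ ℕ.≤ M → ∣ x + E ∣ ℕ.≤ M → ∣ rise f i x E ∣ ℕ.≤ maxSize M ℕ.+ maxSize M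
  rise≤ f i x E p q = abs-- (proj₂ (g f (i , x + E))) (proj₂ (g f (i , x))) (size≤ f i (x + E) q)
    (size≤ f i x p)

  along : ∀ f i x E → + D ∣ E → Outward N E x → Ray (λ x → g f (i , x)) x E (rise f i x E)
  along f i x E d o t with ray f i x E d o
  ... | a , r = trans (r t) (cong (λ v → proj₁ (g f (i , x)) , proj₂ (g f (i , x)) + + t * v) a≡)
    where
    first : ∀ x E → x + + 1 * E ≡ x + E
    first = solve-∀
    cancel : ∀ y a → a ≡ (y + + 1 * a) - y
    cancel = solve-∀
    a≡ : a ≡ rise f i x E
    a≡ = trans (cancel (proj₂ (g f (i , x))) a) (cong (_- proj₂ (g f (i , x)))
           (trans (cong proj₂ (sym (r 1))) (cong (λ v → proj₂ (g f (i , v))) (first x E))))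

  -- From any point of [N, N + D), `span` steps of length D downwards lead to -N or below, where the
  -- left rays start. `radius` covers this walk and one more step. `driftStep` is the error made by
  -- one edge in `edge-step`.
  span radius reach slopeBound driftStep : ℕ
  span       = suc (N ℕ.+ N)
  reach      = (2 ℕ.+ span) ℕ.* D
  radius     = N ℕ.+ reach
  slopeBound = suc (maxSize radius ℕ.+ maxSize radius)
  driftStep  = D ℕ.* (maxSize radius ℕ.+ maxSize radius) ℕ.+ slopeBound ℕ.* D

  -- The error in `Carried` after a edges: a further edge multiplies it by a slope and adds D^a
  -- times `driftStep`. The leading `drift a` makes the sequence monotone.
  drift : ℕ → ℕ
  drift zero    = 0
  drift (suc a) = drift a ℕ.+ (slopeBound ℕ.* drift a ℕ.+ D ℕ.^ a ℕ.* driftStep)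

  -- The number of edges required by `weights` for U = K!.
  pathLength : ℕ
  pathLength = stableTime (K ℕ.* K !)

  -- The gap must accommodate the sum of two near distances, differences of images and slopes within
  -- `radius′ b`, and the difference of two drift errors.
  radius′ slack next : ℕ → ℕ
  radius′ b = (b ℕ.+ b) ℕ.+ radius
  slack b   = (b ℕ.+ b) ℕ.+ ((2 ℕ.+ span) ℕ.* (maxSize (radius′ b) ℕ.+ maxSize (radius′ b)) ℕ.+
    (drift pathLength ℕ.+ drift pathLength))
  next b    = b ℕ.+ slack b

  2b≤slack : ∀ b → b ℕ.+ b ℕ.≤ slack b
  2b≤slack b = ℕ.m≤m+n (b ℕ.+ b) _

  size≤slack : ∀ b → (2 ℕ.+ span) ℕ.* (maxSize (radius′ b) ℕ.+ maxSize (radius′ b)) ℕ.≤ slack b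
  size≤slack b = ℕ.≤-trans (ℕ.m≤m+n _ _) (ℕ.m≤n+m _ (b ℕ.+ b))

  drift≤slack : ∀ b → drift pathLength ℕ.+ drift pathLength ℕ.≤ slack b
  drift≤slack b = ℕ.≤-trans (ℕ.m≤n+m _ ((2 ℕ.+ span) ℕ.* (maxSize (radius′ b) ℕ.+ maxSize (radius′ b))))
    (ℕ.m≤n+m _ (b ℕ.+ b))

  slack≤next : ∀ b → slack b ℕ.≤ next b
  slack≤next b = ℕ.m≤n+m (slack b) b

  2size≤slack : ∀ b → maxSize (radius′ b) ℕ.+ maxSize (radius′ b) ℕ.≤ slack b
  2size≤slack b = ℕ.≤-trans (ℕ.m≤n*m _ (2 ℕ.+ span)) (size≤slack b)

  4size≤slack : ∀ b → (maxSize (radius′ b) ℕ.+ maxSize (radius′ b)) ℕ.+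
    (maxSize (radius′ b) ℕ.+ maxSize (radius′ b)) ℕ.≤ slack b
  4size≤slack b = ℕ.≤-trans (ℕ.+-monoʳ-≤ G (ℕ.m≤m+n G (span ℕ.* G))) (size≤slack b)
    where G = maxSize (radius′ b) ℕ.+ maxSize (radius′ b)

  b+D+D≤radius′ : ∀ b → (N ℕ.+ b ℕ.+ D) ℕ.+ (b ℕ.+ D) ℕ.≤ radius′ b
  b+D+D≤radius′ b = ℕ.≤-trans (ℕ.≤-reflexive (shuffle N b D)) (ℕ.+-monoʳ-≤ (b ℕ.+ b) (ℕ.+-monoʳ-≤ N
                      (ℕ.≤-trans (ℕ.≤-reflexive (two D)) (ℕ.*-monoˡ-≤ D (ℕ.m≤m+n 2 span)))))
    where
    shuffle : ∀ N b D → (N ℕ.+ b ℕ.+ D) ℕ.+ (b ℕ.+ D) ≡ (b ℕ.+ b) ℕ.+ (N ℕ.+ (D ℕ.+ D))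
    shuffle = ℕ-Solver.solve-∀
    two : ∀ D → D ℕ.+ D ≡ 2 ℕ.* D
    two = ℕ-Solver.solve-∀

-- Bounding the periods of a solution.

module Flow {K n : ℕ} (k : Fin K → ℕ) (g : Fin n → Fin K × ℤ → Fin K × ℤ) (F : Fin K → Bool)
  (N D : ℕ) (D>0 : 0 ℕ.< D)
  (ray : ∀ f i x E → + D ∣ E → Outward N E x → ∃ (Ray (λ x → g f (i , x)) x E))
  (g-periodic : ∀ f i {x y} → + k i ∣ y - x → g f (i , x) ≡ g f (i , y)) where

  open Dynamics k g F
  open Bounds g N D D>0 ray

  instance
    D-nonZero : ℕ.NonZero D
    D-nonZero = ℕ.>-nonZero D>0

  -- No period and no distance between related points lies strictly between b and next b.
  -- Cutting R down to distances at most b then leaves a solution whose periods are at most b.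
  module Gap {R : Pt → Pt → Set} (sol : Sol R) (m : Fin K → ℕ) (per : ∀ i → Period R i (m i))
    (b : ℕ) (k≤b : ∀ i → k i ℕ.≤ b)
    (m-gap : ∀ i → m i ≡ 0 ⊎ (0 ℕ.< m i × m i ℕ.≤ b) ⊎ next b ℕ.< m i)
    (offset-gap : ∀ i j e → ∣ e ∣ ℕ.≤ next b → R (i , + 0) (j , e) → ∃ λ e′ → ∣ e′ ∣ ℕ.≤ b × R (i , + 0)
      (j , e′))
    where

    open Periodic sol m per

    Small : Fin K → Set
    Small i = 0 ℕ.< m i × m i ℕ.≤ b

    -- On orbits with a small period all of R is kept, since there every related pair differs by
    -- multiples of the period from one at distance at most b.
    Near : Pt → Pt → Set
    Near p q = R p q × (Small (proj₁ p) ⊎ ∣ proj₂ q - proj₂ p ∣ ℕ.≤ b)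

    private
      imageBound = maxSize (radius′ b)

    -- The way the gap is used throughout: bounded congruences become equations.
    tiny⇒0 : ∀ i {e} → (m i ≡ 0 ⊎ next b ℕ.< m i) → + m i ∣ e → ∣ e ∣ ℕ.≤ next b → e ≡ + 0
    tiny⇒0 i {e} (inj₁ z) d p = 0∣⇒≡0 (subst (λ v → + v ∣ e) z d)
    tiny⇒0 i {e} (inj₂ l) d p = ∣∧∣∣<⇒≡0 d (ℕ.≤-<-trans p l)

    small-or : ∀ i → Small i ⊎ (m i ≡ 0 ⊎ next b ℕ.< m i)
    small-or i with m-gap i
    ... | inj₁ z        = inj₂ (inj₁ z)
    ... | inj₂ (inj₁ s) = inj₁ s
    ... | inj₂ (inj₂ l) = inj₂ (inj₂ l)

    -- The gap provides a related offset e of size at most b. Unless the period is small, y - x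
    -- differs from e by a multiple of it of size at most `next b`, hence not at all.
    near : ∀ {i x j y} → R (i , x) (j , y) → ∣ y - x ∣ ℕ.≤ slack b → Near (i , x) (j , y)
    near {i} {x} {j} {y} r close with small-or i
    ... | inj₁ s = r , inj₁ s
    ... | inj₂ ¬s with offset-gap i j (y - x) (ℕ.≤-trans close (slack≤next b)) (move (+ 0) (y - x) (diff x y) r)
      where
      diff : ∀ x y → (y - x) - + 0 ≡ y - x
      diff = solve-∀
    ...   | e , e≤ , re = r , inj₂ (subst (λ v → ∣ v ∣ ℕ.≤ b) (sym (i-j≡0⇒i≡j (y - x) e e≡)) e≤)
      where
      diff : ∀ x y → (y - x) - + 0 ≡ y - x
      diff = solve-∀
      gap : R (j , e) (j , y - x)
      gap = rel-trans (rel-sym re) (move (+ 0) (y - x) (diff x y) r)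
      e≡ : (y - x) - e ≡ + 0
      e≡ = tiny⇒0 j (subst (λ v → v ≡ 0 ⊎ next b ℕ.< v) (m≡ r) ¬s) (R⇒∣ gap)
             (ℕ.≤-trans (abs-- (y - x) e close e≤) (ℕ.≤-reflexive (ℕ.+-comm (slack b) b)))

    small-sym : ∀ {p q} → R p q → Small (proj₁ q) → Small (proj₁ p)
    small-sym r s rewrite m≡ r = s

    near-kern : ∀ {i x y} → + k i ∣ y - x → Near (i , x) (i , y)
    near-kern {i} {x} {y} d = kern d , small (k i) (m i) refl refl
      where
      small : ∀ c v → k i ≡ c → m i ≡ v → Small i ⊎ ∣ y - x ∣ ℕ.≤ b
      small zero v eq _ = inj₂ (subst (λ v → ∣ v ∣ ℕ.≤ b) (sym (0∣⇒≡0 (subst (λ v → + v ∣ y - x) eq d))) z≤n)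
      small (suc c) zero eq eq′ = case trans (sym eq) (ℕ.0∣⇒≡0 (subst (ℕ._∣ k i) eq′ (∣⇒∣ᵤ (m∣k i)))) of λ ()
      small (suc c) (suc v) eq eq′ = inj₁ (subst (0 ℕ.<_) (sym eq′) (s≤s z≤n) ,
        ℕ.≤-trans (ℕ.∣⇒≤ (subst (m i ℕ.∣_) eq (∣⇒∣ᵤ (m∣k i)))) (subst (ℕ._≤ b) eq (k≤b i)))

    near-sym : ∀ {p q} → Near p q → Near q p
    near-sym {i , x} {j , y} (r , inj₁ s) = rel-sym r , inj₁ (small-sym (rel-sym r) s)
    near-sym {i , x} {j , y} (r , inj₂ c) = rel-sym r , inj₂ (subst (ℕ._≤ b) (∣i-j∣≡∣j-i∣ y x) c)

    near-trans : ∀ {p q s} → Near p q → Near q s → Near p s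
    near-trans (r , inj₁ s) (r′ , _)      = rel-trans r r′ , inj₁ s
    near-trans (r , inj₂ c) (r′ , inj₁ s) = rel-trans r r′ , inj₁ (small-sym r s)
    near-trans {i , x} {j , y} {l , z} (r , inj₂ c) (r′ , inj₂ c′) = near (rel-trans r r′)
      (ℕ.≤-trans (subst (λ v → ∣ v ∣ ℕ.≤ b ℕ.+ b) (telescope x y z) (abs-+ (y - x) (z - y) c c′)) (2b≤slack b))
      where
      telescope : ∀ x y z → (y - x) + (z - y) ≡ z - x
      telescope = solve-∀

    near-shift : ∀ {i x j y} z → Near (i , x) (j , y) → Near (i , x + z) (j , y + z)
    near-shift {i} {x} {j} {y} z (r , c) = shift z r , map₂ (subst (λ v → ∣ v ∣ ℕ.≤ b) (same x y z)) c
      where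
      same : ∀ x y z → y - x ≡ (y + z) - (x + z)
      same = solve-∀

    -- Comparing the two ends of a ray shows that close starting points have the same slope.
    congr-far : ∀ f i j d x E q → + D ∣ E → Outward N E x → Outward N E (x + d) →
                ∣ x ∣ ℕ.≤ N ℕ.+ b ℕ.+ D → ∣ E ∣ ℕ.≤ D → ∣ d ∣ ℕ.≤ b →
                R (i , x + + q * E) (j , x + + q * E + d) →
                Near (g f (i , x + + q * E)) (g f (j , x + + q * E + d))
    congr-far f i j d x E q D∣E o o′ x≤ E≤ d≤ r =
      subst₂ Near (sym (onRay q)) (sym (onRay′ q)) (go (small-or j₁))
      where
      i₁ = proj₁ (g f (i , x))
      y = proj₂ (g f (i , x))
      j₁ = proj₁ (g f (j , x + d))
      y′ = proj₂ (g f (j , x + d))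
      a = rise f i x E
      a′ = rise f j (x + d) E
      onRay : ∀ t → g f (i , x + + t * E) ≡ (i₁ , y + + t * a)
      onRay = along f i x E D∣E o
      swap : ∀ x e d → x + e + d ≡ x + d + e
      swap = solve-∀
      onRay′ : ∀ t → g f (j , x + + t * E + d) ≡ (j₁ , y′ + + t * a′)
      onRay′ t = trans (cong (λ v → g f (j , v)) (swap x (+ t * E) d)) (along f j (x + d) E D∣E o′ t)
      images : ∀ t → R (i₁ , y + + t * a) (j₁ , y′ + + t * a′)
      images t = subst₂ R (onRay t) (onRay′ t)
        (congr f (move (x + + t * E) (x + + t * E + d) (offset x (+ t * E) (+ q * E) d) r))
        where
        offset : ∀ x e e′ d → (x + e + d) - (x + e) ≡ (x + e′ + d) - (x + e′)
        offset = solve-∀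
      bound : ∀ x d → ∣ x ∣ ℕ.≤ N ℕ.+ b ℕ.+ D → ∣ d ∣ ℕ.≤ b ℕ.+ D → ∣ x + d ∣ ℕ.≤ radius′ b
      bound x d p q = ℕ.≤-trans (abs-+ x d p q) (b+D+D≤radius′ b)
      x≤′ : ∣ x ∣ ℕ.≤ radius′ b
      x≤′ = ℕ.≤-trans x≤ (ℕ.≤-trans (ℕ.m≤m+n _ (b ℕ.+ D)) (b+D+D≤radius′ b))
      x+d≤′ : ∣ x + d ∣ ℕ.≤ radius′ b
      x+d≤′ = bound x d x≤ (ℕ.≤-trans d≤ (ℕ.m≤m+n b D))
      y≤ : ∣ y ∣ ℕ.≤ imageBound
      y≤ = size≤ f i x x≤′
      y′≤ : ∣ y′ ∣ ℕ.≤ imageBound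
      y′≤ = size≤ f j (x + d) x+d≤′
      a≤ : ∣ a ∣ ℕ.≤ imageBound ℕ.+ imageBound
      a≤ = rise≤ f i x E x≤′ (bound x E x≤ (ℕ.≤-trans E≤ (ℕ.m≤n+m D b)))
      a′≤ : ∣ a′ ∣ ℕ.≤ imageBound ℕ.+ imageBound
      a′≤ = rise≤ f j (x + d) E x+d≤′ (subst (λ v → ∣ v ∣ ℕ.≤ radius′ b) (sym (+-assoc x d E))
        (bound x (d + E) x≤ (abs-+ d E d≤ E≤)))
      slope-diff : + m j₁ ∣ a′ - a
      slope-diff = ∣-respʳ (cancel y′ a a′)
        (R⇒∣ (rel-trans (rel-sym (move (y + + 1 * a) (y′ + + 1 * a) (shifted y y′ a) (images 0))) (images 1)))
        where
        cancel : ∀ y a a′ → (y + + 1 * a′) - (y + + 1 * a) ≡ a′ - a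
        cancel = solve-∀
        shifted : ∀ y y′ a → (y′ + + 1 * a) - (y + + 1 * a) ≡ (y′ + + 0) - (y + + 0)
        shifted = solve-∀
      go : Small j₁ ⊎ (m j₁ ≡ 0 ⊎ next b ℕ.< m j₁) → Near (i₁ , y + + q * a) (j₁ , y′ + + q * a′)
      go (inj₁ s)  = images q , inj₁ (small-sym (images q) s)
      go (inj₂ ¬s) = near (images q) (subst (λ v → ∣ v ∣ ℕ.≤ slack b) (sym diff)
        (ℕ.≤-trans (abs-- y′ y y′≤ y≤) (2size≤slack b)))
        where
        a′≡a : a′ ≡ a
        a′≡a = i-j≡0⇒i≡j a′ a (tiny⇒0 j₁ ¬s slope-diff
                 (ℕ.≤-trans (abs-- a′ a a′≤ a≤) (ℕ.≤-trans (4size≤slack b) (slack≤next b))))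
        cancel : ∀ y y′ w → (y′ + w) - (y + w) ≡ y′ - y
        cancel = solve-∀
        diff : (y′ + + q * a′) - (y + + q * a) ≡ y′ - y
        diff = trans (cong (λ v → (y′ + + q * v) - (y + + q * a)) a′≡a) (cancel y y′ (+ q * a))

    -- Rays are started at N + b, so that x + d stays outward of N together with x; closer to the
    -- origin the images are bounded outright.
    congr-close : ∀ f i x j d → ∣ d ∣ ℕ.≤ b → R (i , x) (j , x + d) → Near (g f (i , x)) (g f (j , x + d))
    congr-close f i x j d d≤ r with position (N ℕ.+ b) D {{ℕ.>-nonZero D>0}} x
    ... | inj₁ x≤ = near (congr f r) (ℕ.≤-trans
      (abs-- (proj₂ (g f (j , x + d))) (proj₂ (g f (i , x))) (size≤ f j (x + d) x+d≤) (size≤ f i x x≤′))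
        (2size≤slack b))
      where
      x≤D : ∣ x ∣ ℕ.≤ N ℕ.+ b ℕ.+ D
      x≤D = ℕ.≤-trans x≤ (ℕ.m≤m+n _ D)
      x≤′ : ∣ x ∣ ℕ.≤ radius′ b
      x≤′ = ℕ.≤-trans x≤D (ℕ.≤-trans (ℕ.m≤m+n _ (b ℕ.+ D)) (b+D+D≤radius′ b))
      x+d≤ : ∣ x + d ∣ ℕ.≤ radius′ b
      x+d≤ = ℕ.≤-trans (abs-+ x d x≤D (ℕ.≤-trans d≤ (ℕ.m≤m+n b D))) (b+D+D≤radius′ b)
    ... | inj₂ (inj₁ (c , q , c<D , refl)) = congr-far f i j d (+ (N ℕ.+ b ℕ.+ c)) (+ D) q ∣-refl
            (inj₁ (≤-trans (+≤+ (ℕ.m≤m+n N b)) start , +≤+ z≤n)) (inj₁ (lower {d = d} start d≤ , +≤+ z≤n))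
            (ℕ.+-monoʳ-≤ (N ℕ.+ b) (ℕ.<⇒≤ c<D)) ℕ.≤-refl d≤ r
      where
      start : + (N ℕ.+ b) ≤ + (N ℕ.+ b ℕ.+ c)
      start = +≤+ (ℕ.m≤m+n (N ℕ.+ b) c)
    ... | inj₂ (inj₂ (c , q , c<D , refl)) = congr-far f i j d (- + (N ℕ.+ b ℕ.+ c)) (- + D) q (∣m⇒∣-m ∣-refl)
            (inj₂ (≤-trans start (neg-mono-≤ (+≤+ (ℕ.m≤m+n N b))) , neg-≤-pos {D} {0}))
              (inj₂ (upper {d = d} start d≤ , neg-≤-pos {D} {0}))
            (ℕ.≤-trans (ℕ.≤-reflexive (∣-i∣≡∣i∣ (+ (N ℕ.+ b ℕ.+ c)))) (ℕ.+-monoʳ-≤ (N ℕ.+ b) (ℕ.<⇒≤ c<D)))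
            (ℕ.≤-reflexive (∣-i∣≡∣i∣ (+ D))) d≤ r
      where
      start : - + (N ℕ.+ b ℕ.+ c) ≤ - + (N ℕ.+ b)
      start = neg-mono-≤ (+≤+ (ℕ.m≤m+n (N ℕ.+ b) c))

    congr-periods : ∀ f i x → Small i → ∀ q → Near (g f (i , x)) (g f (i , x + + q * + m i))
    congr-periods f i x s zero    = subst (λ v → Near (g f (i , x)) (g f (i , v))) (sym (+-identityʳ x))
      (rel-refl , inj₂ self)
      where
      self : ∣ proj₂ (g f (i , x)) - proj₂ (g f (i , x)) ∣ ℕ.≤ b
      self = subst (λ v → ∣ v ∣ ℕ.≤ b) (sym (+-inverseʳ (proj₂ (g f (i , x))))) z≤n
    congr-periods f i x s (suc q) = near-trans (congr-periods f i x s q)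
      (subst (λ v → Near (g f (i , z)) (g f (i , v))) (next-multiple x (+ q) (+ m i))
        (congr-close f i z i (+ m i) (proj₂ s) (∣⇒R (divides (+ 1) (one z (+ m i))))))
      where
      z = x + + q * + m i
      next-multiple : ∀ x q m → x + q * m + m ≡ x + (+ 1 + q) * m
      next-multiple = solve-∀
      one : ∀ z m → (z + m) - z ≡ + 1 * m
      one = solve-∀

    congr-periodsᶻ : ∀ f i x → Small i → ∀ q → Near (g f (i , x)) (g f (i , x + q * + m i))
    congr-periodsᶻ f i x s (+ q)    = congr-periods f i x s q
    congr-periodsᶻ f i x s -[1+ q ] = near-sym
      (subst (λ v → Near (g f (i , z)) (g f (i , v))) (back x (+ suc q) (+ m i))
        (congr-periods f i z s (suc q)))
      where
      z = x + -[1+ q ] * + m i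
      back : ∀ x q m → x + (- q) * m + q * m ≡ x
      back = solve-∀

    -- For a small period the pair is split at (j , x + e), with e the remainder of y - x: a close
    -- pair, then a multiple of the period, walked in steps of length at most b.
    near-congr : ∀ f {p q} → Near p q → Near (g f p) (g f q)
    near-congr f {i , x} {j , y} (r , inj₂ c) = subst (λ v → Near (g f (i , x)) (g f (j , v))) (back x y)
      (congr-close f i x j (y - x) c (subst (λ v → R (i , x) (j , v)) (sym (back x y)) r))
      where
      back : ∀ x y → x + (y - x) ≡ y
      back = solve-∀
    near-congr f {i , x} {j , y} (r , inj₁ s) = near-trans
      (congr-close f i x j (+ e) (ℕ.≤-trans (ℕ.<⇒≤ (n%ℕd<d (y - x) (m i))) (proj₂ s))
        (rel-trans r (rel-sym step)))
      (subst (λ v → Near (g f (j , x + + e)) (g f (j , v))) (trans (cong (λ v → x + + e + q * + v) mj) z≡)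
        (congr-periodsᶻ f j (x + + e) (small-sym (rel-sym r) s) q))
      where
      instance _ = ℕ.>-nonZero (proj₁ s)
      e = (y - x) %ℕ m i
      q = (y - x) /ℕ m i
      mj : m j ≡ m i
      mj = m≡ (rel-sym r)
      regroup : ∀ x e w y → (x + e + w) ≡ x + (e + w)
      regroup = solve-∀
      back : ∀ x y → x + (y - x) ≡ y
      back = solve-∀
      z≡ : x + + e + q * + m i ≡ y
      z≡ = trans (regroup x (+ e) (q * + m i) y)
        (trans (cong (λ v → x + v) (sym (a≡a%ℕn+[a/ℕn]*n (y - x) (m i)))) (back x y))
      cancel : ∀ z w → (z + w) - z ≡ w
      cancel = solve-∀
      step : R (j , x + + e) (j , y)
      step = ∣⇒R (divides q (trans (cong (_- (x + + e)) (sym z≡))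
        (trans (cancel (x + + e) (q * + m i)) (cong (λ v → q * + v) (sym mj)))))

    near-sol : Sol Near
    near-sol = record
      { rel-refl  = λ {(i , x)} → rel-refl , inj₂ (subst (λ v → ∣ v ∣ ℕ.≤ b) (sym (+-inverseʳ x)) z≤n)
      ; rel-sym   = near-sym
      ; rel-trans = near-trans
      ; shift     = near-shift
      ; kern      = near-kern
      ; congr     = near-congr
      ; respF     = λ (r , _) → respF r
      }

    near-bounded : BoundedBy b Near
    near-bounded i with m-gap i
    ... | inj₂ (inj₁ s) = m i , proj₂ s , λ {x} {y} → (λ (r , _) → R⇒∣ r) , λ d → ∣⇒R d , inj₁ s
    ... | inj₁ z = 0 , z≤n , λ {x} {y} → (λ (r , _) → subst (λ v → + v ∣ y - x) z (R⇒∣ r)) ,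
                   λ d → near-kern (subst (+ k i ∣_) (sym (0∣⇒≡0 d)) (divides (+ 0) refl))
    -- A period above the gap disappears: its nonzero multiples are longer than b.
    ... | inj₂ (inj₂ l) = 0 , z≤n , λ {x} {y} →
                   (λ { (r , inj₁ s) → ⊥-elim (ℕ.<⇒≱ l (ℕ.≤-trans (proj₂ s) (ℕ.m≤m+n b (slack b))))
                      ; (r , inj₂ c) → ∣-reflexive (sym (tiny⇒0 i (inj₂ l) (R⇒∣ r)
                        (ℕ.≤-trans c (ℕ.m≤m+n b (slack b))))) }) ,
                   λ d → near-kern (subst (+ k i ∣_) (sym (0∣⇒≡0 d)) (divides (+ 0) refl))

    -- The rigid case: slopes and the transport of periods.

    module Rigid (rigid : ∀ {p q} → Near p q → Ker p q) where

      Large : Fin K → Set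
      Large i = next b ℕ.< m i

      large>0 : ∀ {i} → Large i → 0 ℕ.< m i
      large>0 l = ℕ.≤-<-trans z≤n l

      k-large : ∀ {i} → Large i → k i ≡ 0
      k-large {i} l = +-injective (∣∧∣∣<⇒≡0 (m∣k i) (ℕ.≤-<-trans (ℕ.≤-trans (k≤b i) (ℕ.m≤m+n b (slack b))) l))

      large-transfer : ∀ {i x j y} → R (i , x) (j , y) → Large i → Large j
      large-transfer r = subst (next b ℕ.<_) (m≡ r)

      ker-refl : ∀ {p} → Ker p p
      ker-refl {i , x} = refl , divides (+ 0) (+-inverseʳ x)

      ker⇒R : ∀ {p q} → Ker p q → R p q
      ker⇒R (refl , d) = kern d

      base : ℕ → ℤ
      base r = + (N ℕ.+ r)

      slope : Fin n → Fin K → ℕ → ℤ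
      slope f i r = rise f i (base r) (+ D)

      target : Fin n → Fin K → ℕ → Fin K
      target f i r = proj₁ (g f (i , base r))

      value₀ : Fin n → Fin K → ℕ → ℤ
      value₀ f i r = proj₂ (g f (i , base r))

      forward : ∀ f i r t → g f (i , base r + + t * + D) ≡ (target f i r , value₀ f i r + + t * slope f i r)
      forward f i r = along f i (base r) (+ D) ∣-refl (inj₁ (+≤+ (ℕ.m≤m+n N r) , +≤+ z≤n))

      base≤ : ∀ {r} → r ℕ.< D → ∣ base r ∣ ℕ.≤ N ℕ.+ D
      base≤ r<D = ℕ.+-monoʳ-≤ N (ℕ.<⇒≤ r<D)

      multiple≤radius : ∀ {r} q → r ℕ.< D → ∣ q ∣ ℕ.≤ suc span → ∣ base r + q * + D ∣ ℕ.≤ radius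
      multiple≤radius {r} q r<D q≤ = ℕ.≤-trans
        (abs-+ (base r) (q * + D) (base≤ r<D)
          (ℕ.≤-trans (ℕ.≤-reflexive (∣i*j∣≡∣i∣*∣j∣ q (+ D))) (ℕ.*-monoˡ-≤ D q≤)))
        (ℕ.≤-reflexive (ℕ.+-assoc N D (suc span ℕ.* D)))

      slope≤ : ∀ {M} f i r → radius ℕ.≤ M → r ℕ.< D → ∣ slope f i r ∣ ℕ.≤ maxSize M ℕ.+ maxSize M
      slope≤ f i r M≥ r<D = rise≤ f i (base r) (+ D) (bound (+ 0) (+-identityʳ (base r)) z≤n)
                              (bound (+ 1) (cong (λ v → base r + v) (*-identityˡ (+ D))) (s≤s z≤n))
        where
        bound : ∀ q {x} → base r + q * + D ≡ x → ∣ q ∣ ℕ.≤ suc span → ∣ x ∣ ℕ.≤ _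
        bound q eq q≤ = ℕ.≤-trans (subst (λ v → ∣ v ∣ ℕ.≤ radius) eq (multiple≤radius q r<D q≤)) M≥

      radius≤radius′ : radius ℕ.≤ radius′ b
      radius≤radius′ = ℕ.m≤n+m radius (b ℕ.+ b)

      radius≤radius : radius ℕ.≤ radius
      radius≤radius = ℕ.≤-refl

      -- Going back s steps is, up to R, going forward: adding s D periods leads to a point of the
      -- right ray, where the map is known. Its value there is compared with the image of a multiple
      -- of the period.
      exact-R : ∀ f {i} r → Large i → ∀ q → R (g f (i , base r + q * + D))
        (target f i r , value₀ f i r + q * slope f i r)
      exact-R f {i} r l (+ t) = subst (R (g f (i , base r + + t * + D))) (forward f i r t) rel-refl
      exact-R f {i} r l -[1+ t ] = shifted (m i) refl (large>0 l)
        where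
        s = suc t
        y = value₀ f i r
        a = slope f i r
        shifted : ∀ v → m i ≡ v → 0 ℕ.< v → R (g f (i , base r + - + s * + D)) (target f i r , y + - + s * a)
        shifted (suc v) eq _ = rel-trans (congr f back)
          (subst (λ p → R p (target f i r , y + - + s * a)) (sym (forward f i r u)) (rel-sym period-image))
          where
          u = v ℕ.* s
          u≡ : + u ≡ + v * + s
          u≡ = pos-* v s
          back : R (i , base r + - + s * + D) (i , base r + + u * + D)
          back = ∣⇒R (divides (+ s * + D) (trans (cong (λ w → (base r + w * + D) - (base r + - + s * + D)) u≡)
                   (trans (diff (base r) (+ v) (+ s) (+ D)) (cong (λ w → + s * + D * + w) (sym eq)))))
            where
            diff : ∀ x v s d → (x + v * s * d) - (x + (- s) * d) ≡ s * d * (+ 1 + v)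
            diff = solve-∀
          full = suc v ℕ.* s
          start : R (i , base r) (i , base r + + full * + D)
          start = ∣⇒R (divides (+ s * + D) (trans (cong (λ w → (base r + w * + D) - base r) (pos-* (suc v) s))
                    (trans (diff (base r) (+ suc v) (+ s) (+ D)) (cong (λ w → + s * + D * + w) (sym eq)))))
            where
            diff : ∀ x v s d → (x + v * s * d) - x ≡ s * d * v
            diff = solve-∀
          period-image : R (target f i r , y + - + s * a) (target f i r , y + + u * a)
          period-image = move (y + - + s * a) (y + + u * a)
            (trans (cong (λ w → (y + w * a) - (y + - + s * a)) u≡) (trans (diff y (+ v) (+ s) a)
              (cong (λ w → (y + w * a) - y) (sym (pos-* (suc v) s)))))
            (subst (R (g f (i , base r))) (forward f i r full) (congr f start))
            where
            diff : ∀ y v s a → (y + v * s * a) - (y + (- s) * a) ≡ (y + (+ 1 + v) * s * a) - y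
            diff = solve-∀

      -- For boundedly many steps both sides are small, so being related makes them near, and
      -- rigidity identifies them.
      exact-bounded : ∀ f {i} r → Large i → r ℕ.< D → ∀ q → ∣ q ∣ ℕ.≤ suc span →
                      Ker (g f (i , base r + q * + D)) (target f i r , value₀ f i r + q * slope f i r)
      exact-bounded f {i} r l r<D q q≤ = rigid (near (exact-R f r l q) (ℕ.≤-trans
        (abs-- (y₀ + q * a) y (abs-+ y₀ (q * a) y₀≤ qa≤) y≤)
          (ℕ.≤-trans (ℕ.≤-reflexive (regroup imageBound span)) (size≤slack b))))
        where
        y₀ = value₀ f i r
        a = slope f i r
        y = proj₂ (g f (i , base r + q * + D))
        y≤ : ∣ y ∣ ℕ.≤ imageBound
        y≤ = size≤ f i (base r + q * + D) (ℕ.≤-trans (multiple≤radius q r<D q≤) radius≤radius′)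
        y₀≤ : ∣ y₀ ∣ ℕ.≤ imageBound
        y₀≤ = size≤ f i (base r) (ℕ.≤-trans
          (subst (λ v → ∣ v ∣ ℕ.≤ radius) (+-identityʳ (base r)) (multiple≤radius (+ 0) r<D z≤n))
            radius≤radius′)
        qa≤ : ∣ q * a ∣ ℕ.≤ suc span ℕ.* (imageBound ℕ.+ imageBound)
        qa≤ = ℕ.≤-trans (ℕ.≤-reflexive (∣i*j∣≡∣i∣*∣j∣ q a)) (ℕ.*-mono-≤ q≤ (slope≤ f i r radius≤radius′ r<D))
        regroup : ∀ c s → c ℕ.+ (1 ℕ.+ s) ℕ.* (c ℕ.+ c) ℕ.+ c ≡ (2 ℕ.+ s) ℕ.* (c ℕ.+ c)
        regroup = ℕ-Solver.solve-∀

      -- On orbits with a large period the maps are affine along residue classes on all of ℤ.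
      exact : ∀ f {i} r → Large i → r ℕ.< D → ∀ q →
              Ker (g f (i , base r + q * + D)) (target f i r , value₀ f i r + q * slope f i r)
      exact f {i} r l r<D (+ t) = subst (Ker (g f (i , base r + + t * + D))) (forward f i r t)
        (ker-refl {g f (i , base r + + t * + D)})
      exact f {i} r l r<D -[1+ t ] with suc t ℕ.≤? span
      ... | yes t≤ = exact-bounded f r l r<D -[1+ t ] (ℕ.≤-trans t≤ (ℕ.n≤1+n span))
      -- The left ray is affine too and agrees with the extrapolated right ray after `span` and
      -- `span + 1` steps, hence from there on.
      ... | no t≰ = subst (λ v → Ker (g f (i , base r + - + v * + D)) (target f i r , y₀ + - + v * a))
        (ℕ.m+[n∸m]≡n (ℕ.<⇒≤ (ℕ.≰⇒> t≰)))
                      (subst (λ p → Ker p (target f i r , y₀ + - + (span ℕ.+ s′) * a))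
                        (sym (trans (cong (λ v → g f (i , v)) (position-eq s′)) (onRay s′)))
                        (combine′ (proj₁ at-span) (proj₂ at-span) (proj₂ at-next)))
        where
        s′ = suc t ℕ.∸ span
        y₀ = value₀ f i r
        a = slope f i r
        j = target f i r
        x₁ = base r + - + span * + D
        x₁≤ : x₁ ≤ - + N
        x₁≤ = ≤-trans (+-mono-≤ base≤′ span≥) (≤-reflexive (cancel (+ N) (+ D)))
          where
          base≤′ : base r ≤ + N + + D
          base≤′ = ≤-trans (+≤+ (ℕ.+-monoʳ-≤ N (ℕ.<⇒≤ r<D))) (≤-reflexive (pos-+ N D))
          cancel : ∀ N D → (N + D) + - (D + (N + N)) ≡ - N
          cancel = solve-∀
          span≥ : - + span * + D ≤ - (+ D + (+ N + + N))
          span≥ = ≤-trans (≤-reflexive (trans (sym (neg-distribˡ-* (+ span) (+ D)))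
            (cong -_ (sym (pos-* span D)))))
                    (neg-mono-≤ (≤-trans (≤-reflexive (trans (cong (λ v → + D + v) (sym (pos-+ N N)))
                      (sym (pos-+ D (N ℕ.+ N)))))
                      (+≤+ (ℕ.+-monoʳ-≤ D (ℕ.m≤m*n (N ℕ.+ N) D)))))
        j₁ = proj₁ (g f (i , x₁))
        y₁ = proj₂ (g f (i , x₁))
        a₁ = rise f i x₁ (- + D)
        onRay : ∀ t → g f (i , x₁ + + t * - + D) ≡ (j₁ , y₁ + + t * a₁)
        onRay = along f i x₁ (- + D) (∣m⇒∣-m ∣-refl) (inj₂ (x₁≤ , neg-≤-pos {D} {0}))
        position-eq : ∀ t → base r + - + (span ℕ.+ t) * + D ≡ x₁ + + t * - + D
        position-eq t = trans (cong (λ v → base r + - v * + D) (pos-+ span t))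
          (shuffle (base r) (+ span) (+ t) (+ D))
          where
          shuffle : ∀ x s t d → x + - (s + t) * d ≡ x + (- s) * d + t * - d
          shuffle = solve-∀
        at-span : j₁ ≡ j × + k j₁ ∣ (y₀ + - + span * a) - y₁
        at-span = exact-bounded f r l r<D (- + span) (ℕ.n≤1+n span)
        at-next : j₁ ≡ j × + k j₁ ∣ (y₀ + - + suc span * a) - (y₁ + + 1 * a₁)
        at-next = subst (λ p → Ker p (j , y₀ + - + suc span * a)) (trans (cong (λ v → g f (i , v))
                    (trans (cong (λ v → base r + - + v * + D) (ℕ.+-comm 1 span)) (position-eq 1))) (onRay 1))
                    (exact-bounded f r l r<D (- + suc span) ℕ.≤-refl)
        combine′ : j₁ ≡ j → + k j₁ ∣ (y₀ + - + span * a) - y₁ → + k j₁ ∣ (y₀ + - + suc span * a) -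
          (y₁ + + 1 * a₁) →
                   Ker (j₁ , y₁ + + s′ * a₁) (j , y₀ + - + (span ℕ.+ s′) * a)
        combine′ p d₀ d₁ = p , subst (+ k j₁ ∣_)
          (trans (mix y₀ y₁ (+ span) (+ s′) a a₁)
            (cong (λ v → (y₀ + - v * a) - (y₁ + + s′ * a₁)) (sym (pos-+ span s′))))
          (∣m∣n⇒∣m+n d₀ (∣n⇒∣m*n (+ s′) (∣m∣n⇒∣m-n d₁ d₀)))
          where
          mix : ∀ y₀ y₁ s t a a₁ → ((y₀ + (- s) * a) - y₁) + t *
            (((y₀ + (- (+ 1 + s)) * a) - (y₁ + + 1 * a₁)) - ((y₀ + (- s) * a) - y₁))
                                   ≡ (y₀ + (- (s + t)) * a) - (y₁ + t * a₁)
          mix = solve-∀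

      -- Only nonzero slopes into infinite orbits constrain the weights; for finite targets the
      -- factor `periodScale k` of the final periods is responsible.
      Edge : Fin K → Fin K → ℤ → Set
      Edge i j a = ∃ λ f → ∃ λ r → r ℕ.< D × target f i r ≡ j × slope f i r ≡ a × a ≢ + 0 × k j ≡ 0

      edge-bound : ∀ {i j a} → Edge i j a → ∣ a ∣ ℕ.≤ slopeBound × a ≢ + 0
      edge-bound {i} (f , r , r<D , refl , refl , a≢0 , _) = ℕ.≤-trans (slope≤ f i r radius≤radius r<D)
        (ℕ.n≤1+n _) , a≢0

      edge-period : ∀ {i j a} → Edge i j a → + m j ∣ a * + m i
      edge-period {i} (f , r , r<D , refl , refl , _) =
        ∣-respʳ (cancel (value₀ f i r) (slope f i r) (+ m i))
          (R⇒∣ (subst (R (g f (i , base r))) (forward f i r (m i))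
          (congr f (∣⇒R (divides (+ D) (diff (base r) (+ m i) (+ D)))))))
        where
        cancel : ∀ y a m → (y + m * a) - y ≡ a * m
        cancel = solve-∀
        diff : ∀ x m d → (x + m * d) - x ≡ d * m
        diff = solve-∀

      -- `m j` divides the nonzero a (m i), so it is not 0; a small positive period on the infinite
      -- orbit j would contradict rigidity.
      edge-large : ∀ {i j a} → Large i → Edge i j a → Large j
      edge-large {i} {j} {a} l e@(_ , _ , _ , _ , _ , a≢0 , kj≡0) with m-gap j
      ... | inj₂ (inj₂ lj) = lj
      ... | inj₁ mj≡0 = ⊥-elim (case i*j≡0⇒i≡0∨j≡0 a (0∣⇒≡0 (subst (λ v → + v ∣ a * + m i) mj≡0 (edge-period e))) of λ
            { (inj₁ a≡0)  → a≢0 a≡0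
            ; (inj₂ mi≡0) → ℕ.<⇒≢ (large>0 l) (sym (+-injective mi≡0)) })
      ... | inj₂ (inj₁ s) = ⊥-elim (ℕ.<⇒≢ (proj₁ s) (sym (+-injective (trans (sym (+-identityʳ (+ m j)))
            (0∣⇒≡0 (subst (λ v → + v ∣ + m j - + 0) kj≡0 (proj₂ (rigid {j , + 0} {j , + m j}
              (∣⇒R (divides (+ 1) (trans (+-identityʳ (+ m j)) (sym (*-identityˡ (+ m j))))) , inj₁ s)))))))))

      residue : ∀ z → ∃ λ r → ∃ λ q → r ℕ.< D × z ≡ base r + q * + D
      residue z = r , q , n%ℕd<d (z - + N) D , (begin
        z                          ≡⟨ back z (+ N) ⟨
        + N + (z - + N)            ≡⟨ cong (λ v → + N + v) (a≡a%ℕn+[a/ℕn]*n (z - + N) D) ⟩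
        + N + (+ r + q * + D)      ≡⟨ +-assoc (+ N) (+ r) (q * + D) ⟨
        + N + + r + q * + D        ≡⟨ cong (_+ q * + D) (pos-+ N r) ⟨
        base r + q * + D           ∎)
        where
        open ≡-Reasoning
        r = (z - + N) %ℕ D
        q = (z - + N) /ℕ D
        back : ∀ z N → N + (z - N) ≡ z
        back = solve-∀

      base-diff : ∀ {r r′} → r ℕ.< D → r′ ℕ.< D → ∣ base r - base r′ ∣ ℕ.≤ D
      base-diff {r} {r′} p q = subst (λ v → ∣ v ∣ ℕ.≤ D)
        (trans (sym (m-n≡m⊖n r r′)) (trans (cancel (+ N) (+ r) (+ r′))
          (sym (cong₂ _-_ (pos-+ N r) (pos-+ N r′)))))
        (ℕ.≤-trans (∣m⊝n∣≤m⊔n r r′) (ℕ.⊔-lub (ℕ.<⇒≤ p) (ℕ.<⇒≤ q)))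
        where
        cancel : ∀ N r r′ → r - r′ ≡ (N + r) - (N + r′)
        cancel = solve-∀

      -- Along an edge of slope a, distances e between related points become a e / D up to a bounded error.
      edge-step : ∀ {i i₁ a j e} → Large i → Edge i i₁ a → R (i , + 0) (j , e) →
                  ∃ λ j₁ → ∃ λ e₁ → ∃ λ c → R (i₁ , + 0) (j₁ , e₁) × + D * e₁ ≡ a * e + c × ∣ c ∣ ℕ.≤ driftStep
      edge-step {i} {i₁} {a} {j} {e} l ed@(f , r , r<D , refl , refl , _) rel with residue (base r + e)
      ... | r′ , q , r′<D , z≡ = j₁ , e₁ , c , related , D*e₁ , c≤
        where
        lj = large-transfer rel l
        j₁ = target f j r′
        y = value₀ f i r
        y′ = value₀ f j r′
        a′ = slope f j r′
        e₁ = (y′ + q * a) - y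
        c = + D * (y′ - y) + a * (base r - base r′)
        image : ∀ t → R (i₁ , y + + t * a) (j₁ , y′ + (q + + t) * a′)
        image t = rel-trans (subst (λ p → R p (g f (j , base r + + t * + D + e))) (forward f i r t)
                      (congr f (move (base r + + t * + D) (base r + + t * + D + e)
                        (diff (base r + + t * + D) e) rel)))
                    (subst (λ v → R (g f (j , v)) (j₁ , y′ + (q + + t) * a′)) shifted
                      (ker⇒R (exact f r′ lj r′<D (q + + t))))
          where
          diff : ∀ x e → (x + e) - x ≡ e - + 0
          diff = solve-∀
          distr : ∀ x q t d → x + (q + t) * d ≡ x + q * d + t * d
          distr = solve-∀
          swap : ∀ x e w → x + e + w ≡ x + w + e
          swap = solve-∀
          shifted : base r′ + (q + + t) * + D ≡ base r + + t * + D + e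
          shifted = trans (distr (base r′) q (+ t) (+ D))
            (trans (cong (_+ + t * + D) (sym z≡)) (swap (base r) e (+ t * + D)))
        slope-diff : + m j₁ ∣ a′ - a
        slope-diff = ∣-respʳ (cancel y′ q a a′)
          (R⇒∣ (rel-trans (rel-sym (move (y + + 1 * a) (y′ + (q + + 0) * a′ + a) (shifted y y′ q a a′)
            (image 0))) (image 1)))
          where
          cancel : ∀ y q a a′ → (y + (q + + 1) * a′) - (y + (q + + 0) * a′ + a) ≡ a′ - a
          cancel = solve-∀
          shifted : ∀ y y′ q a a′ → (y′ + (q + + 0) * a′ + a) - (y + + 1 * a) ≡ (y′ + (q + + 0) * a′) -
            (y + + 0 * a)
          shifted = solve-∀
        a′≡a : a′ ≡ a
        a′≡a = i-j≡0⇒i≡j a′ a (tiny⇒0 j₁ (inj₂ (large-transfer (image 0) (edge-large l ed))) slope-diff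
                 (ℕ.≤-trans (abs-- a′ a (slope≤ f j r′ radius≤radius′ r′<D) (slope≤ f i r radius≤radius′ r<D))
                            (ℕ.≤-trans (4size≤slack b) (slack≤next b))))
        related : R (i₁ , + 0) (j₁ , e₁)
        related = move (+ 0) e₁ (trans (diff y y′ (q * a) a) (cong (λ v → (y′ + v) - (y + + 0 * a)) same))
          (image 0)
          where
          diff : ∀ y y′ w a → ((y′ + w) - y) - + 0 ≡ (y′ + w) - (y + + 0 * a)
          diff = solve-∀
          same : q * a ≡ (q + + 0) * a′
          same = cong₂ _*_ (sym (+-identityʳ q)) (sym a′≡a)
        D*e₁ : + D * e₁ ≡ a * e + c
        D*e₁ = trans (expand (+ D) y y′ q a)
          (trans (cong (λ v → + D * (y′ - y) + a * v) qD≡) (regroup (+ D * (y′ - y)) a e (base r) (base r′)))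
          where
          expand : ∀ D y y′ q a → D * ((y′ + q * a) - y) ≡ D * (y′ - y) + a * (q * D)
          expand = solve-∀
          regroup : ∀ u a e x x′ → u + a * ((x + e) - x′) ≡ a * e + (u + a * (x - x′))
          regroup = solve-∀
          cancel : ∀ x w → w ≡ (x + w) - x
          cancel = solve-∀
          qD≡ : q * + D ≡ (base r + e) - base r′
          qD≡ = trans (cancel (base r′) (q * + D)) (cong (_- base r′) (sym z≡))
        c≤ : ∣ c ∣ ℕ.≤ driftStep
        c≤ = abs-+ (+ D * (y′ - y)) (a * (base r - base r′))
          (ℕ.≤-trans (ℕ.≤-reflexive (∣i*j∣≡∣i∣*∣j∣ (+ D) (y′ - y)))
            (ℕ.*-monoʳ-≤ D (abs-- y′ y (value≤ j r′ r′<D) (value≤ i r r<D))))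
          (ℕ.≤-trans (ℕ.≤-reflexive (∣i*j∣≡∣i∣*∣j∣ a (base r - base r′)))
            (ℕ.*-mono-≤ (proj₁ (edge-bound ed)) (base-diff r<D r′<D)))
          where
          value≤ : ∀ i r → r ℕ.< D → ∣ value₀ f i r ∣ ℕ.≤ maxSize radius
          value≤ i r r<D = size≤ f i (base r)
            (ℕ.≤-trans (base≤ r<D) (ℕ.+-monoʳ-≤ N (ℕ.m≤m+n D (suc span ℕ.* D))))

      D^ : ℕ → ℤ
      D^ s = + (D ℕ.^ s)

      D^-suc : ∀ s → D^ (suc s) ≡ + D * D^ s
      D^-suc s = pos-* D (D ℕ.^ s)

      drift-step : ∀ s → drift s ℕ.≤ drift (suc s)
      drift-step s = ℕ.m≤m+n (drift s) _

      drift-mono : ∀ {s t} → s ℕ.≤′ t → drift s ℕ.≤ drift t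
      drift-mono ℕ.≤′-refl         = ℕ.≤-refl
      drift-mono (ℕ.≤′-step {t} p) = ℕ.≤-trans (drift-mono p) (drift-step t)

      -- S / D^s is the image of a period under the slopes of a path of length s ending in i;
      -- it need not be an integer, but all its multiples are distances up to a bounded error.
      Carried : ℕ → Fin K → ℤ → Set
      Carried s i S = + m i ∣ S × ((y : ℕ) → ∃ λ j → ∃ λ e → ∃ λ c →
        R (i , + 0) (j , e) × D^ s * e ≡ S * + y + c × ∣ c ∣ ℕ.≤ drift s)

      carried-start : ∀ i → Carried 0 i (+ m i)
      carried-start i = ∣-refl , λ y → i , + m i * + y , + 0 , ∣⇒R (divides (+ y) (swap (+ m i) (+ y))) ,
        trivial (+ m i * + y) , z≤n
        where
        swap : ∀ m y → m * y - + 0 ≡ y * m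
        swap = solve-∀
        trivial : ∀ w → + 1 * w ≡ w + + 0
        trivial = solve-∀

      carried-step : ∀ {s i j a S} → Large i → Edge i j a → Carried s i S → Carried (suc s) j (a * S)
      carried-step {s} {i} {j} {a} {S} l e (divides w S≡ , dist) = d , λ y → distances y (dist y)
        where
        d : + m j ∣ a * S
        d = ∣-respʳ (trans (swap w a (+ m i)) (cong (a *_) (sym S≡))) (∣n⇒∣m*n w (edge-period e))
          where
          swap : ∀ w a m → w * (a * m) ≡ a * (w * m)
          swap = solve-∀
        distances : ∀ y → (∃ λ j₁ → ∃ λ e₁ → ∃ λ c → R (i , + 0) (j₁ , e₁) × D^ s * e₁ ≡ S * + y + c ×
          ∣ c ∣ ℕ.≤ drift s) →
                    ∃ λ j₁ → ∃ λ e₁ → ∃ λ c → R (j , + 0) (j₁ , e₁) × D^ (suc s) * e₁ ≡ a * S * + y + c ×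
                      ∣ c ∣ ℕ.≤ drift (suc s)
        distances y (j₁ , e₁ , c , rel , eq , c≤) with edge-step l e rel
        ... | j₂ , e₂ , c₂ , rel₂ , eq₂ , c₂≤ = j₂ , e₂ , a * c + D^ s * c₂ , rel₂ , (begin
          D^ (suc s) * e₂                       ≡⟨ cong (_* e₂) (D^-suc s) ⟩
          + D * D^ s * e₂                       ≡⟨ swap (+ D) (D^ s) e₂ ⟩
          D^ s * (+ D * e₂)                     ≡⟨ cong (D^ s *_) eq₂ ⟩
          D^ s * (a * e₁ + c₂)                  ≡⟨ expand (D^ s) a e₁ c₂ ⟩
          a * (D^ s * e₁) + D^ s * c₂           ≡⟨ cong (λ v → a * v + D^ s * c₂) eq ⟩
          a * (S * + y + c) + D^ s * c₂         ≡⟨ regroup a S (+ y) c (D^ s * c₂) ⟩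
          a * S * + y + (a * c + D^ s * c₂)     ∎) ,
          ℕ.≤-trans (abs-+ (a * c) (D^ s * c₂)
            (ℕ.≤-trans (ℕ.≤-reflexive (∣i*j∣≡∣i∣*∣j∣ a c)) (ℕ.*-mono-≤ (proj₁ (edge-bound e)) c≤))
            (ℕ.≤-trans (ℕ.≤-reflexive (∣i*j∣≡∣i∣*∣j∣ (D^ s) c₂)) (ℕ.*-monoʳ-≤ (D ℕ.^ s) c₂≤)))
              (ℕ.m≤n+m _ (drift s))
          where
          open ≡-Reasoning
          swap : ∀ d p e → d * p * e ≡ p * (d * e)
          swap = solve-∀
          expand : ∀ p a e c → p * (a * e + c) ≡ a * (p * e) + p * c
          expand = solve-∀
          regroup : ∀ a S y c u → a * (S * y + c) + u ≡ a * S * y + (a * c + u)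
          regroup = solve-∀

      -- Two of K + 1 multiples lie on the same orbit, and then their difference is a genuine period.
      carried-integral : ∀ {s i S} → Large i → s ℕ.≤ pathLength → Carried s i S →
                         ∃ λ z → + (K !) * S ≡ D^ s * (z * + m i)
      carried-integral {s} {i} {S} l s≤ (m∣S , dist) with pigeonhole (ℕ.n<1+n K) (λ y → proj₁ (dist (toℕ y)))
      ... | u , v , u<v , same with dist (toℕ u) | dist (toℕ v)
      ...   | j , e , c , rel , eq , c≤ | j′ , e′ , c′ , rel′ , eq′ , c′≤ = conclude same
        where
        δ = toℕ v ℕ.∸ toℕ u
        δ>0 : 0 ℕ.< δ
        δ>0 = ℕ.m<n⇒0<n∸m u<v
        δ≤K : δ ℕ.≤ K
        δ≤K = ℕ.≤-trans (ℕ.m∸n≤m (toℕ v) (toℕ u)) (toℕ≤pred[n] v)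
        δ≡ : + toℕ v - + toℕ u ≡ + δ
        δ≡ = trans (m-n≡m⊖n (toℕ v) (toℕ u)) (⊖-≥ (ℕ.<⇒≤ u<v))
        conclude : j ≡ j′ → ∃ λ z → + (K !) * S ≡ D^ s * (z * + m i)
        conclude refl with ∣! δ>0 δ≤K | subst (λ w → + w ∣ e′ - e) (sym (m≡ rel))
          (R⇒∣ (rel-trans (rel-sym rel) rel′))
        ... | ℕ.divides w K!≡ | divides t ee = + w * t , (begin
          + (K !) * S                          ≡⟨ cong (λ x → + x * S) K!≡ ⟩
          + (w ℕ.* δ) * S                      ≡⟨ cong (_* S) (pos-* w δ) ⟩
          + w * + δ * S                        ≡⟨ swap (+ w) (+ δ) S ⟩
          + w * (S * + δ)                      ≡⟨ cong (+ w *_) Sδ ⟩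
          + w * (D^ s * (e′ - e))              ≡⟨ cong (λ x → + w * (D^ s * x)) ee ⟩
          + w * (D^ s * (t * + m i))           ≡⟨ regroup (+ w) (D^ s) t (+ m i) ⟩
          D^ s * (+ w * t * + m i)             ∎)
          where
          open ≡-Reasoning
          swap : ∀ w d S → w * d * S ≡ w * (S * d)
          swap = solve-∀
          regroup : ∀ w p t m → w * (p * (t * m)) ≡ p * (w * t * m)
          regroup = solve-∀
          expand : ∀ p e e′ → p * (e′ - e) ≡ p * e′ - p * e
          expand = solve-∀
          collect : ∀ S v u c′ c → (S * v + c′) - (S * u + c) ≡ S * (v - u) + (c′ - c)
          collect = solve-∀
          difference : D^ s * (e′ - e) ≡ S * + δ + (c′ - c)
          difference = trans (expand (D^ s) e e′)
            (trans (cong₂ _-_ eq′ eq) (trans (collect S (+ toℕ v) (+ toℕ u) c′ c)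
              (cong (λ x → S * x + (c′ - c)) δ≡)))
          -- The error is a difference of two multiples of the large period, and two drifts fit
          -- below the gap.
          c′-c≡0 : c′ - c ≡ + 0
          c′-c≡0 = tiny⇒0 i (inj₂ l)
            (∣m+n∣m⇒∣n (subst (+ m i ∣_) difference (∣n⇒∣m*n (D^ s) (divides t ee))) (∣m⇒∣m*n (+ δ) m∣S))
            (ℕ.≤-trans (abs-- c′ c (ℕ.≤-trans c′≤ drift≤) (ℕ.≤-trans c≤ drift≤))
              (ℕ.≤-trans (drift≤slack b) (slack≤next b)))
            where drift≤ = drift-mono (ℕ.≤⇒≤′ s≤)
          Sδ : S * + δ ≡ D^ s * (e′ - e)
          Sδ = sym (trans difference (trans (cong (λ x → S * + δ + x) c′-c≡0) (+-identityʳ (S * + δ))))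

      large? : ∀ i → Dec (Large i)
      large? i = next b ℕ.<? m i

      open Weights D slopeBound D>0 (s≤s z≤n) Edge edge-bound Large large? m large>0 edge-large public

      -- Here z (m i) is K! S / D^s; after each further edge `carried-integral` shows the new
      -- quotient to be an integer multiple of the period reached.
      transported : ∀ t s {i S z} → s ℕ.+ t ℕ.≤ pathLength → Large i → Carried s i S →
                    D^ s * (z * + m i) ≡ + (K !) * S → Transported t i z
      transported zero    s _ _ _ _ = tt
      transported (suc t) s {i} {S} {z} le l car eq =
        transported t s (ℕ.≤-trans (ℕ.+-monoʳ-≤ s (ℕ.n≤1+n t)) le) l car eq , λ j a e →
        let le′ = subst (ℕ._≤ pathLength) (ℕ.+-suc s t) le
            car′ = carried-step {s} {i} {j} {a} {S} l e car
            lj = edge-large l e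
            (z′ , eq′) = carried-integral lj (ℕ.≤-trans (ℕ.m≤m+n (suc s) t) le′) car′
        in z′ , cancelled j a z′ eq′ , transported t (suc s) le′ lj car′ (sym eq′)
        where
        instance
          D^-nonZero : NonZero (D^ s)
          D^-nonZero = ℕ.m^n≢0 D s
        swap : ∀ p d z m → p * (d * z * m) ≡ d * p * (z * m)
        swap = solve-∀
        swap′ : ∀ k a S → k * (a * S) ≡ a * (k * S)
        swap′ = solve-∀
        regroup : ∀ a p z m → a * (p * (z * m)) ≡ p * (a * z * m)
        regroup = solve-∀
        cancelled : ∀ j a z′ → + (K !) * (a * S) ≡ D^ (suc s) * (z′ * + m j) → + D * z′ * + m j ≡ a * z * + m i
        cancelled j a z′ eq′ = *-cancelˡ-≡ (D^ s) _ _ (begin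
          D^ s * (+ D * z′ * + m j)       ≡⟨ swap (D^ s) (+ D) z′ (+ m j) ⟩
          + D * D^ s * (z′ * + m j)       ≡⟨ cong (_* (z′ * + m j)) (D^-suc s) ⟨
          D^ (suc s) * (z′ * + m j)       ≡⟨ eq′ ⟨
          + (K !) * (a * S)               ≡⟨ swap′ (+ (K !)) a S ⟩
          a * (+ (K !) * S)               ≡⟨ cong (a *_) eq ⟨
          a * (D^ s * (z * + m i))        ≡⟨ regroup a (D^ s) z (+ m i) ⟩
          D^ s * (a * z * + m i)          ∎)
          where open ≡-Reasoning

      large-weights : ∃ Large → ¬ ¬ BoundedWeighting
      large-weights start c = weights (K !)
        (λ {i} l → transported pathLength 0 {z = + (K !)} ℕ.≤-refl l (carried-start i)
          (*-identityˡ (+ (K !) * + m i)))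
        (ℕ.1≤n! K) λ w → bounded-weights start w c

      -- The solution built from weights.

      module FromWeights (bw : BoundedWeighting) where
        open BoundedWeighting bw

        -- The factor D preserves the residue classes along which the maps are affine, and
        -- `periodScale k` keeps images in finite orbits fixed.
        period* : ∀ {i} → Dec (L′ i) → ℕ
        period* {i} (yes _) = D ℕ.* (periodScale k) ℕ.* w i
        period* {i} (no _)  = k i

        M : Fin K → ℕ
        M i = period* (L′? i)

        Star : Pt → Pt → Set
        Star (i , x) (j , y) = i ≡ j × + M i ∣ y - x

        M∣k : ∀ i → + M i ∣ + k i
        M∣k i with L′? i
        ... | no _  = ∣-refl
        ... | yes l = divides (+ 0) (cong +_ (k-large (L′⊆L l)))

        ker⇒star : ∀ p q → Ker p q → Star p q
        ker⇒star (i , _) _ (refl , d) = refl , ∣-trans (M∣k i) d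

        star-sym : ∀ p q → Star p q → Star q p
        star-sym (i , x) (j , y) (refl , d) = refl , ∣-respʳ (swap x y) (∣m⇒∣-m d)
          where
          swap : ∀ x y → - (y - x) ≡ x - y
          swap = solve-∀

        star-trans : ∀ p q s → Star p q → Star q s → Star p s
        star-trans (i , x) (_ , y) (_ , z) (refl , d) (refl , e) = refl , ∣-respʳ (telescope x y z)
          (∣m∣n⇒∣m+n d e)
          where
          telescope : ∀ x y z → (y - x) + (z - y) ≡ z - x
          telescope = solve-∀

        -- Either the slope is 0, or there is an edge and the weighting applies, or the target is
        -- finite and its characteristic divides `periodScale k`.
        slope-period : ∀ f {i} r → L′ i → r ℕ.< D → + M (target f i r) ∣ + (periodScale k) * + w i * slope f i r
        slope-period f {i} r l r<D with slope f i r ≟ᶻ + 0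
        ... | yes a≡0 = divides (+ 0) (trans (cong (+ (periodScale k) * + w i *_) a≡0)
          (*-zeroʳ (+ (periodScale k) * + w i)))
        ... | no a≢0 with k (target f i r) ℕ.≟ 0
        ...   | yes k≡0 = go (L′? (target f i r))
          where
          e : Edge i (target f i r) (slope f i r)
          e = f , r , r<D , refl , refl , a≢0 , k≡0
          swap : ∀ κ w a → κ * (a * w) ≡ κ * w * a
          swap = solve-∀
          swap′ : ∀ κ d w → κ * (d * w) ≡ d * κ * w
          swap′ = solve-∀
          go : (l? : Dec (L′ (target f i r))) → + period* l? ∣ + (periodScale k) * + w i * slope f i r
          go (no ¬l) = ⊥-elim (¬l (L′-closed l e))
          go (yes l′) = subst₂ _∣_
            (trans (swap′ (+ (periodScale k)) (+ D) (+ w (target f i r)))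
              (trans (cong (_* + w (target f i r)) (sym (pos-* D (periodScale k))))
                (sym (pos-* (D ℕ.* (periodScale k)) (w (target f i r))))))
            (swap (+ (periodScale k)) (+ w i) (slope f i r))
            (*-monoʳ-∣ (+ (periodScale k)) (proj₂ weighting l e))
        ...   | no k≢0 = ∣m⇒∣m*n {m = + (periodScale k) * + w i} (slope f i r)
          (∣m⇒∣m*n {m = + (periodScale k)} (+ w i)
            (∣-trans (M∣k (target f i r)) (∣ᵤ⇒∣ (∣-periodScale k (target f i r) k≢0))))

        star-congr : ∀ f p q → Star p q → Star (g f p) (g f q)
        star-congr f (i , x) (_ , y) (refl , d) = go (L′? i) d
          where
          go : (l? : Dec (L′ i)) → + period* l? ∣ y - x → Star (g f (i , x)) (g f (i , y))
          go (no _)  d = subst (Star (g f (i , x))) (g-periodic f i d)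
            (ker⇒star (g f (i , x)) (g f (i , x)) (ker-refl {g f (i , x)}))
          go (yes l) (divides z eq) with residue x
          ... | r , q , r<D , x≡ = star-trans (g f (i , x)) p′ (g f (i , y))
            (ker⇒star (g f (i , x)) p′ (at-multiple q x≡))
                (star-trans p′ p″ (g f (i , y)) middle
                  (star-sym (g f (i , y)) p″ (ker⇒star (g f (i , y)) p″ (at-multiple q′ y≡))))
            where
            at-multiple : ∀ q {x} → x ≡ base r + q * + D → Ker (g f (i , x))
              (target f i r , value₀ f i r + q * slope f i r)
            at-multiple q refl = exact f r (L′⊆L l) r<D q
            q′ = q + z * (+ (periodScale k) * + w i)
            cancel : ∀ x y → x + (y - x) ≡ y
            cancel = solve-∀
            regroup : ∀ b q D z κ w → b + q * D + z * (D * κ * w) ≡ b + (q + z * (κ * w)) * D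
            regroup = solve-∀
            y≡ : y ≡ base r + q′ * + D
            y≡ = begin
              y                                         ≡⟨ cancel x y ⟨
              x + (y - x)                               ≡⟨ cong₂ _+_ x≡ eq ⟩
              base r + q * + D + z * + (D ℕ.* (periodScale k) ℕ.* w i)
                ≡⟨ cong (λ v → base r + q * + D + z * v)
                  (trans (pos-* (D ℕ.* (periodScale k)) (w i)) (cong (_* + w i) (pos-* D (periodScale k)))) ⟩
              base r + q * + D + z * (+ D * + (periodScale k) * + w i) ≡⟨ regroup (base r) q (+ D) z
                (+ (periodScale k)) (+ w i) ⟩
              base r + q′ * + D                         ∎
              where open ≡-Reasoning
            diff : ∀ y z c q a → (y + (q + z * c) * a) - (y + q * a) ≡ z * (c * a)
            diff = solve-∀
            p′ p″ : Pt
            p′ = target f i r , value₀ f i r + q * slope f i r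
            p″ = target f i r , value₀ f i r + q′ * slope f i r
            middle : Star p′ p″
            middle = refl , ∣-respʳ (sym (diff (value₀ f i r) z (+ (periodScale k) * + w i) q (slope f i r)))
                       (∣n⇒∣m*n z (slope-period f r l r<D))

        star-sol : Sol Star
        star-sol = record
          { rel-refl  = λ {p} → ker⇒star p p (ker-refl {p})
          ; rel-sym   = λ {p} {q} → star-sym p q
          ; rel-trans = λ {p} {q} {s} → star-trans p q s
          ; shift     = λ { {i} {x} {j} {y} z (eq , d) → eq , ∣-respʳ (same x y z) d }
          ; kern      = λ {i} {x} {y} d → ker⇒star (i , x) (i , y) (refl , d)
          ; congr     = λ f {p} {q} → star-congr f p q
          ; respF     = λ { (refl , _) → refl }
          }
          where
          same : ∀ x y z → y - x ≡ (y + z) - (x + z)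
          same = solve-∀

        M>0 : ∀ {i} → L′ i → 0 ℕ.< M i
        M>0 {i} l with L′? i
        ... | no ¬l = ⊥-elim (¬l l)
        ... | yes _ = ℕ.*-mono-≤ (ℕ.*-mono-≤ D>0 (periodScale>0 k)) (proj₁ weighting l)

        star-proper : Proper Star
        star-proper with start
        ... | i , l = (i , + 0) , (i , + M i) , (refl , ∣-reflexive (sym (+-identityʳ (+ M i)))) ,
          λ (_ , d) → ℕ.<⇒≢ (M>0 l) (sym (+-injective (trans (sym (+-identityʳ (+ M i)))
            (0∣⇒≡0 (subst (λ v → + v ∣ + M i - + 0) (k-large (L′⊆L l)) d)))))

        M≤ : ∀ i → M i ℕ.≤ b ℕ.+ D ℕ.* (periodScale k) ℕ.* weightBound
        M≤ i with L′? i
        ... | no _  = ℕ.≤-trans (k≤b i) (ℕ.m≤m+n b _)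
        ... | yes l = ℕ.≤-trans (ℕ.*-monoʳ-≤ (D ℕ.* (periodScale k)) (w-bound l)) (ℕ.m≤n+m _ b)

        star-bounded : BoundedBy (b ℕ.+ D ℕ.* (periodScale k) ℕ.* weightBound) Star
        star-bounded i = M i , M≤ i , proj₂ , (refl ,_)

  -- Choice of the threshold.

  private
    module H = Heights K D slopeBound D>0 (s≤s z≤n)

  cutoff : ℕ → ℕ
  cutoff zero    = sumFin K k
  cutoff (suc t) = next (cutoff t)

  cutoff-mono : ∀ {s t} → s ℕ.≤′ t → cutoff s ℕ.≤ cutoff t
  cutoff-mono ℕ.≤′-refl         = ℕ.≤-refl
  cutoff-mono (ℕ.≤′-step {t} p) = ℕ.≤-trans (cutoff-mono p) (ℕ.m≤m+n (cutoff t) (slack (cutoff t)))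

  -- The number of thresholds tried is governed by one process per period and one per ordered pair
  -- of orbits. The second summand accounts for the periods built from weights.
  periodBound : ℕ
  periodBound = cutoff (stableTime (K ℕ.* suc K)) ℕ.+ D ℕ.* periodScale k ℕ.* H.weightBound

  -- Three outcomes: the cut relation is proper; or it is trivial and no period is large, so R
  -- itself is bounded; or it is trivial and weights exist. The alternatives are undecidable, hence
  -- the form of a refutation.
  bounded-suffices : ∀ {R} → Sol R → Proper R →
    (∀ {R′} → Sol R′ → Proper R′ → BoundedBy periodBound R′ → ⊥) → ⊥
  bounded-suffices {R} sol proper none =
    ¬¬-Fin K (Relation.period-exists sol) λ periods → withPeriods (proj₁ ∘ periods) λ i → proj₂ (periods i)
    where
    withPeriods : (m : Fin K → ℕ) → (∀ i → Period R i (m i)) → ⊥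
    withPeriods m per = stabilise (K ℕ.* suc K)
      (λ t p → Close (suc t) (remQuot (suc K) p) → Close t (remQuot (suc K) p)) once
      λ (t , t≤ , stable) → withCutoff t t≤ λ p → subst (λ q → Close (suc t) q → Close t q)
        (remQuot-combine (proj₁ p) (proj₂ p)) (stable (uncurry combine p))
      where
      -- Index `zero` stands for the period of i, index `suc j` for the offsets from i to j.
      Close : ℕ → Fin K × Fin (suc K) → Set
      Close t (i , zero)  = 0 ℕ.< m i × m i ℕ.≤ cutoff t
      Close t (i , suc j) = ∃ λ e → ∣ e ∣ ℕ.≤ cutoff t × R (i , + 0) (j , e)
      close-mono : ∀ {s t} p → s ℕ.≤ t → Close s p → Close t p
      close-mono (i , zero)  s≤t (z , le)     = z , ℕ.≤-trans le (cutoff-mono (ℕ.≤⇒≤′ s≤t))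
      close-mono (i , suc j) s≤t (e , le , r) = e , ℕ.≤-trans le (cutoff-mono (ℕ.≤⇒≤′ s≤t)) , r
      once : ∀ p {s t} → s ℕ.< t → ¬ (Close (suc s) (remQuot (suc K) p) → Close s (remQuot (suc K) p)) →
             ¬ ¬ (Close (suc t) (remQuot (suc K) p) → Close t (remQuot (suc K) p))
      once p {s} {t} s<t ¬st c = ¬st λ x → ⊥-elim (c λ _ → close-mono {suc s} {t} (remQuot (suc K) p) s<t x)
      withCutoff : ∀ t → t ℕ.≤ stableTime (K ℕ.* suc K) → (∀ p → Close (suc t) p → Close t p) → ⊥
      withCutoff t t≤ stable = excluded-middle {Proper Near} λ
        { (yes proper′) → none near-sol proper′ (weaken {Near} (ℕ.m≤m+n _ _) near-bounded)
        ; (no rigid′) → excluded-middle {∃ λ i → next b ℕ.< m i} λ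
          { (no none-large) → none sol proper
            (weaken {R} (ℕ.m≤m+n _ _) λ i → m i , small none-large i , λ {x} {y} → per i)
          ; (yes start) → large (λ {p} {q} nr → rigid rigid′ p q nr) start
          }
        }
        where
        b = cutoff t
        b≤ : b ℕ.≤ cutoff (stableTime (K ℕ.* suc K))
        b≤ = cutoff-mono (ℕ.≤⇒≤′ t≤)
        k≤b : ∀ i → k i ℕ.≤ b
        k≤b i = ℕ.≤-trans (≤-sumFin k i) (cutoff-mono {0} {t} (ℕ.≤⇒≤′ z≤n))
        m-gap : ∀ i → m i ≡ 0 ⊎ (0 ℕ.< m i × m i ℕ.≤ b) ⊎ next b ℕ.< m i
        m-gap i with m i ℕ.≟ 0 | m i ℕ.≤? next b
        ... | yes z | _ = inj₁ z
        ... | no _ | no l = inj₂ (inj₂ (ℕ.≰⇒> l))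
        ... | no z | yes p = inj₂ (inj₁ (stable (i , zero) (ℕ.n≢0⇒n>0 z , p)))
        offset-gap : ∀ i j e → ∣ e ∣ ℕ.≤ next b → R (i , + 0) (j , e) → ∃ λ e′ → ∣ e′ ∣ ℕ.≤ b × R (i , + 0)
          (j , e′)
        offset-gap i j e le r = stable (i , suc j) (e , le , r)
        open Gap sol m per b k≤b m-gap offset-gap
        weaken : ∀ {R′ c} → cutoff (stableTime (K ℕ.* suc K)) ℕ.≤ c → BoundedBy b R′ → BoundedBy c R′
        weaken le bd i = let (m , m≤ , p) = bd i in m , ℕ.≤-trans m≤ (ℕ.≤-trans b≤ le) , p
        small : ¬ (∃ λ i → next b ℕ.< m i) → ∀ i → m i ℕ.≤ b
        small none-large i with m-gap i
        ... | inj₁ z        = subst (ℕ._≤ b) (sym z) z≤n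
        ... | inj₂ (inj₁ s) = proj₂ s
        ... | inj₂ (inj₂ l) = ⊥-elim (none-large (i , l))
        rigid : ¬ Proper Near → ∀ p q → Near p q → Ker p q
        rigid ¬proper p q nr with Ker? p q
        ... | yes ker = ker
        ... | no ¬ker = ⊥-elim (¬proper (p , q , nr , ¬ker))
        large : (∀ {p q} → Near p q → Ker p q) → ∃ (λ i → next b ℕ.< m i) → ⊥
        large rigid start = large-weights start conclude
          where
          open Rigid rigid
          conclude : ¬ BoundedWeighting
          conclude bw = none star-sol star-proper λ i →
            let (c , c≤ , p) = star-bounded i in c , ℕ.≤-trans c≤ (ℕ.+-monoˡ-≤ _ b≤) , λ {x} {y} → p {x} {y}
            where open FromWeights bw

-- Searching for a congruence with bounded periods

any-Vec? : ∀ {n} K {P : Vec (Fin n) K → Set} → (∀ v → Dec (P v)) → Dec (∃ P)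
any-Vec? zero    P? = map′ ([] ,_) (λ { ([] , p) → p }) (P? [])
any-Vec? (suc K) P? = map′ (λ (x , v , p) → x ∷ v , p) (λ { (x ∷ v , p) → x , v , p })
                           (Fin.any? λ x → any-Vec? K (P? ∘ (x ∷_)))

any-Env? : ∀ K {P : Env K → Set} → Def P → Dec (∃ P)
any-Env? zero    d = map′ (_ ,_) (λ (ρ , p) → def-ext d (λ ()) p) (def-dec d λ ())
any-Env? (suc K) d = map′ (λ (ρ , x , p) → extend x ρ , p)
                          (λ (ρ , p) → ρ ∘ suc , ρ zero , def-ext d (λ { zero → refl ; (suc i) → refl }) p)
                          (any-Env? K (def-∃ d))

def-diff : ∀ {n} m (a b c d : Fin n) → Def (λ ρ → + m ∣ (ρ a + ρ b) - (ρ c + ρ d))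
def-diff m a b c d = def-⇔ (λ ρ → subst (+ m ∣_) (eq ρ)) (λ ρ → subst (+ m ∣_) (sym (eq ρ))) (def-∣ m t)
  where
  sum₂ : ∀ a b → Lin _
  sum₂ a b = varₗ a +ₗ varₗ b
  t = sum₂ a b +ₗ - + 1 *ₗ sum₂ c d
  sum₂≡ : ∀ a b ρ → value (sum₂ a b) ρ ≡ ρ a + ρ b
  sum₂≡ a b ρ = trans (value-+ₗ (varₗ a) (varₗ b) ρ) (cong₂ _+_ (value-varₗ a ρ) (value-varₗ b ρ))
  eq : ∀ ρ → value t ρ ≡ (ρ a + ρ b) - (ρ c + ρ d)
  eq ρ = trans (value-+ₗ (sum₂ a b) _ ρ) (cong₂ _+_ (sum₂≡ a b ρ)
           (trans (value-*ₗ (- + 1) (sum₂ c d) ρ) (trans (-1*i≡-i _) (cong -_ (sum₂≡ c d ρ)))))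

module Search {K n : ℕ} (k : Fin K → ℕ) (g : Fin n → Fin K × ℤ → Fin K × ℤ) (F : Fin K → Bool)
  (graph : ∀ f i j → Def {2} (λ ρ → proj₁ (g f (i , ρ (suc zero))) ≡ j ×
                                    + k j ∣ ρ zero - proj₂ (g f (i , ρ (suc zero)))))
  where

  open Dynamics k g F

  -- (i , x) lies at position x + e i in the copy of ℤ/m shared by the orbits of class c i.
  Glue : (Fin K → ℕ) → (Fin K → Fin K) → (Fin K → ℤ) → Pt → Pt → Set
  Glue m c e (i , x) (j , y) = c i ≡ c j × + m i ∣ (y + e j) - (x + e i)

  Congruent : (Fin K → ℕ) → (Fin K → Fin K) → (Fin K → ℤ) → Set
  Congruent m c e = ∀ f p q → Glue m c e p q → Glue m c e (g f p) (g f q)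

  -- The conditions that do not mention offsets, checked by finite search. The last one is
  -- properness: two orbits are glued, or some period identifies more than the characteristic does.
  Admissible : (Fin K → ℕ) → (Fin K → Fin K) → Set
  Admissible m c = (∀ i → + m i ∣ + k i) × (∀ i j → c i ≡ c j → m i ≡ m j) × (∀ i j → c i ≡ c j → F i ≡ F j) ×
                   ((∃ λ i → ∃ λ j → i ≢ j × c i ≡ c j) ⊎ (∃ λ i → ¬ + k i ∣ + m i))

  admissible? : ∀ m c → Dec (Admissible m c)
  admissible? m c =
    Fin.all? (λ i → _ ∣? _) ×-dec
    Fin.all? (λ i → Fin.all? λ j → (c i ≟ᶠ c j) →-dec (m i ℕ.≟ m j)) ×-dec
    Fin.all? (λ i → Fin.all? λ j → (c i ≟ᶠ c j) →-dec (F i ≟ᵇ F j)) ×-dec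
    (Fin.any? (λ i → Fin.any? λ j → ¬? (i ≟ᶠ j) ×-dec (c i ≟ᶠ c j)) ⊎-dec Fin.any? λ i → ¬? (_ ∣? _))

  glue-sol : ∀ {m c e} → Admissible m c → Congruent m c e → Sol (Glue m c e)
  glue-sol {m} {c} {e} (m∣k , m-c , F-c , _) cong-e = record
    { rel-refl  = λ {(i , x)} → refl , divides (+ 0) (+-inverseʳ (x + e i))
    ; rel-sym   = λ { {i , x} {j , y} (eq , d) → sym eq , subst₂ (λ v w → + v ∣ w) (m-c i j eq)
      (swap (x + e i) (y + e j)) (∣m⇒∣-m d) }
    ; rel-trans = λ { {i , x} {j , y} {l , z} (eq , d) (eq′ , d′) → trans eq eq′ ,
                ∣-respʳ (telescope (x + e i) (y + e j) (z + e l))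
                  (∣m∣n⇒∣m+n d (subst (λ v → + v ∣ (z + e l) - (y + e j)) (sym (m-c i j eq)) d′)) }
    ; shift     = λ { {i} {x} {j} {y} z (eq , d) → eq , ∣-respʳ (shifted x (e i) y (e j) z) d }
    ; kern      = λ {i} {x} {y} d → refl , ∣-respʳ (same x y (e i)) (∣-trans (m∣k i) d)
    ; congr     = λ f {p} {q} → cong-e f p q
    ; respF     = λ { {i , _} {j , _} (eq , _) → F-c i j eq }
    }
    where
    swap : ∀ x y → - (y - x) ≡ x - y
    swap = solve-∀
    telescope : ∀ x y z → (y - x) + (z - y) ≡ z - x
    telescope = solve-∀
    shifted : ∀ x a y b z → (y + b) - (x + a) ≡ (y + z + b) - (x + z + a)
    shifted = solve-∀
    same : ∀ x y a → y - x ≡ (y + a) - (x + a)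
    same = solve-∀

  glue-proper : ∀ {m c e} → Admissible m c → Proper (Glue m c e)
  glue-proper {m} {c} {e} (_ , _ , _ , inj₁ (i , j , i≢j , eq)) =
    (i , - e i) , (j , - e j) , (eq , divides (+ 0) (cancel (e i) (e j))) , i≢j ∘ proj₁
    where
    cancel : ∀ a b → (- b + b) - (- a + a) ≡ + 0
    cancel = solve-∀
  glue-proper {m} {c} {e} (_ , _ , _ , inj₂ (i , ¬d)) =
    (i , + 0) , (i , + m i) , (refl , divides (+ 1) (cancel (+ m i) (e i))) , λ (_ , d) → ¬d
      (subst (+ k i ∣_) (+-identityʳ (+ m i)) d)
    where
    cancel : ∀ m a → (m + a) - (+ 0 + a) ≡ + 1 * m
    cancel = solve-∀

  Graph : Fin n → Fin K → Fin K → ℤ → ℤ → Set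
  Graph f i j y x = proj₁ (g f (i , x)) ≡ j × + k j ∣ y - proj₂ (g f (i , x))

  -- Images enter as quantified points on the graphs. These fix them only modulo the
  -- characteristics, which is harmless because the periods divide the characteristics.
  def-congruent : ∀ m c → Admissible m c → Def {K} (Congruent m c)
  def-congruent m c (m∣k , m-c , _) = def-⇔ to from
    (def-∀Fin n λ f → def-∀Fin K λ i → def-∀Fin K λ j → def-∀Fin K λ i′ → def-∀Fin K λ j′ →
      def-∀ (def-∀ (def-∀ (def-∀ (clause f i j i′ j′)))))
    where
    old : Fin K → Fin (4 ℕ.+ K)
    old i = suc (suc (suc (suc i)))
    iy′ iy ix′ ix : Fin (4 ℕ.+ K)
    iy′ = zero
    iy  = suc zero
    ix′ = suc (suc zero)
    ix  = suc (suc (suc zero))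
    pick : Fin (4 ℕ.+ K) → Fin (4 ℕ.+ K) → Fin 2 → Fin (4 ℕ.+ K)
    pick a b zero    = a
    pick a b (suc _) = b
    Clause : Fin n → (i j i′ j′ : Fin K) → Env (4 ℕ.+ K) → Set
    Clause f i j i′ j′ σ = c i ≡ c j × + m i ∣ (σ ix′ + σ (old j)) - (σ ix + σ (old i)) →
      Graph f i i′ (σ iy) (σ ix) × Graph f j j′ (σ iy′) (σ ix′) →
      c i′ ≡ c j′ × + m i′ ∣ (σ iy′ + σ (old j′)) - (σ iy + σ (old i′))
    clause : ∀ f i j i′ j′ → Def (Clause f i j i′ j′)
    clause f i j i′ j′ = def-→ (def-× (def-const (c i ≟ᶠ c j)) (def-diff (m i) ix′ (old j) ix (old i)))
      (def-→ (def-× (def-rename (pick iy ix) (graph f i i′)) (def-rename (pick iy′ ix′) (graph f j j′)))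
             (def-× (def-const (c i′ ≟ᶠ c j′)) (def-diff (m i′) iy′ (old j′) iy (old i′))))
    env : ℤ → ℤ → ℤ → ℤ → Env K → Env (4 ℕ.+ K)
    env x x′ y y′ ρ = extend y′ (extend y (extend x′ (extend x ρ)))
    to : ∀ ρ → (∀ f i j i′ j′ x x′ y y′ → Clause f i j i′ j′ (env x x′ y y′ ρ)) → Congruent m c ρ
    to ρ h f (i , x) (j , x′) gl = h f i j _ _ x x′ (proj₂ (g f (i , x))) (proj₂ (g f (j , x′))) gl
      ((refl , divides (+ 0) (+-inverseʳ (proj₂ (g f (i , x))))) ,
        (refl , divides (+ 0) (+-inverseʳ (proj₂ (g f (j , x′))))))
    from : ∀ ρ → Congruent m c ρ → ∀ f i j i′ j′ x x′ y y′ → Clause f i j i′ j′ (env x x′ y y′ ρ)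
    from ρ cong-e f i j i′ j′ x x′ y y′ gl ((refl , d) , (refl , d′)) with cong-e f (i , x) (j , x′) gl
    ... | eq , e = eq , ∣-respʳ (mix y y′ y₀ y₀′ (ρ i′) (ρ j′)) (∣m∣n⇒∣m-n (∣m∣n⇒∣m+n e
                     (subst (λ v → + v ∣ y′ - y₀′) (sym (m-c i′ j′ eq)) (∣-trans (m∣k j′) d′)))
                       (∣-trans (m∣k i′) d))
      where
      y₀ = proj₂ (g f (i , x))
      y₀′ = proj₂ (g f (j , x′))
      mix : ∀ y y′ u u′ a b → ((u′ + b) - (u + a)) + (y′ - u′) - (y - u) ≡ (y′ + b) - (y + a)
      mix = solve-∀

  Candidate : ℕ → Set
  Candidate B = ∃ λ (ms : Vec (Fin (suc B)) K) → ∃ λ (cs : Vec (Fin K) K) →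
    Admissible (toℕ ∘ Vec.lookup ms) (Vec.lookup cs) × ∃ (Congruent (toℕ ∘ Vec.lookup ms) (Vec.lookup cs))

  candidate? : ∀ B → Dec (Candidate B)
  candidate? B = any-Vec? K λ ms → any-Vec? K λ cs → decide (toℕ ∘ Vec.lookup ms) (Vec.lookup cs)
    where
    decide : ∀ m c → Dec (Admissible m c × ∃ (Congruent m c))
    decide m c with admissible? m c
    ... | no ¬a = no (¬a ∘ proj₁)
    ... | yes a = map′ (a ,_) proj₂ (any-Env? K (def-congruent m c a))

  -- The class of i is named by the orbit of least index linked to i, and e i is the displacement of
  -- a related point there.
  candidate-complete : ∀ {B R} → Sol R → Proper R → BoundedBy B R → ¬ ¬ Candidate B
  candidate-complete {B} {R} sol proper bounded contra = ¬¬-Fin K representative λ reps →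
    contra (fromVectors (Vec.tabulate (proj₁ ∘ residueOf)) (Vec.tabulate (proj₁ ∘ reps))
      (λ i → subst (λ v → Period R i (toℕ v)) (sym (lookup∘tabulate (proj₁ ∘ residueOf) i))
        (proj₂ (residueOf i)))
      (λ i → subst (Representative i) (sym (lookup∘tabulate (proj₁ ∘ reps) i)) (proj₂ (reps i))))
    where
    open Relation sol using (rel-refl; rel-sym; rel-trans; shift; kern; congr; respF; move)
    residueOf : ∀ i → ∃ λ (m : Fin (suc B)) → Period R i (toℕ m)
    residueOf i with bounded i
    ... | m , m≤B , p = fromℕ< (s≤s m≤B) , subst (λ m → Period R i m) (sym (toℕ-fromℕ< (s≤s m≤B))) p
    Linked : Fin K → Fin K → Set
    Linked i j = ∃ λ e → R (i , + 0) (j , e)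
    Representative : Fin K → Fin K → Set
    Representative i c = Linked i c × (∀ j → toℕ j ℕ.< toℕ c → ¬ Linked i j)
    representative : ∀ i → ¬ ¬ (∃ (Representative i))
    representative i no-rep = ¬¬-least {λ v → ∃ λ j → toℕ j ≡ v × Linked i j} (toℕ i)
      (i , refl , + 0 , rel-refl)
      λ { (_ , _ , (j , refl , l) , least) → no-rep (j , l , λ j′ lt l′ → least (toℕ j′) lt (j′ , refl , l′)) }
    fromVectors : (ms : Vec (Fin (suc B)) K) (cs : Vec (Fin K) K) →
                  (∀ i → Period R i (toℕ (Vec.lookup ms i))) → (∀ i → Representative i (Vec.lookup cs i)) →
                    Candidate B
    fromVectors ms cs per rep = ms , cs ,
      (m∣k , (λ i j eq → m≡ (linked i j eq)) , (λ i j eq → respF (linked i j eq)) , properness proper) ,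
      e , λ f p q gl → R⇒glue (congr f (glue⇒R {p} {q} gl))
      where
      m : Fin K → ℕ
      m = toℕ ∘ Vec.lookup ms
      c : Fin K → Fin K
      c = Vec.lookup cs
      e : Fin K → ℤ
      e i = proj₁ (proj₁ (rep i))
      open Periodic sol m per using (m≡; m∣k; R⇒∣; ∣⇒R)
      to-class : ∀ i x → R (i , x) (c i , x + e i)
      to-class i x = move x (x + e i) (diff x (e i)) (proj₂ (proj₁ (rep i)))
        where
        diff : ∀ x e → (x + e) - x ≡ e - + 0
        diff = solve-∀
      linked⇒≮ : ∀ {i x j y} → R (i , x) (j , y) → ¬ toℕ (c i) ℕ.< toℕ (c j)
      linked⇒≮ {i} {x} {j} {y} r lt = proj₂ (rep j) (c i) lt (((x + e i) - y) ,
        move (+ 0) ((x + e i) - y) (diff x (e i) y) (rel-trans (rel-sym r) (to-class i x)))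
        where
        diff : ∀ x e y → ((x + e) - y) - + 0 ≡ (x + e) - y
        diff = solve-∀
      c≡ : ∀ {i x j y} → R (i , x) (j , y) → c i ≡ c j
      c≡ r = Fin.toℕ-injective (ℕ.≤-antisym (ℕ.≮⇒≥ (linked⇒≮ (rel-sym r))) (ℕ.≮⇒≥ (linked⇒≮ r)))
      R⇒glue : ∀ {p q} → R p q → Glue m c e p q
      R⇒glue {i , x} {j , y} r = c≡ r , subst (λ v → + v ∣ (y + e j) - (x + e i)) (sym (m≡ (to-class i x)))
        (R⇒∣ (rel-trans (rel-sym (to-class i x))
          (rel-trans r (subst (λ l → R (j , y) (l , y + e j)) (sym (c≡ r)) (to-class j y)))))
      glue⇒R : ∀ {p q} → Glue m c e p q → R p q
      glue⇒R {i , x} {j , y} (eq , d) = rel-trans (to-class i x)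
        (rel-trans (∣⇒R (subst (λ v → + v ∣ (y + e j) - (x + e i)) (m≡ (to-class i x)) d))
        (rel-sym (subst (λ l → R (j , y) (l , y + e j)) (sym eq) (to-class j y))))
      linked : ∀ i j → c i ≡ c j → R (i , + 0 - e i) (j , + 0 - e j)
      linked i j eq = glue⇒R (eq , divides (+ 0) (cancel (e i) (e j)))
        where
        cancel : ∀ a b → (+ 0 - b + b) - (+ 0 - a + a) ≡ + 0
        cancel = solve-∀
      properness : Proper R → (∃ λ i → ∃ λ j → i ≢ j × c i ≡ c j) ⊎ (∃ λ i → ¬ + k i ∣ + m i)
      properness ((i , x) , (j , y) , r , ¬ker) with i ≟ᶠ j
      ... | no i≢j   = inj₁ (i , j , i≢j , c≡ r)
      ... | yes refl = inj₂ (i , λ d → ¬ker (refl , ∣-trans d (R⇒∣ r)))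

-- From the pulled back relations to the given set

proj-cong : ∀ k {x y} → + k ∣ y - x → proj k x ≡ proj k y
proj-cong zero    {x} {y} d = sym (i-j≡0⇒i≡j y x (0∣⇒≡0 d))
proj-cong (suc k) {x} {y} d = Fin.toℕ-injective (begin
  toℕ (proj (suc k) x)  ≡⟨ toℕ-fromℕ< (n%ℕd<d x (suc k)) ⟩
  x %ℕ suc k            ≡⟨ residue-unique (n%ℕd<d x (suc k)) (n%ℕd<d y (suc k)) residues ⟩
  y %ℕ suc k            ≡⟨ toℕ-fromℕ< (n%ℕd<d y (suc k)) ⟨
  toℕ (proj (suc k) y)  ∎)
  where
  open ≡-Reasoning
  isolate : ∀ a q a′ q′ m → (q′ - q) * m - ((a′ + q′ * m) - (a + q * m)) ≡ a - a′
  isolate = solve-∀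
  residues : + suc k ∣ + (x %ℕ suc k) - + (y %ℕ suc k)
  residues = ∣-respʳ (isolate (+ (x %ℕ suc k)) (x /ℕ suc k) (+ (y %ℕ suc k)) (y /ℕ suc k) (+ suc k))
    (∣m∣n⇒∣m-n (divides (y /ℕ suc k - x /ℕ suc k) refl)
      (subst₂ (λ u v → + suc k ∣ u - v) (a≡a%ℕn+[a/ℕn]*n y (suc k)) (a≡a%ℕn+[a/ℕn]*n x (suc k)) d))

proj-injective : ∀ k {x y} → proj k x ≡ proj k y → + k ∣ y - x
proj-injective zero    {x} refl = divides (+ 0) (+-inverseʳ x)
proj-injective (suc k) {x} {y} eq = divides (y /ℕ suc k - x /ℕ suc k) (begin
  y - x                                   ≡⟨ cong₂ _-_ (a≡a%ℕn+[a/ℕn]*n y (suc k)) (a≡a%ℕn+[a/ℕn]*n x (suc k)) ⟩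
  (+ (y %ℕ suc k) + y /ℕ suc k * + suc k) - (+ (x %ℕ suc k) + x /ℕ suc k * + suc k)
    ≡⟨ cong (λ v → (+ v + y /ℕ suc k * + suc k) - (+ (x %ℕ suc k) + x /ℕ suc k * + suc k)) same ⟩
  (+ (x %ℕ suc k) + y /ℕ suc k * + suc k) - (+ (x %ℕ suc k) + x /ℕ suc k * + suc k)
    ≡⟨ collect (+ (x %ℕ suc k)) (y /ℕ suc k) (x /ℕ suc k) (+ suc k) ⟩
  (y /ℕ suc k - x /ℕ suc k) * + suc k     ∎)
  where
  open ≡-Reasoning
  collect : ∀ r q q′ m → (r + q * m) - (r + q′ * m) ≡ (q - q′) * m
  collect = solve-∀
  same : y %ℕ suc k ≡ x %ℕ suc k
  same = trans (sym (toℕ-fromℕ< (n%ℕd<d y (suc k)))) (trans (cong toℕ (sym eq)) (toℕ-fromℕ< (n%ℕd<d x (suc k))))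

proj-rep : ∀ k a → proj k (rep k a) ≡ a
proj-rep zero    a = refl
proj-rep (suc k) a = Fin.toℕ-injective
  (trans (toℕ-fromℕ< (n%ℕd<d (+ toℕ a) (suc k))) (ℕ.m<n⇒m%n≡m (Fin.toℕ<n a)))

rep-proj : ∀ k x → + k ∣ rep k (proj k x) - x
rep-proj k x = proj-injective k (sym (proj-rep k (proj k x)))

rep-normal : ∀ k a → Normal k (rep k a)
rep-normal zero    a = inj₁ refl
rep-normal (suc k) a = inj₂ (toℕ a , Fin.toℕ<n a , refl)

module Translation (ks : List ℕ) (F : Q ks → Bool) (F-equi : EquivariantSubset ks F)
                   (n : ℕ) (δ : Fin n → SemilinearFun ks) where

  private
    K = length ks

  k : Fin K → ℕ
  k = lookup ks

  apply : Fin n → Q ks → Q ks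
  apply f = SemilinearFun.fun (δ f)

  lift : Q ks → Fin K × ℤ
  lift (i , a) = i , rep (k i) a

  lower′ : Fin K × ℤ → Q ks
  lower′ (i , x) = elem ks i x

  g : Fin n → Fin K × ℤ → Fin K × ℤ
  g f p = lift (apply f (lower′ p))

  F̂ : Fin K → Bool
  F̂ i = F (elem ks i (+ 0))

  open Dynamics k g F̂

  lower-lift : ∀ p → lower′ (lift p) ≡ p
  lower-lift (i , a) = cong (i ,_) (proj-rep (k i) a)

  ker⇒≡ : ∀ p q → Ker p q → lower′ p ≡ lower′ q
  ker⇒≡ (i , x) (_ , y) (refl , d) = cong (i ,_) (proj-cong (k i) d)

  ≡⇒ker : ∀ p q → lower′ p ≡ lower′ q → Ker p q
  ≡⇒ker (i , x) (j , y) eq = go refl refl eq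
    where
    go : ∀ {i j x y a b} → proj (k i) x ≡ a → proj (k j) y ≡ b → _≡_ {A = Q ks} (i , a) (j , b) → i ≡ j ×
      + k i ∣ y - x
    go {i} p q refl = refl , proj-injective (k i) (trans p (sym q))

  lower-act : ∀ z i x → act ks z (elem ks i x) ≡ elem ks i (x + z)
  lower-act z i x = cong (i ,_) (proj-cong (k i) (∣-respʳ (swap x z (rep (k i) (proj (k i) x)))
    (∣m⇒∣-m (rep-proj (k i) x))))
    where
    swap : ∀ x z r → - (r - x) ≡ (x + z) - (z + r)
    swap = solve-∀

  F-lower : ∀ i x → F (elem ks i x) ≡ F̂ i
  F-lower i x = trans (cong F (trans (cong (elem ks i) (sym (+-identityˡ x))) (sym (lower-act x i (+ 0)))))
    (F-equi x (elem ks i (+ 0)))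

  g-periodic : ∀ f i {x y} → + k i ∣ y - x → g f (i , x) ≡ g f (i , y)
  g-periodic f i {x} {y} d = cong (lift ∘ apply f) (ker⇒≡ (i , x) (i , y) (refl , d))

  g-normal : ∀ f i x → Normal (k (proj₁ (g f (i , x)))) (proj₂ (g f (i , x)))
  g-normal f i x = rep-normal (k _) (proj₂ (apply f (elem ks i x)))

  graph : ∀ f i j → Def {2} (λ ρ → proj₁ (g f (i , ρ (suc zero))) ≡ j ×
                                   + k j ∣ ρ zero - proj₂ (g f (i , ρ (suc zero))))
  graph f i j = def-⇔ to from (def-rename flip (presburger φ))
    where
    open SemilinearFun (δ f) using (descr; defines)
    φ = descr i j
    -- The description puts x first; here y comes first, as the variable whose boundary lines are
    -- computed.
    flip : Fin 2 → Fin 2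
    flip zero    = suc zero
    flip (suc _) = zero
    flipped : ∀ ρ v → ρ (flip v) ≡ env2 (ρ (suc zero)) (ρ zero) v
    flipped ρ zero       = refl
    flipped ρ (suc zero) = refl
    to : ∀ ρ → ⟦ φ ⟧ (ρ ∘ flip) → proj₁ (g f (i , ρ (suc zero))) ≡ j × + k j ∣ ρ zero - proj₂
      (g f (i , ρ (suc zero)))
    to ρ p = let (eq , d) = ≡⇒ker (g f (i , ρ (suc zero))) (j , ρ zero) (trans (lower-lift (apply f (elem ks i (ρ (suc zero)))))
                              (proj₂ (defines i j (ρ (suc zero)) (ρ zero))
                                (def-ext (presburger φ) (flipped ρ) p)))
             in eq , subst (λ l → + k l ∣ ρ zero - proj₂ (g f (i , ρ (suc zero)))) eq d
    from : ∀ ρ → proj₁ (g f (i , ρ (suc zero))) ≡ j × + k j ∣ ρ zero - proj₂ (g f (i , ρ (suc zero))) →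
      ⟦ φ ⟧ (ρ ∘ flip)
    from ρ (eq , d) = def-ext (presburger φ) (sym ∘ flipped ρ) (proj₁ (defines i j (ρ (suc zero)) (ρ zero))
      (trans (sym (lower-lift (apply f (elem ks i (ρ (suc zero))))))
        (ker⇒≡ (g f (i , ρ (suc zero))) (j , ρ zero)
        (eq , subst (λ l → + k l ∣ ρ zero - proj₂ (g f (i , ρ (suc zero)))) (sym eq) d))))

  open Search k g F̂ graph

  pullback : ∀ {R} → IsEquivalence R → RespectsF ks F R → Congruence ks n δ R → EquivariantRel ks R →
             Sol (λ p q → R (lower′ p) (lower′ q))
  pullback {R} eqv respects congruence equivariant = record
    { rel-refl  = IsEquivalence.refl eqv
    ; rel-sym   = IsEquivalence.sym eqv
    ; rel-trans = IsEquivalence.trans eqv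
    ; shift     = λ {i} {x} {j} {y} z r → subst₂ R (lower-act z i x) (lower-act z j y)
      (proj₁ (equivariant z (elem ks i x) (elem ks j y)) r)
    ; kern      = λ {i} {x} {y} d → subst (R (elem ks i x)) (ker⇒≡ (i , x) (i , y) (refl , d))
      (IsEquivalence.refl eqv)
    ; congr     = λ f {p} {q} r → subst₂ R (sym (lower-lift (apply f (lower′ p))))
      (sym (lower-lift (apply f (lower′ q)))) (congruence f (lower′ p) (lower′ q) r)
    ; respF     = λ { {i , x} {j , y} r → trans (sym (F-lower i x))
      (trans (same (F (elem ks i x)) (F (elem ks j y)) (respects (elem ks i x) (elem ks j y) r))
        (F-lower j y)) }
    }
    where
    same : ∀ a b → (a ≡ true → b ≡ true) × (b ≡ true → a ≡ true) → a ≡ b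
    same true  b     (f , _) = sym (f refl)
    same false true  (_ , f) = f refl
    same false false _       = refl

  -- Representatives commute with the action only modulo the characteristics; `kern` absorbs the
  -- difference.
  pushforward : ∀ {R} → Sol R → Proper R → GoodCongruenceExists ks F n δ
  pushforward {R} sol (p , q , r , ¬ker) = (λ p q → R (lift p) (lift q)) ,
    record { refl = rel-refl ; sym = rel-sym ; trans = rel-trans } ,
    (lower′ p , lower′ q , ¬ker ∘ ≡⇒ker p q , rel-trans (settle p) (rel-trans r (rel-sym (settle q)))) ,
    (λ p q r → subst (_≡ true) (F-lift r) , subst (_≡ true) (sym (F-lift r))) ,
    (λ f p q r → subst₂ (λ p q → R (lift (apply f p)) (lift (apply f q))) (lower-lift p) (lower-lift q)
      (congr f r)) ,
    λ z p q → (λ r → rel-trans (acted z p) (rel-trans (shift z r) (rel-sym (acted z q)))) ,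
              λ r → subst₂ R (unshift z (lift p)) (unshift z (lift q))
                (shift (- z) (rel-trans (rel-sym (acted z p)) (rel-trans r (acted z q))))
    where
    open Sol sol
    translate : ℤ → Fin K × ℤ → Fin K × ℤ
    translate z (i , x) = i , x + z
    settle : ∀ p → R (lift (lower′ p)) p
    settle (i , x) = rel-sym (kern (rep-proj (k i) x))
    acted : ∀ z p → R (lift (act ks z p)) (translate z (lift p))
    acted z (i , a) = subst (λ v → R (lift (act ks z (i , a))) (i , v)) (+-comm z (rep (k i) a))
      (settle (i , z + rep (k i) a))
    cancel : ∀ x z → x + z + - z ≡ x
    cancel = solve-∀
    unshift : ∀ z p → translate (- z) (translate z p) ≡ p
    unshift z (i , x) = cong (i ,_) (cancel x z)
    F-lift : ∀ {p q} → R (lift p) (lift q) → F p ≡ F q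
    F-lift {p@(i , a)} {q@(j , b)} r = trans (cong F (sym (lower-lift p)))
      (trans (F-lower i (rep (k i) a)) (trans (respF r)
      (trans (sym (F-lower j (rep (k j) b))) (cong F (lower-lift q)))))

  -- A successful search yields a witness directly; a failed one refutes every congruence, for which
  -- the doubly negated completeness is strong enough.
  decide-below : ∀ B → (∀ {R} → Sol R → Proper R → (∀ {R′} → Sol R′ → Proper R′ → BoundedBy B R′ → ⊥) → ⊥) →
                 Dec (GoodCongruenceExists ks F n δ)
  decide-below B suffices with candidate? B
  ... | yes (ms , cs , adm , e , cong-e) = yes (pushforward (glue-sol adm cong-e) (glue-proper {e = e} adm))
  ... | no none = no λ (R , eqv , (p , q , p≢q , r) , respects , congruence , equivariant) →
    suffices (pullback eqv respects congruence equivariant)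
      (lift p , lift q , subst₂ R (sym (lower-lift p)) (sym (lower-lift q)) r ,
       λ ker → p≢q (trans (sym (lower-lift p)) (trans (ker⇒≡ (lift p) (lift q) ker) (lower-lift q))))
      λ sol proper bounded → candidate-complete sol proper bounded none

  decide : Dec (GoodCongruenceExists ks F n δ)
  decide = decide-below periodBound bounded-suffices
    where
    module R = Rays k g graph g-normal
    open Flow k g F̂ R.N R.D R.D>0 R.ray-exists g-periodic using (periodBound; bounded-suffices)

theorem7 : (ks : List ℕ) (F : Q ks → Bool) → EquivariantSubset ks F →
    (n : ℕ) (δ : Fin n → SemilinearFun ks) →
    Dec (GoodCongruenceExists ks F n δ)
theorem7 ks F F-equi n δ = Translation.decide ks F F-equi n δ
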